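{- Let $k\ge 2$ be an even integer and let $H$ be a graph. Then there exists some $\delta>0$ such that $\mathrm{ex}(n,H^{k-1})=O(n^{1+2/k-\delta})$ as $n\to\infty$.
   Context: For a graph $F$, $\mathrm{ex}(n,F)$ is the maximum number of edges in an $n$-vertex graph containing no copy of $F$ as a subgraph. $H^{k-1}$ is the $(k-1)$-subdivision of $H$, i.e. the graph obtained by replacing the edges of $H$ by internally disjoint paths of length $k$. $H$ is a fixed finite simple graph (not necessarily bipartite), and the implied constant may depend on $H$ and $k$. -}

module Defs where

open import Data.Bool.Base using (Bool; true; false; T; not; _∧_; _∨_)
import Data.Bool.Properties as Bool
open import Data.Fin.Base as Fin
  using (Fin; zero; suc; toℕ; inject₁; _↑ˡ_; _↑ʳ_; splitAt; combine; finToFun; funToFin)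
import Data.Fin.Properties as Fin
open import Data.Integer.Base using (+_; -[1+_])
open import Data.List.Base
  using (List; length; lookup; filter; map; allFin; cartesianProduct)
open import Data.List.Extrema.Nat using (max; xs≤max; argmax-sel)
open import Data.List.Membership.Propositional using (_∈_)
open import Data.List.Membership.Propositional.Properties
  using (∈-filter⁺; ∈-filter⁻; ∈-map⁺; ∈-map⁻; ∈-allFin; ∈-lookup)
open import Data.List.Properties using (filter-≐)
import Data.List.Relation.Unary.All as All
open import Data.Nat.Base using (ℕ; suc; _+_; _*_; _^_; _≤_)
import Data.Nat.Properties as ℕ
open import Data.Product.Base using (_×_; _,_; proj₁; proj₂; ∃; ∃-syntax)
open import Data.Rational.Unnormalised.Base using (ℚᵘ; ↥_; ↧ₙ_)
open import Data.Sum.Base using (_⊎_; inj₁; inj₂; [_,_]′; swap)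
open import Function.Base using (_∘_; id)
open import Function.Bundles using (Inverse; mk⇔)
open import Function.Definitions using (Injective)
open import Relation.Binary.PropositionalEquality
open import Relation.Nullary.Decidable
  using ( Dec; yes; no; ⌊_⌋; T?; map′; ¬?; _×-dec_; _⊎-dec_; _→-dec_
        ; dec-false; isYes≗does; does-⇔)
open import Relation.Nullary.Negation.Core using (¬_; contradiction)

record Graph (n : ℕ) : Set where
  field
    adj    : Fin n → Fin n → Bool
    symm   : ∀ u v → adj u v ≡ adj v u
    irrefl : ∀ v → adj v v ≡ false

  Adj : Fin n → Fin n → Set
  Adj u v = T (adj u v)

open Graph public

module _ {n : ℕ} where

  -- Each edge {u , v} is listed exactly once, as (u , v) with u < v.
  IsEdge : Graph n → Fin n × Fin n → Set
  IsEdge G (u , v) = u Fin.< v × Adj G u v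

  isEdge? : ∀ G e → Dec (IsEdge G e)
  isEdge? G (u , v) = (u Fin.<? v) ×-dec T? (adj G u v)

  edges : Graph n → List (Fin n × Fin n)
  edges G = filter (isEdge? G) (cartesianProduct (allFin n) (allFin n))

  ∣E∣ : Graph n → ℕ
  ∣E∣ G = length (edges G)

IsCopy : ∀ {m n} → Graph m → Graph n → (Fin m → Fin n) → Set
IsCopy F G f = Injective _≡_ _≡_ f × (∀ u v → Adj F u v → Adj G (f u) (f v))

-- F occurs in G as a (not necessarily induced) subgraph.
Contains : ∀ {m n} → Graph m → Graph n → Set
Contains F G = ∃ (IsCopy F G)

Free : ∀ {m n} → Graph m → Graph n → Set
Free F G = ¬ Contains F G

module _ {m n : ℕ} (F : Graph m) (G : Graph n) where

  isCopy? : ∀ f → Dec (IsCopy F G f)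
  isCopy? f = injective? ×-dec
      Fin.all? λ u → Fin.all? λ v → T? (adj F u v) →-dec T? (adj G (f u) (f v))
    where
    injective? : Dec (Injective _≡_ _≡_ f)
    injective? = map′ (λ inj {u} {v} → inj u v) (λ inj u v → inj)
      (Fin.all? λ u → Fin.all? λ v → (f u Fin.≟ f v) →-dec (u Fin.≟ v))

  IsCopy-resp-≗ : ∀ {f g} → f ≗ g → IsCopy F G f → IsCopy F G g
  IsCopy-resp-≗ f≗g (inj , hom) =
    (λ {u} {v} eq → inj (trans (f≗g u) (trans eq (sym (f≗g v))))) ,
    (λ u v a → subst₂ (Adj G) (f≗g u) (f≗g v) (hom u v a))

  contains? : Dec (Contains F G)
  contains? = map′
    (λ (c , p) → finToFun c , p)
    (λ (f , p) → funToFin f , IsCopy-resp-≗ (sym ∘ Fin.finToFun-funToFin f) p)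
    (Fin.any? (λ c → isCopy? (finToFun c)))

  free? : Dec (Free F G)
  free? = ¬? contains?

module _ {n : ℕ} where

  -- The diagonal of the matrix is discarded and its two triangles are merged.
  fromMatrix : (Fin n → Fin n → Bool) → Graph n
  fromMatrix M = record
    { adj    = λ u v → not ⌊ u Fin.≟ v ⌋ ∧ (M u v ∨ M v u)
    ; symm   = λ u v → cong₂ (λ a b → not a ∧ b) (≟-sym u v) (Bool.∨-comm (M u v) (M v u))
    ; irrefl = λ v → cong (λ a → not a ∧ (M v v ∨ M v v)) (≟-refl v)
    }
    where
    ≟-sym : ∀ (u v : Fin n) → ⌊ u Fin.≟ v ⌋ ≡ ⌊ v Fin.≟ u ⌋
    ≟-sym u v with u Fin.≟ v | v Fin.≟ u
    ... | yes _ | yes _ = refl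
    ... | no _  | no _  = refl
    ... | yes p | no ¬q = contradiction (sym p) ¬q
    ... | no ¬p | yes q = contradiction (sym q) ¬p

    ≟-refl : ∀ (v : Fin n) → ⌊ v Fin.≟ v ⌋ ≡ true
    ≟-refl v with v Fin.≟ v
    ... | yes _ = refl
    ... | no ¬p = contradiction refl ¬p

  fromCode : Fin (2 ^ (n * n)) → Graph n
  fromCode c = fromMatrix λ u v → Inverse.to Fin.2↔Bool (finToFun c (combine u v))

  allGraphs : List (Graph n)
  allGraphs = map fromCode (allFin (2 ^ (n * n)))

-- The maximum over the empty list is 0. This only matters when every graph on n
-- vertices contains F, which for F with at least one edge never happens.
ex : ∀ {m} → ℕ → Graph m → ℕ
ex n F = max 0 (map ∣E∣ (filter (free? F) (allGraphs {n})))

-- ex n F is attained by, and bounds, all F-free graphs on Fin n (not just those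
-- literally of the form fromCode c).
module _ {n : ℕ} where

  infix 4 _≐ᴳ_
  _≐ᴳ_ : Graph n → Graph n → Set
  G ≐ᴳ G′ = ∀ u v → adj G u v ≡ adj G′ u v

  ∣E∣-resp-≐ᴳ : ∀ {G G′} → G ≐ᴳ G′ → ∣E∣ G ≡ ∣E∣ G′
  ∣E∣-resp-≐ᴳ {G} {G′} G≐G′ = cong length
    (filter-≐ (isEdge? G) (isEdge? G′)
      ( (λ {(u , v)} (u<v , a) → u<v , subst T (G≐G′ u v) a)
      , (λ {(u , v)} (u<v , a) → u<v , subst T (sym (G≐G′ u v)) a))
      (cartesianProduct (allFin n) (allFin n)))

  Free-resp-≐ᴳ : ∀ {m} {F : Graph m} {G G′} → G ≐ᴳ G′ → Free F G → Free F G′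
  Free-resp-≐ᴳ G≐G′ free (f , inj , hom) =
    free (f , inj , λ u v a → subst T (sym (G≐G′ (f u) (f v))) (hom u v a))

  allGraphs-complete : ∀ G → ∃[ G′ ] (G′ ∈ allGraphs × G ≐ᴳ G′)
  allGraphs-complete G = fromCode code , ∈-map⁺ fromCode (∈-allFin code) , G≐
    where
    bit : Fin n × Fin n → Fin 2
    bit (u , v) = Inverse.from Fin.2↔Bool (adj G u v)

    code : Fin (2 ^ (n * n))
    code = funToFin (bit ∘ Fin.remQuot n)

    decode : ∀ u v → Inverse.to Fin.2↔Bool (finToFun code (combine u v)) ≡ adj G u v
    decode u v = trans
      (cong (Inverse.to Fin.2↔Bool)
        (trans (Fin.finToFun-funToFin (bit ∘ Fin.remQuot n) (combine u v))
               (cong bit (Fin.remQuot-combine u v))))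
      (Inverse.strictlyInverseˡ Fin.2↔Bool (adj G u v))

    G≐ : G ≐ᴳ fromCode code
    G≐ u v rewrite decode u v | decode v u | symm G v u | Bool.∨-idem (adj G u v)
      with u Fin.≟ v
    ... | yes refl = irrefl G u
    ... | no _     = refl

  ex-upper : ∀ {m} {F : Graph m} {G : Graph n} → Free F G → ∣E∣ G ≤ ex n F
  ex-upper {F = F} {G} free with allGraphs-complete G
  ... | G′ , G′∈ , G≐ = subst (_≤ ex n F) (sym (∣E∣-resp-≐ᴳ {G} {G′} G≐))
    (All.lookup (xs≤max 0 _)
      (∈-map⁺ ∣E∣ (∈-filter⁺ (free? F) G′∈ (Free-resp-≐ᴳ {F = F} {G} {G′} G≐ free))))

  ex-attained : ∀ {m} {F : Graph m} {G : Graph n} → Free F G →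
                ∃[ G′ ] (Free F G′ × ∣E∣ {n} G′ ≡ ex n F)
  ex-attained {F = F} {G} free
    with argmax-sel id 0 (map ∣E∣ (filter (free? F) (allGraphs {n})))
  ... | inj₁ ex≡0 = G , free , trans
          (ℕ.n≤0⇒n≡0 (subst (∣E∣ G ≤_) ex≡0 (ex-upper {F = F} {G} free))) (sym ex≡0)
  ... | inj₂ ex∈ with ∈-map⁻ ∣E∣ ex∈
  ...   | G′ , G′∈ , ex≡ =
          G′ , proj₂ (∈-filter⁻ (free? F) {xs = allGraphs} G′∈) , sym ex≡

-- H^s: every edge of H is replaced by a path with s internal vertices (so of
-- length s + 1). The vertices are those of H followed by s new ones per edge.
module _ {h : ℕ} (H : Graph h) (s : ℕ) where

  SubdivisionVertex : Set
  SubdivisionVertex = Fin (h + ∣E∣ H * s)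

  ends : Fin (∣E∣ H) → Fin h × Fin h
  ends = lookup (edges H)

  branch : Fin h → SubdivisionVertex
  branch u = u ↑ˡ (∣E∣ H * s)

  internal : Fin (∣E∣ H) → Fin s → SubdivisionVertex
  internal e q = h ↑ʳ combine e q

  -- pathVertex e p is the p-th vertex, 0 ≤ p ≤ s + 1, of the path replacing the edge e.
  pathVertex : Fin (∣E∣ H) → Fin (suc (s + 1)) → SubdivisionVertex
  pathVertex e zero    = branch (proj₁ (ends e))
  pathVertex e (suc p) =
    [ internal e , (λ _ → branch (proj₂ (ends e))) ]′ (splitAt s p)

  Consecutive : SubdivisionVertex → SubdivisionVertex → Set
  Consecutive x y = ∃[ e ] ∃[ p ] (x ≡ pathVertex e (inject₁ p) × y ≡ pathVertex e (suc p))

  consecutive? : ∀ x y → Dec (Consecutive x y)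
  consecutive? x y = Fin.any? λ e → Fin.any? λ p →
    (x Fin.≟ pathVertex e (inject₁ p)) ×-dec (y Fin.≟ pathVertex e (suc p))

  edge-< : ∀ e → proj₁ (ends e) Fin.< proj₂ (ends e)
  edge-< e = proj₁ (proj₂ (∈-filter⁻ (isEdge? H)
    {xs = cartesianProduct (allFin h) (allFin h)} (∈-lookup {xs = edges H} e)))

  branch-injective : ∀ {u v} → branch u ≡ branch v → u ≡ v
  branch-injective = Fin.↑ˡ-injective (∣E∣ H * s) _ _

  branch≢internal : ∀ {u e q} → branch u ≢ internal e q
  branch≢internal {u} {e} {q} eq with trans (sym (Fin.splitAt-↑ˡ h u (∣E∣ H * s)))
    (trans (cong (splitAt h) eq) (Fin.splitAt-↑ʳ h (∣E∣ H * s) (combine e q)))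
  ... | ()

  internal-injective : ∀ {e q r} → internal e q ≡ internal e r → q ≡ r
  internal-injective {e} {q} {r} =
    Fin.combine-injectiveʳ e q e r ∘ Fin.↑ʳ-injective h _ _

  pathVertex-injective : ∀ e {p q} → pathVertex e p ≡ pathVertex e q → p ≡ q
  pathVertex-injective e {zero} {zero} _ = refl
  pathVertex-injective e {zero} {suc q} eq with splitAt s q
  ... | inj₁ _ = contradiction eq branch≢internal
  ... | inj₂ _ = contradiction (branch-injective eq) (Fin.<⇒≢ (edge-< e))
  pathVertex-injective e {suc p} {zero} eq with splitAt s p
  ... | inj₁ _ = contradiction (sym eq) branch≢internal
  ... | inj₂ _ = contradiction (sym (branch-injective eq)) (Fin.<⇒≢ (edge-< e))
  pathVertex-injective e {suc p} {suc q} eq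
    with splitAt s p in eqp | splitAt s q in eqq
  ... | inj₁ a    | inj₁ b    = cong suc (trans (sym (Fin.splitAt⁻¹-↑ˡ eqp))
          (trans (cong (_↑ˡ 1) (internal-injective eq)) (Fin.splitAt⁻¹-↑ˡ eqq)))
  ... | inj₂ zero | inj₂ zero =
          cong suc (trans (sym (Fin.splitAt⁻¹-↑ʳ eqp)) (Fin.splitAt⁻¹-↑ʳ eqq))
  ... | inj₁ _    | inj₂ _    = contradiction (sym eq) branch≢internal
  ... | inj₂ _    | inj₁ _    = contradiction eq branch≢internal

  subdivision : Graph (h + ∣E∣ H * s)
  subdivision = record
    { adj    = λ x y → ⌊ adj? x y ⌋
    ; symm   = λ x y → trans (isYes≗does (adj? x y))
                 (trans (does-⇔ (mk⇔ swap swap) (adj? x y) (adj? y x))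
                        (sym (isYes≗does (adj? y x))))
    ; irrefl = λ x → trans (isYes≗does (adj? x x))
                 (dec-false (adj? x x) [ ¬loop , ¬loop ]′)
    }
    where
    adj? : ∀ x y → Dec (Consecutive x y ⊎ Consecutive y x)
    adj? x y = consecutive? x y ⊎-dec consecutive? y x

    ¬loop : ∀ {x} → ¬ Consecutive x x
    ¬loop (e , p , x≡ , x≡′) = ℕ.<⇒≢ (ℕ.n<1+n (toℕ p))
      (trans (sym (Fin.toℕ-inject₁ p))
        (cong toℕ (pathVertex-injective e (trans (sym x≡) x≡′))))

-- x ≤ C · n ^ (a / b) for a rational exponent a / b (b > 0), with the b-th root cleared.
_≤_·_^ℚ_ : ℕ → ℕ → ℕ → ℚᵘ → Set
x ≤ C · n ^ℚ e with ↥ e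
... | + a      = x ^ ↧ₙ e ≤ C ^ ↧ₙ e * n ^ a
... | -[1+ a ] = x ^ ↧ₙ e * n ^ suc a ≤ C ^ ↧ₙ e

-- f n = O(n ^ e) as n → ∞. It is no restriction to take the constant C in ℕ.
infix 4 _=O[n^_]
_=O[n^_] : (ℕ → ℕ) → ℚᵘ → Set
f =O[n^ e ] = ∃[ C ] ∃[ N ] (∀ n → N ≤ n → f n ≤ C · n ^ℚ e)

{-# OPTIONS --safe #-}
module Submission where

-- Write k = 2 l, s = h + 1 and let t exceed the number of edges of H. It suffices to find
-- internally disjoint paths of length l between all pairs from s vertices a and t vertices b:
-- the a's become the vertices of H, the b's the midpoints of its subdivided edges.
--
-- A minimal counterexample has an almost regular subgraph, with N vertices and degrees between
-- d and K d, where d ^ (l s + 1) ≥ C N ^ s. Call a pair of vertices robust if no bounded set of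
-- vertices blocks all paths of a given length j ≤ l between them. If some vertex x has a dense
-- set of robust pairs between its neighbours and the vertices at distance j - 1, then s
-- neighbours of x are robustly joined to all vertices of a large set B. The vertices of B have many
-- neighbours among the few vertices at distance j - 1 from one of the a's, so there is a
-- bipartite subgraph of large minimum degree between them; walking in it for l - j steps and
-- then using robustness joins every b to every a.
--
-- Otherwise most paths of length l are light: they contain no robust pair. A blocking set of a
-- non-robust pair cuts its light paths into shorter light paths, so between two vertices there
-- are boundedly many. Hence a proportion of about d ^ l / N of all pairs is joined by a path of
-- length l, and as only about d ^ (l - 1) paths from a vertex meet a given vertex, the a's and
-- then the b's can be chosen greedily with disjoint paths.

-- The exponent is set by the light case. Picking the s vertices a one at a time, each joined to an
-- above-average share of the remaining b, leaves about N (d^l / N)^s vertices b, while the greedy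
-- choice of t of them needs more than a constant times d^(l - 1). As d^l is O(N), this follows from
-- d^(l s + 1) ≥ C N^s, that is, from an average degree of order N^(s / (l s + 1)). Compared with
-- N^(1 / l) this saves 1 / (l (l s + 1)) in the exponent, which is δ. The obstacle is a circle of
-- constants: the number of light paths between two vertices depends on the size of blocking sets,
-- this size on the density at which robust pairs already yield a path system, and the density that
-- can be tolerated on the number of light paths. The circle is broken by letting the threshold vary
-- with the length: the threshold for c + 1 internal vertices uses only the number of light paths
-- with at most c.

module SubdivisionBound where

  open import Data.Bool.Base using (Bool; true; T)
  open import Data.Empty using (⊥)
  open import Data.Fin.Base as Fin using (Fin; zero; suc; toℕ)
  import Data.Fin.Properties as Fin
  import Data.Integer.Base as ℤ
  import Data.Integer.Properties as ℤ
  open import Data.List.Base as List using (List; []; _∷_; _++_; length; filter; allFin; replicate)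
  import Data.List.Properties as List
  open import Data.List.Extrema.Nat using (argmax-sel)
  open import Data.List.Membership.Propositional as Mem using (_∈_; _∉_)
  open import Data.List.Membership.Propositional.Properties
    using ( ∈-++⁺ˡ; ∈-++⁺ʳ; ∈-++⁻; ∈-∃++; ∈-allFin; ∈-filter⁺; ∈-filter⁻; ∈-lookup
          ; ∈-map⁺; ∈-map⁻; ∈-tabulate⁺; ∈-upTo⁺)
  open import Data.List.Relation.Unary.All as All using (All; []; _∷_)
  import Data.List.Relation.Unary.All.Properties as All
  import Data.List.Relation.Unary.AllPairs.Properties as AllPairs
  open import Data.List.Relation.Unary.Any as Any using (Any; here; there)
  import Data.List.Relation.Unary.Any.Properties as Any
  open import Data.List.Relation.Unary.Unique.Propositional using (Unique; []; _∷_)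
  open import Data.Nat.Base as ℕ
    using (ℕ; zero; suc; _+_; _*_; _^_; _∸_; _≤_; _<_; z≤n; s≤s; s≤s⁻¹; NonZero; >-nonZero)
  open import Data.Nat.DivMod using (_/_; _%_; m≡m%n+[m/n]*n; m%n<n; m/n*n≤m; m≥n⇒m/n>0)
  import Data.Nat.Properties as ℕ
  open import Data.Nat.Tactic.RingSolver using (solve-∀)
  open import Data.Product.Base using (_×_; _,_; proj₁; proj₂; ∃; ∃-syntax; Σ-syntax)
  open import Data.Rational.Unnormalised.Base as ℚᵘ using (ℚᵘ; 0ℚᵘ; 1ℚᵘ)
  import Data.Rational.Unnormalised.Properties as ℚᵘ
  open import Data.Sum.Base as Sum using (_⊎_; inj₁; inj₂; [_,_]′)
  open import Data.Unit.Base using (⊤; tt)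
  open import Function.Base using (_∘_; id; case_of_)
  open import Relation.Binary.Definitions using (Tri; tri<; tri≈; tri>)
  open import Relation.Binary.PropositionalEquality
    using (_≡_; _≢_; refl; sym; trans; cong; cong₂; subst; subst₂)
  open import Relation.Nullary.Decidable
    using ( Dec; yes; no; T?; map′; ¬?; _×-dec_; _⊎-dec_; ⌊_⌋; toWitness; fromWitness
          ; decidable-stable)
  open import Relation.Nullary.Negation.Core using (¬_; contradiction)
  open ℕ.≤-Reasoning

  -- Sums and counts over finite sets

  ind : {A : Set} → Dec A → ℕ
  ind (yes _) = 1
  ind (no _)  = 0

  ind-mono : {A B : Set} (a : Dec A) (b : Dec B) → (A → B) → ind a ≤ ind b
  ind-mono (no _)  _       _   = z≤n
  ind-mono (yes x) (yes _) _   = s≤s z≤n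
  ind-mono (yes x) (no ¬b) A→B = contradiction (A→B x) ¬b

  ind-≤1 : {A : Set} (a : Dec A) → ind a ≤ 1
  ind-≤1 (yes _) = s≤s z≤n
  ind-≤1 (no _)  = z≤n

  ind-yes : {A : Set} (a : Dec A) → A → 1 ≤ ind a
  ind-yes (yes _) _ = s≤s z≤n
  ind-yes (no ¬x) x = contradiction x ¬x

  ind-no : {A : Set} (a : Dec A) → ¬ A → ind a ≡ 0
  ind-no (yes x) ¬x = contradiction x ¬x
  ind-no (no _)  _  = refl

  ind-× : {A B : Set} (a : Dec A) (b : Dec B) → ind (a ×-dec b) ≡ ind a * ind b
  ind-× (yes _) (yes _) = refl
  ind-× (yes _) (no _)  = refl
  ind-× (no _)  _       = refl

  ind-split : {A B C : Set} (a : Dec A) (b : Dec B) (c : Dec C) → (A → B ⊎ C) →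
              ind a ≤ ind b + ind c
  ind-split (no _)  b       c       h = z≤n
  ind-split (yes x) (yes _) c       h = s≤s z≤n
  ind-split (yes x) (no ¬y) (yes _) h = s≤s z≤n
  ind-split (yes x) (no ¬y) (no ¬z) h = contradiction (h x) [ ¬y , ¬z ]′

  ∑ : ∀ {n} → (Fin n → ℕ) → ℕ
  ∑ {zero}  f = 0
  ∑ {suc n} f = f zero + ∑ (f ∘ suc)

  ∑-mono : ∀ {n} {f g : Fin n → ℕ} → (∀ x → f x ≤ g x) → ∑ f ≤ ∑ g
  ∑-mono {zero}  h = z≤n
  ∑-mono {suc n} h = ℕ.+-mono-≤ (h zero) (∑-mono (h ∘ suc))

  ∑-cong : ∀ {n} {f g : Fin n → ℕ} → (∀ x → f x ≡ g x) → ∑ f ≡ ∑ g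
  ∑-cong {zero}  h = refl
  ∑-cong {suc n} h = cong₂ _+_ (h zero) (∑-cong (h ∘ suc))

  ∑-+ : ∀ {n} (f g : Fin n → ℕ) → ∑ (λ x → f x + g x) ≡ ∑ f + ∑ g
  ∑-+ {zero}  f g = refl
  ∑-+ {suc n} f g = trans (cong (f zero + g zero +_) (∑-+ (f ∘ suc) (g ∘ suc)))
    (shuffle (f zero) (g zero) (∑ (f ∘ suc)) (∑ (g ∘ suc)))
    where
    shuffle : ∀ a b c d → a + b + (c + d) ≡ a + c + (b + d)
    shuffle = solve-∀

  ∑-0 : ∀ n → ∑ {n} (λ _ → 0) ≡ 0
  ∑-0 zero    = refl
  ∑-0 (suc n) = ∑-0 n

  ∑-swap : ∀ {m n} (f : Fin m → Fin n → ℕ) →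
           ∑ (λ x → ∑ (λ y → f x y)) ≡ ∑ (λ y → ∑ (λ x → f x y))
  ∑-swap {zero}  {n} f = sym (∑-0 n)
  ∑-swap {suc m}     f = trans (cong (∑ (f zero) +_) (∑-swap (f ∘ suc)))
    (sym (∑-+ (f zero) (λ y → ∑ (λ x → f (suc x) y))))

  ∑-*ˡ : ∀ {n} c (f : Fin n → ℕ) → ∑ (λ x → c * f x) ≡ c * ∑ f
  ∑-*ˡ {zero}  c f = sym (ℕ.*-zeroʳ c)
  ∑-*ˡ {suc n} c f = trans (cong (c * f zero +_) (∑-*ˡ c (f ∘ suc)))
    (sym (ℕ.*-distribˡ-+ c (f zero) (∑ (f ∘ suc))))

  ∑-*ʳ : ∀ {n} c (f : Fin n → ℕ) → ∑ (λ x → f x * c) ≡ ∑ f * c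
  ∑-*ʳ c f = trans (∑-cong (λ x → ℕ.*-comm (f x) c)) (trans (∑-*ˡ c f) (ℕ.*-comm c (∑ f)))

  ∑-≥ : ∀ {n} (f : Fin n → ℕ) x → f x ≤ ∑ f
  ∑-≥ f zero    = ℕ.m≤m+n _ _
  ∑-≥ f (suc x) = ℕ.≤-trans (∑-≥ (f ∘ suc) x) (ℕ.m≤n+m _ _)

  module _ {n : ℕ} {P : Fin n → Set} (P? : ∀ x → Dec (P x)) where

    cnt : ℕ
    cnt = ∑ (λ x → ind (P? x))

    cnt-∑≤ : ∀ {f : Fin n → ℕ} {c} → (∀ x → P x → f x ≤ c) → ∑ (λ x → ind (P? x) * f x) ≤ cnt * c
    cnt-∑≤ {f} {c} h = ℕ.≤-trans (∑-mono bound) (ℕ.≤-reflexive (∑-*ʳ c (λ x → ind (P? x))))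
      where
      bound : ∀ x → ind (P? x) * f x ≤ ind (P? x) * c
      bound x with P? x
      ... | yes p = ℕ.+-monoˡ-≤ 0 (h x p)
      ... | no _  = z≤n

    cnt-∑≥ : ∀ {f : Fin n → ℕ} {c} → (∀ x → P x → c ≤ f x) → cnt * c ≤ ∑ (λ x → ind (P? x) * f x)
    cnt-∑≥ {f} {c} h = ℕ.≤-trans (ℕ.≤-reflexive (sym (∑-*ʳ c (λ x → ind (P? x))))) (∑-mono bound)
      where
      bound : ∀ x → ind (P? x) * c ≤ ind (P? x) * f x
      bound x with P? x
      ... | yes p = ℕ.+-monoˡ-≤ 0 (h x p)
      ... | no _  = z≤n

    -- If `cnt * f x` stayed below `X` throughout `P`, summing over `P` and cancelling `cnt` would
    -- put the total below `X`. This stands in for choosing an element of `P` at random; `0 < X` is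
    -- what keeps `P` from being empty.
    ∃-above-average : ∀ {f : Fin n → ℕ} {X} → 0 < X → X ≤ ∑ (λ x → ind (P? x) * f x) →
                      ∃[ x ] (P x × X ≤ cnt * f x)
    ∃-above-average {f} {suc X} _ X≤ with Fin.any? (λ x → P? x ×-dec (suc X ℕ.≤? cnt * f x))
    ... | yes found = found
    ... | no none = contradiction X≤ (ℕ.<⇒≱ (s≤s (big cnt refl)))
      where
      low : ∀ x → P x → cnt * f x ≤ X
      low x p = s≤s⁻¹ (ℕ.≰⇒> (λ le → none (x , p , le)))
      -- Naming the count `c` allows a split into `zero`, where every weight vanishes, and a
      -- successor, which can be cancelled.
      big : ∀ c → c ≡ cnt → ∑ (λ x → ind (P? x) * f x) ≤ X
      big zero eq = begin
        ∑ (λ x → ind (P? x) * f x) ≤⟨ ∑-mono (λ x → ℕ.*-monoˡ-≤ (f x) (ℕ.≤-trans (∑-≥ (λ y → ind (P? y)) x) (ℕ.≤-reflexive (sym eq)))) ⟩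
        ∑ {n} (λ x → 0)   ≡⟨ ∑-0 n ⟩
        0   ≤⟨ z≤n ⟩
        X                          ∎
      big (suc c) eq = ℕ.*-cancelˡ-≤ (suc c) (begin
        suc c * ∑ (λ x → ind (P? x) * f x)   ≡⟨ ∑-*ˡ (suc c) (λ x → ind (P? x) * f x) ⟨
        ∑ (λ x → suc c * (ind (P? x) * f x))   ≡⟨ ∑-cong (λ x → trans (cong (_* (ind (P? x) * f x)) eq) (exchange cnt (ind (P? x)) (f x))) ⟩
        ∑ (λ x → ind (P? x) * (cnt * f x))   ≤⟨ cnt-∑≤ low ⟩
        cnt * X   ≡⟨ cong (_* X) eq ⟨
        suc c * X                              ∎)
        where
        exchange : ∀ a b c → a * (b * c) ≡ b * (a * c)
        exchange = solve-∀

    cnt>0⇒∃ : 0 < cnt → ∃ P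
    cnt>0⇒∃ pos with ∃-above-average {f = λ _ → 1} pos
        (ℕ.≤-reflexive (sym (∑-cong (λ x → ℕ.*-identityʳ (ind (P? x))))))
    ... | x , p , _ = x , p

    ∃⇒cnt>0 : ∀ x → P x → 0 < cnt
    ∃⇒cnt>0 x p = ℕ.≤-trans (ind-yes (P? x) p) (∑-≥ (λ y → ind (P? y)) x)

  module _ {n : ℕ} {P Q : Fin n → Set} where

    cnt-mono : (P? : ∀ x → Dec (P x)) (Q? : ∀ x → Dec (Q x)) → (∀ x → P x → Q x) → cnt P? ≤ cnt Q?
    cnt-mono P? Q? P⊆Q = ∑-mono (λ x → ind-mono (P? x) (Q? x) (P⊆Q x))

    cnt-split : {R : Fin n → Set} (P? : ∀ x → Dec (P x)) (Q? : ∀ x → Dec (Q x)) (R? : ∀ x → Dec (R x)) →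
                (∀ x → P x → Q x ⊎ R x) → cnt P? ≤ cnt Q? + cnt R?
    cnt-split P? Q? R? h = ℕ.≤-trans (∑-mono (λ x → ind-split (P? x) (Q? x) (R? x) (h x)))
      (ℕ.≤-reflexive (∑-+ (λ x → ind (Q? x)) (λ x → ind (R? x))))

  ∑-ind≟ : ∀ {n} (y : Fin n) (f : Fin n → ℕ) → ∑ (λ x → ind (x Fin.≟ y) * f x) ≡ f y
  ∑-ind≟ {suc n} zero f = trans (cong (f zero + 0 +_) (trans
      (∑-cong (λ x → cong (_* f (suc x)) (ind-no (suc x Fin.≟ zero) λ ()))) (∑-0 n)))
    (trans (ℕ.+-identityʳ _) (ℕ.+-identityʳ _))
  ∑-ind≟ {suc n} (suc y) f = trans
    (cong₂ _+_ (cong (_* f zero) (ind-no (zero Fin.≟ suc y) λ ()))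
               (∑-cong (λ x → cong (_* f (suc x)) (same x))))
    (∑-ind≟ y (f ∘ suc))
    where
    same : ∀ x → ind (suc x Fin.≟ suc y) ≡ ind (x Fin.≟ y)
    same x with x Fin.≟ y
    ... | yes _ = refl
    ... | no _  = refl

  cnt-≟ : ∀ {n} (y : Fin n) → cnt (Fin._≟ y) ≡ 1
  cnt-≟ y = trans (sym (trans (∑-*ʳ 1 (λ x → ind (x Fin.≟ y))) (ℕ.*-identityʳ _)))
    (∑-ind≟ y (λ _ → 1))

  cnt-Any : ∀ {n} {A : Set} {P : A → Fin n → Set} (P? : ∀ w x → Dec (P w x)) (ws : List A) {b} →
            (∀ w → cnt (P? w) ≤ b) → cnt (λ x → Any.any? (λ w → P? w x) ws) ≤ length ws * b
  cnt-Any {n} P? [] h = ℕ.≤-reflexive (trans (∑-cong (λ x → ind-no (Any.any? (λ w → P? w x) []) λ ())) (∑-0 n))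
  cnt-Any P? (w ∷ ws) h = ℕ.≤-trans
    (cnt-split (λ x → Any.any? (λ w → P? w x) (w ∷ ws)) (P? w) (λ x → Any.any? (λ w → P? w x) ws)
      (λ x → λ { (here p) → inj₁ p ; (there p) → inj₂ p }))
    (ℕ.+-mono-≤ (h w) (cnt-Any P? ws h))

  module _ {n : ℕ} where

    _∈?_ : (x : Fin n) (xs : List (Fin n)) → Dec (x ∈ xs)
    x ∈? xs = Any.any? (x Fin.≟_) xs

    cnt-∈ : ∀ xs → cnt (_∈? xs) ≤ length xs
    cnt-∈ xs = ℕ.≤-trans (cnt-Any (λ w x → x Fin.≟ w) xs (λ w → ℕ.≤-reflexive (cnt-≟ w)))
      (ℕ.≤-reflexive (ℕ.*-identityʳ _))

    ∃-avoiding : {P : Fin n → Set} (P? : ∀ x → Dec (P x)) (xs : List (Fin n)) →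
                 length xs < cnt P? → ∃[ x ] (P x × x ∉ xs)
    ∃-avoiding P? xs lt with Fin.any? (λ x → P? x ×-dec ¬? (x ∈? xs))
    ... | yes found = found
    ... | no none = contradiction (ℕ.≤-trans (cnt-mono P? (_∈? xs) inside) (cnt-∈ xs)) (ℕ.<⇒≱ lt)
      where
      inside : ∀ x → _ → x ∈ xs
      inside x p with x ∈? xs
      ... | yes x∈ = x∈
      ... | no x∉  = contradiction (x , p , x∉) none

    elements : {P : Fin n → Set} (P? : ∀ x → Dec (P x)) → List (Fin n)
    elements P? = filter P? (allFin n)

    ∈-elements : {P : Fin n → Set} (P? : ∀ x → Dec (P x)) {x : Fin n} → P x → x ∈ elements P?
    ∈-elements P? {x} p = ∈-filter⁺ P? (∈-allFin x) p

  length-filter-tabulate : ∀ {m n} {P : Fin n → Set} (P? : ∀ x → Dec (P x)) (f : Fin m → Fin n) →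
                           length (filter P? (List.tabulate f)) ≡ ∑ (λ i → ind (P? (f i)))
  length-filter-tabulate {zero}  P? f = refl
  length-filter-tabulate {suc m} P? f with P? (f zero)
  ... | yes _ = cong suc (length-filter-tabulate P? (f ∘ suc))
  ... | no _  = length-filter-tabulate P? (f ∘ suc)

  length-elements : ∀ {n} {P : Fin n → Set} (P? : ∀ x → Dec (P x)) → length (elements P?) ≡ cnt P?
  length-elements P? = length-filter-tabulate P? id

  cnt-disjoint : ∀ {n} {P Q R : Fin n → Set}
                 (P? : ∀ x → Dec (P x)) (Q? : ∀ x → Dec (Q x)) (R? : ∀ x → Dec (R x)) →
                 (∀ x → P x → R x) → (∀ x → Q x → R x) → (∀ x → P x → ¬ Q x) →
                 cnt P? + cnt Q? ≤ cnt R?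
  cnt-disjoint P? Q? R? P⊆R Q⊆R disj = ℕ.≤-trans (ℕ.≤-reflexive (sym (∑-+ (λ x → ind (P? x)) (λ x → ind (Q? x))))) (∑-mono pointwise)
    where
    pointwise : ∀ x → ind (P? x) + ind (Q? x) ≤ ind (R? x)
    pointwise x with P? x | Q? x
    ... | yes p | yes q = contradiction q (disj x p)
    ... | yes p | no _  = ind-yes (R? x) (P⊆R x p)
    ... | no _  | yes q = ind-yes (R? x) (Q⊆R x q)
    ... | no _  | no _  = z≤n

  cnt-≤ : ∀ {n} {P : Fin n → Set} (P? : ∀ x → Dec (P x)) → cnt P? ≤ n
  cnt-≤ {zero}  P? = z≤n
  cnt-≤ {suc n} P? = ℕ.+-mono-≤ (ind-≤1 (P? zero)) (cnt-≤ (P? ∘ suc))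

  ∃-below-average : ∀ {n} {P : Fin n → Set} (P? : ∀ x → Dec (P x)) (f : Fin n → ℕ) → 0 < cnt P? →
                    ∃[ x ] (P x × cnt P? * f x ≤ ∑ (λ x → ind (P? x) * f x))
  ∃-below-average {n} {P} P? f pos with Fin.any? (λ x → P? x ×-dec (cnt P? * f x ℕ.≤? total))
    where total = ∑ (λ x → ind (P? x) * f x)
  ... | yes found = found
  ... | no none = contradiction (begin-strict
    cnt P? * total   <⟨ ℕ.m<m+n _ pos ⟩
    cnt P? * total + cnt P?   ≡⟨ trans (ℕ.+-comm _ (cnt P?)) (sym (ℕ.*-suc (cnt P?) total)) ⟩
    cnt P? * suc total   ≤⟨ cnt-∑≥ P? (λ x p → ℕ.≰⇒> (λ le → none (x , p , le))) ⟩
    ∑ (λ x → ind (P? x) * (cnt P? * f x))  ≡⟨ ∑-cong (λ x → exchange (ind (P? x)) (cnt P?) (f x)) ⟩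
    ∑ (λ x → cnt P? * (ind (P? x) * f x))  ≡⟨ ∑-*ˡ (cnt P?) (λ x → ind (P? x) * f x) ⟩
    cnt P? * total                         ∎) (ℕ.<-irrefl refl)
    where
    total = ∑ (λ x → ind (P? x) * f x)
    exchange : ∀ a b c → a * (b * c) ≡ b * (a * c)
    exchange = solve-∀

  -- Powers, quotients, double counting and greedy choice

  ^-distrib-* : ∀ a b k → (a * b) ^ k ≡ a ^ k * b ^ k
  ^-distrib-* a b zero    = refl
  ^-distrib-* a b (suc k) = trans (cong (a * b *_) (^-distrib-* a b k)) (exchange a b (a ^ k) (b ^ k))
    where
    exchange : ∀ a b c d → a * b * (c * d) ≡ a * c * (b * d)
    exchange = solve-∀

  ^-cancel-≤ : ∀ {a b} k → a ^ suc k ≤ b ^ suc k → a ≤ b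
  ^-cancel-≤ k a^k≤b^k = ℕ.≮⇒≥ (λ b<a → ℕ.<⇒≱ (ℕ.^-monoˡ-< (suc k) b<a) a^k≤b^k)

  ^-cancel-< : ∀ {a b} k → a ^ k < b ^ k → a < b
  ^-cancel-< k a^k<b^k = ℕ.≰⇒> (λ b≤a → ℕ.<⇒≱ a^k<b^k (ℕ.^-monoˡ-≤ k b≤a))

  m<[1+m/n]*n : ∀ m n .{{_ : NonZero n}} → m < suc (m / n) * n
  m<[1+m/n]*n m n = begin-strict
    m   ≡⟨ m≡m%n+[m/n]*n m n ⟩
    m % n + (m / n) * n   <⟨ ℕ.+-monoˡ-< _ (m%n<n m n) ⟩
    n + (m / n) * n         ∎

  double-count : ∀ {m n} {A : Fin m → Set} {B : Fin n → Set} {R : Fin m → Fin n → Set}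
                 (A? : ∀ y → Dec (A y)) (B? : ∀ z → Dec (B z)) (R? : ∀ y z → Dec (R y z)) →
                 ∑ (λ y → ind (A? y) * cnt (λ z → B? z ×-dec R? y z)) ≡
                 ∑ (λ z → ind (B? z) * cnt (λ y → A? y ×-dec R? y z))
  double-count A? B? R? = begin-equality
    ∑ (λ y → ind (A? y) * cnt (λ z → B? z ×-dec R? y z))
      ≡⟨ ∑-cong (λ y → sym (∑-*ˡ (ind (A? y)) (λ z → ind (B? z ×-dec R? y z)))) ⟩
    ∑ (λ y → ∑ (λ z → ind (A? y) * ind (B? z ×-dec R? y z)))
      ≡⟨ ∑-swap (λ y z → ind (A? y) * ind (B? z ×-dec R? y z)) ⟩
    ∑ (λ z → ∑ (λ y → ind (A? y) * ind (B? z ×-dec R? y z)))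
      ≡⟨ ∑-cong (λ z → ∑-cong (λ y → exchange y z)) ⟩
    ∑ (λ z → ∑ (λ y → ind (B? z) * ind (A? y ×-dec R? y z)))
      ≡⟨ ∑-cong (λ z → ∑-*ˡ (ind (B? z)) (λ y → ind (A? y ×-dec R? y z))) ⟩
    ∑ (λ z → ind (B? z) * cnt (λ y → A? y ×-dec R? y z)) ∎
    where
    exchange : ∀ y z → ind (A? y) * ind (B? z ×-dec R? y z) ≡ ind (B? z) * ind (A? y ×-dec R? y z)
    exchange y z rewrite ind-× (B? z) (R? y z) | ind-× (A? y) (R? y z) =
      swap (ind (A? y)) (ind (B? z)) (ind (R? y z))
      where
      swap : ∀ a b c → a * (b * c) ≡ b * (a * c)
      swap = solve-∀

  cnt-∃ : ∀ {m n} {A : Fin m → Set} {B : Fin m → Fin n → Set}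
          (A? : ∀ z → Dec (A z)) (B? : ∀ z y → Dec (B z y)) →
          cnt (λ y → Fin.any? (λ z → A? z ×-dec B? z y)) ≤ ∑ (λ z → ind (A? z) * cnt (B? z))
  cnt-∃ A? B? = begin
    cnt (λ y → Fin.any? (λ z → A? z ×-dec B? z y))   ≤⟨ ∑-mono pointwise ⟩
    ∑ (λ y → ∑ (λ z → ind (A? z) * ind (B? z y)))   ≡⟨ ∑-swap (λ y z → ind (A? z) * ind (B? z y)) ⟩
    ∑ (λ z → ∑ (λ y → ind (A? z) * ind (B? z y)))   ≡⟨ ∑-cong (λ z → ∑-*ˡ (ind (A? z)) (λ y → ind (B? z y))) ⟩
    ∑ (λ z → ind (A? z) * cnt (B? z))                     ∎
    where
    pointwise : ∀ y → ind (Fin.any? (λ z → A? z ×-dec B? z y)) ≤ ∑ (λ z → ind (A? z) * ind (B? z y))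
    pointwise y with Fin.any? (λ z → A? z ×-dec B? z y)
    ... | no _ = z≤n
    ... | yes (z , az , bzy) = ℕ.≤-trans
      (ℕ.*-mono-≤ (ind-yes (A? z) az) (ind-yes (B? z y) bzy))
      (∑-≥ (λ z → ind (A? z) * ind (B? z y)) z)

  -- The earlier choices `cs` are carried along so that the induction goes through. A single step
  -- has to succeed only against fewer than `bound` of them, which is what a count of the spoiled
  -- candidates delivers.
  greedy : {A : Set} (bound : ℕ) {conf : A → A → Set} → ∀ m (Good : Fin m → A → Set) →
           (∀ i (cs : List A) → length cs < bound → ∃[ x ] (Good i x × All (λ c → ¬ conf c x) cs)) →
           (cs : List A) → length cs + m ≤ bound →
           Σ[ f ∈ (Fin m → A) ] ((∀ i → Good i (f i)) × (∀ i → All (λ c → ¬ conf c (f i)) cs) ×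
                                 (∀ i j → i Fin.< j → ¬ conf (f i) (f j)))
  greedy bound zero Good step cs le = (λ ()) , (λ ()) , (λ ()) , λ ()
  greedy {A} bound {conf} (suc m) Good step cs le =
    f , good , avoids , separate
    where
    lt : length cs < bound
    lt = ℕ.≤-trans (ℕ.≤-trans (s≤s (ℕ.m≤m+n (length cs) m)) (ℕ.≤-reflexive (sym (ℕ.+-suc (length cs) m)))) le
    first = step zero cs lt
    x = proj₁ first
    rest = greedy bound {conf} m (Good ∘ suc) (step ∘ suc) (x ∷ cs)
             (ℕ.≤-trans (ℕ.≤-reflexive (sym (ℕ.+-suc (length cs) m))) le)
    f : Fin (suc m) → A
    f zero    = x
    f (suc i) = proj₁ rest i
    good : ∀ i → Good i (f i)
    good zero    = proj₁ (proj₂ first)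
    good (suc i) = proj₁ (proj₂ rest) i
    avoids : ∀ i → All (λ c → ¬ conf c (f i)) cs
    avoids zero    = proj₂ (proj₂ first)
    avoids (suc i) = All.tail (proj₁ (proj₂ (proj₂ rest)) i)
    separate : ∀ i j → i Fin.< j → ¬ conf (f i) (f j)
    separate zero    (suc j) _         = All.head (proj₁ (proj₂ (proj₂ rest)) j)
    separate (suc i) (suc j) (s≤s i<j) = proj₂ (proj₂ (proj₂ rest)) i j i<j

  ∑-≤ : ∀ {n} {f : Fin n → ℕ} {c} → (∀ x → f x ≤ c) → ∑ f ≤ n * c
  ∑-≤ {zero}  h = z≤n
  ∑-≤ {suc n} h = ℕ.+-mono-≤ (h zero) (∑-≤ (h ∘ suc))

  cnt-any : ∀ {m n} {B : Fin m → Fin n → Set} (B? : ∀ i y → Dec (B i y)) {b} → (∀ i → cnt (B? i) ≤ b) →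
            cnt (λ y → Fin.any? (λ i → B? i y)) ≤ m * b
  cnt-any B? h = ℕ.≤-trans (∑-mono pointwise)
    (ℕ.≤-trans (ℕ.≤-reflexive (∑-swap (λ y i → ind (B? i y)))) (∑-≤ h))
    where
    pointwise : ∀ y → ind (Fin.any? (λ i → B? i y)) ≤ ∑ (λ i → ind (B? i y))
    pointwise y with Fin.any? (λ i → B? i y)
    ... | no _           = z≤n
    ... | yes (i , biy) = ℕ.≤-trans (ind-yes (B? i y) biy) (∑-≥ (λ i → ind (B? i y)) i)

  concatMap-length : ∀ {A B : Set} (f : A → List B) {L} → (∀ x → length (f x) ≡ L) →
                     ∀ xs → length (List.concatMap f xs) ≡ length xs * L
  concatMap-length f h []       = refl
  concatMap-length f h (x ∷ xs) = trans (List.length-++ (f x)) (cong₂ _+_ (h x) (concatMap-length f h xs))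

  ∈-concatMap : ∀ {A B : Set} (f : A → List B) {x y} xs → y ∈ f x → x ∈ xs → y ∈ List.concatMap f xs
  ∈-concatMap f (x ∷ xs) y∈ (here refl) = ∈-++⁺ˡ y∈
  ∈-concatMap f (x ∷ xs) y∈ (there x∈)  = ∈-++⁺ʳ (f x) (∈-concatMap f xs y∈ x∈)

  length-concatMap-≤ : ∀ {A B : Set} (f : A → List B) {b} → ∀ xs → (∀ x → length (f x) ≤ b) →
                       length (List.concatMap f xs) ≤ length xs * b
  length-concatMap-≤ f []       h = z≤n
  length-concatMap-≤ f (x ∷ xs) h = ℕ.≤-trans (ℕ.≤-reflexive (List.length-++ (f x)))
    (ℕ.+-mono-≤ (h x) (length-concatMap-≤ f xs h))

  -- Almost regular subgraphs

  module _ {n : ℕ} where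

    size : (Fin n → Bool) → ℕ
    size S = cnt (λ x → T? (S x))

    set : {P : Fin n → Set} → (∀ x → Dec (P x)) → Fin n → Bool
    set P? x = ⌊ P? x ⌋

    _∖_ : (Fin n → Bool) → {P : Fin n → Set} → (∀ x → Dec (P x)) → Fin n → Bool
    S ∖ P? = set (λ x → T? (S x) ×-dec ¬? (P? x))

    ∖-cases : (S : Fin n → Bool) {P : Fin n → Set} (P? : ∀ x → Dec (P x)) {y : Fin n} →
              T (S y) → T ((S ∖ P?) y) ⊎ P y
    ∖-cases S {P} P? {y} y∈S = decide (P? y)
      where
      decide : Dec (P y) → T ((S ∖ P?) y) ⊎ P y
      decide (yes p) = inj₂ p
      decide (no ¬p) = inj₁ (fromWitness {a? = T? (S y) ×-dec ¬? (P? y)} (y∈S , ¬p))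

    size-∖ : (S : Fin n → Bool) {x : Fin n} → T (S x) → size S ≡ suc (size (S ∖ (Fin._≟ x)))
    size-∖ S {x} x∈S = ℕ.≤-antisym
      (ℕ.≤-trans (cnt-split (λ y → T? (S y)) (λ y → T? ((S ∖ (Fin._≟ x)) y)) (Fin._≟ x) (λ y → ∖-cases S (Fin._≟ x)))
        (ℕ.≤-reflexive (trans (cong (size (S ∖ (Fin._≟ x)) +_) (cnt-≟ x)) (ℕ.+-comm _ 1))))
      (ℕ.≤-trans (ℕ.≤-reflexive (trans (ℕ.+-comm 1 _) (cong (size (S ∖ (Fin._≟ x)) +_) (sym (cnt-≟ x)))))
        (cnt-disjoint (λ y → T? ((S ∖ (Fin._≟ x)) y)) (Fin._≟ x) (λ y → T? (S y))
          (λ y → proj₁ ∘ toWitness) (λ { y refl → x∈S }) (λ y → proj₂ ∘ toWitness)))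

    -- Deleting an element of at most average weight does not lower the average, so after `r`
    -- deletions the remaining `p` elements carry at least their fair share. This replaces a random
    -- `p`-subset of `S`.
    heavy-subset : (f : Fin n → ℕ) → ∀ r p (S : Fin n → Bool) → 0 < p → size S ≡ r + p →
                   ∃[ P ] ((∀ x → T (P x) → T (S x)) × size P ≡ p ×
                           p * ∑ (λ x → ind (T? (S x)) * f x) ≤ size S * ∑ (λ x → ind (T? (P x)) * f x))
    heavy-subset f zero p S 0<p eq = S , (λ _ → id) , eq , ℕ.*-monoˡ-≤ _ (ℕ.≤-reflexive (sym eq))
    heavy-subset f (suc r) p S 0<p eq
      with ∃-below-average (λ x → T? (S x)) f (ℕ.≤-trans (s≤s z≤n) (ℕ.≤-reflexive (sym eq)))
    ... | x , x∈S , small with heavy-subset f r p (S ∖ (Fin._≟ x)) 0<p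
                                 (ℕ.suc-injective (trans (sym (size-∖ S x∈S)) eq))
    ...   | P , P⊆S′ , sizeP , fair = P , (λ y → proj₁ ∘ toWitness ∘ P⊆S′ y) , sizeP ,
      (ℕ.*-cancelˡ-≤ (size S′) {{>-nonZero (ℕ.≤-trans (ℕ.≤-trans 0<p (ℕ.m≤n+m p r)) (ℕ.≤-reflexive sizeS′))}} (begin
        size S′ * (p * w S)   ≡⟨ exchange (size S′) p (w S) ⟩
        p * (size S′ * w S)   ≤⟨ ℕ.*-monoʳ-≤ p (ℕ.*-monoʳ-≤ (size S′) wS≤) ⟩
        p * (size S′ * (w S′ + f x))   ≡⟨ cong (p *_) (ℕ.*-distribˡ-+ (size S′) (w S′) (f x)) ⟩
        p * (size S′ * w S′ + size S′ * f x)  ≤⟨ ℕ.*-monoʳ-≤ p (ℕ.+-monoʳ-≤ (size S′ * w S′) small′) ⟩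
        p * (size S′ * w S′ + w S′)   ≡⟨ regroup p (size S′) (w S′) ⟩
        suc (size S′) * (p * w S′)   ≤⟨ ℕ.*-monoʳ-≤ (suc (size S′)) fair ⟩
        suc (size S′) * (size S′ * w P)   ≡⟨ exchange (suc (size S′)) (size S′) (w P) ⟩
        size S′ * (suc (size S′) * w P)   ≡⟨ cong (λ m → size S′ * (m * w P)) (sym (size-∖ S x∈S)) ⟩
        size S′ * (size S * w P)              ∎))
      where
      S′ = S ∖ (Fin._≟ x)
      w : (Fin n → Bool) → ℕ
      w A = ∑ (λ y → ind (T? (A y)) * f y)
      sizeS′ : r + p ≡ size S′
      sizeS′ = ℕ.suc-injective (trans (sym eq) (size-∖ S x∈S))
      exchange : ∀ a b c → a * (b * c) ≡ b * (a * c)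
      exchange = solve-∀
      regroup : ∀ p m a → p * (m * a + a) ≡ suc m * (p * a)
      regroup = solve-∀
      pointwise : ∀ y → ind (T? (S y)) * f y ≤ ind (T? (S′ y)) * f y + ind (y Fin.≟ x) * f y
      pointwise y = ℕ.≤-trans (ℕ.*-monoˡ-≤ (f y) (ind-split (T? (S y)) (T? (S′ y)) (y Fin.≟ x) (∖-cases S (Fin._≟ x))))
        (ℕ.≤-reflexive (ℕ.*-distribʳ-+ (f y) (ind (T? (S′ y))) _))
      wS≤ : w S ≤ w S′ + f x
      wS≤ = begin
        w S   ≤⟨ ∑-mono pointwise ⟩
        ∑ (λ y → ind (T? (S′ y)) * f y + ind (y Fin.≟ x) * f y) ≡⟨ ∑-+ (λ y → ind (T? (S′ y)) * f y) _ ⟩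
        w S′ + ∑ (λ y → ind (y Fin.≟ x) * f y)   ≡⟨ cong (w S′ +_) (∑-ind≟ x f) ⟩
        w S′ + f x                                              ∎
      small′ : size S′ * f x ≤ w S′
      small′ = ℕ.+-cancelˡ-≤ (f x) _ _ (begin
        f x + size S′ * f x  ≡⟨ cong (_* f x) (sym (size-∖ S x∈S)) ⟩
        size S * f x   ≤⟨ small ⟩
        w S   ≤⟨ wS≤ ⟩
        w S′ + f x   ≡⟨ ℕ.+-comm (w S′) (f x) ⟩
        f x + w S′           ∎)

  module AlmostRegular {n : ℕ} (E : Fin n → Fin n → Set) (E? : ∀ x y → Dec (E x y))
                       (E-sym : ∀ {x y} → E x y → E y x) where

    deg : (Fin n → Bool) → Fin n → ℕ
    deg S x = cnt (λ y → T? (S y) ×-dec E? x y)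

    -- Ordered adjacent pairs inside `S`: twice the number of edges when `E` has no loops.
    vol : (Fin n → Bool) → ℕ
    vol S = ∑ (λ x → ind (T? (S x)) * deg S x)

    deg-mono : (S S′ : Fin n → Bool) → (∀ x → T (S x) → T (S′ x)) → ∀ x → deg S x ≤ deg S′ x
    deg-mono S S′ S⊆S′ x = cnt-mono (λ y → T? (S y) ×-dec E? x y) (λ y → T? (S′ y) ×-dec E? x y)
      (λ y (y∈S , e) → S⊆S′ y y∈S , e)

    -- A lost pair begins or ends in `L`. By the symmetry of `E`, each kind is bounded by the
    -- degrees into `S` of the vertices of `L`.
    vol-∖ : (S : Fin n → Bool) {L : Fin n → Set} (L? : ∀ x → Dec (L x)) →
            vol S ≤ vol (S ∖ L?) + 2 * ∑ (λ x → ind (L? x) * deg S x)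
    vol-∖ S {L} L? = begin
      vol S   ≤⟨ ∑-mono pointwise ⟩
      ∑ (λ y → s′ y * deg S′ y + (ind (T? (S y)) * degL y + ind (L? y) * deg S y))
                        ≡⟨ ∑-+ (λ y → s′ y * deg S′ y) _ ⟩
      vol S′ + ∑ (λ y → ind (T? (S y)) * degL y + ind (L? y) * deg S y) ≡⟨ cong (vol S′ +_) (∑-+ (λ y → ind (T? (S y)) * degL y) _) ⟩
      vol S′ + (∑ (λ y → ind (T? (S y)) * degL y) + volL)   ≡⟨ cong (λ a → vol S′ + (a + volL)) (double-count (λ y → T? (S y)) L? E?) ⟩
      vol S′ + (∑ (λ z → ind (L? z) * cnt (λ y → T? (S y) ×-dec E? y z)) + volL)
                        ≤⟨ ℕ.+-monoʳ-≤ (vol S′) (ℕ.+-monoˡ-≤ volL (∑-mono flip)) ⟩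
      vol S′ + (volL + volL)   ≡⟨ cong (λ a → vol S′ + (volL + a)) (sym (ℕ.+-identityʳ volL)) ⟩
      vol S′ + 2 * volL                                                ∎
      where
      S′ = S ∖ L?
      s′ : Fin n → ℕ
      s′ y = ind (T? (S′ y))
      volL : ℕ
      volL = ∑ (λ x → ind (L? x) * deg S x)
      degL : Fin n → ℕ
      degL y = cnt (λ z → L? z ×-dec E? y z)
      flip : ∀ z → ind (L? z) * cnt (λ y → T? (S y) ×-dec E? y z) ≤ ind (L? z) * deg S z
      flip z = ℕ.*-monoʳ-≤ (ind (L? z)) (cnt-mono (λ y → T? (S y) ×-dec E? y z) (λ y → T? (S y) ×-dec E? z y)
        (λ y (y∈S , e) → y∈S , E-sym e))
      deg-split : ∀ y → deg S y ≤ deg S′ y + degL y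
      deg-split y = cnt-split (λ z → T? (S z) ×-dec E? y z) (λ z → T? (S′ z) ×-dec E? y z) (λ z → L? z ×-dec E? y z)
        (λ z (z∈S , e) → [ (λ z∈S′ → inj₁ (z∈S′ , e)) , (λ z∈L → inj₂ (z∈L , e)) ]′ (∖-cases S L? z∈S))
      pointwise : ∀ y → ind (T? (S y)) * deg S y ≤
                        s′ y * deg S′ y + (ind (T? (S y)) * degL y + ind (L? y) * deg S y)
      pointwise y = begin
        ind (T? (S y)) * deg S y   ≤⟨ ℕ.*-monoˡ-≤ (deg S y) (ind-split (T? (S y)) (T? (S′ y)) (L? y) (∖-cases S L?)) ⟩
        (s′ y + ind (L? y)) * deg S y   ≡⟨ ℕ.*-distribʳ-+ (deg S y) (s′ y) (ind (L? y)) ⟩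
        s′ y * deg S y + ind (L? y) * deg S y   ≤⟨ ℕ.+-monoˡ-≤ _ (ℕ.*-monoʳ-≤ (s′ y) (deg-split y)) ⟩
        s′ y * (deg S′ y + degL y) + ind (L? y) * deg S y
                        ≡⟨ cong (_+ ind (L? y) * deg S y) (ℕ.*-distribˡ-+ (s′ y) (deg S′ y) (degL y)) ⟩
        s′ y * deg S′ y + s′ y * degL y + ind (L? y) * deg S y
                        ≡⟨ ℕ.+-assoc (s′ y * deg S′ y) _ _ ⟩
        s′ y * deg S′ y + (s′ y * degL y + ind (L? y) * deg S y)
                        ≤⟨ ℕ.+-monoʳ-≤ (s′ y * deg S′ y) (ℕ.+-monoˡ-≤ _ (ℕ.*-monoˡ-≤ (degL y)
                        (ind-mono (T? (S′ y)) (T? (S y)) (proj₁ ∘ toWitness)))) ⟩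
        s′ y * deg S′ y + (ind (T? (S y)) * degL y + ind (L? y) * deg S y) ∎

    -- The density inequality survives the deletion of a vertex of degree below `d`: by `vol-∖` its
    -- right side drops by at most `8 * d`, its left side by exactly that. The recursion runs on the
    -- size `k`.
    peel : ∀ d e k (S : Fin n → Bool) → size S ≡ k → e + 8 * d * size S ≤ 4 * vol S →
           ∃[ S′ ] ((∀ x → T (S′ x) → T (S x)) × (∀ x → T (S′ x) → d ≤ deg S′ x) × e ≤ 4 * vol S′)
    peel d e k S size≡ dense with Fin.any? (λ x → T? (S x) ×-dec (deg S x ℕ.<? d))
    ... | no none = S , (λ _ → id) , (λ x x∈S → ℕ.≮⇒≥ (λ lt → none (x , x∈S , lt))) , ℕ.≤-trans (ℕ.m≤m+n e _) dense
    peel d e zero S size≡ dense | yes (x , x∈S , _) =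
      contradiction (∃⇒cnt>0 (λ y → T? (S y)) x x∈S) (ℕ.<⇒≱ (s≤s (ℕ.≤-reflexive size≡)))
    peel d e (suc k) S size≡ dense | yes (x , x∈S , few)
      = proj₁ rec , (λ y → proj₁ ∘ toWitness ∘ proj₁ (proj₂ rec) y) , proj₂ (proj₂ rec)
      where
      S′ = S ∖ (Fin._≟ x)
      dense′ : e + 8 * d * size S′ ≤ 4 * vol S′
      dense′ = ℕ.+-cancelʳ-≤ (8 * d) _ _ (begin
        e + 8 * d * size S′ + 8 * d   ≡⟨ regroup e d (size S′) ⟩
        e + 8 * d * suc (size S′)   ≡⟨ cong (λ m → e + 8 * d * m) (size-∖ S x∈S) ⟨
        e + 8 * d * size S   ≤⟨ dense ⟩
        4 * vol S   ≤⟨ ℕ.*-monoʳ-≤ 4 (vol-∖ S (Fin._≟ x)) ⟩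
        4 * (vol S′ + 2 * ∑ (λ y → ind (y Fin.≟ x) * deg S y))
                        ≡⟨ cong (λ a → 4 * (vol S′ + 2 * a)) (∑-ind≟ x (deg S)) ⟩
        4 * (vol S′ + 2 * deg S x)   ≤⟨ ℕ.*-monoʳ-≤ 4 (ℕ.+-monoʳ-≤ (vol S′) (ℕ.*-monoʳ-≤ 2 (ℕ.<⇒≤ few))) ⟩
        4 * (vol S′ + 2 * d)   ≡⟨ expand (vol S′) d ⟩
        4 * vol S′ + 8 * d                ∎)
        where
        regroup : ∀ e d m → e + 8 * d * m + 8 * d ≡ e + 8 * d * suc m
        regroup = solve-∀
        expand : ∀ a d → 4 * (a + 2 * d) ≡ 4 * a + 8 * d
        expand = solve-∀
      rec = peel d e k S′ (ℕ.suc-injective (trans (sym (size-∖ S x∈S)) size≡)) dense′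

    vol≤size² : (S : Fin n → Bool) → vol S ≤ size S * size S
    vol≤size² S = cnt-∑≤ (λ x → T? (S x)) (λ x _ → cnt-mono (λ y → T? (S y) ×-dec E? x y) (λ y → T? (S y)) (λ y → proj₁))

    -- In a minimal violation of vol S ^ v ≤ C ^ v * size S ^ (u + v) the vertices of much
    -- more than average degree carry few edges: otherwise they, together with as many
    -- well-chosen vertices, would span a smaller violation.
    module Regularise (u′ v′ C′ : ℕ) where

      u v w K₁ C : ℕ
      u  = suc u′
      v  = suc v′
      w  = u + v
      -- The smaller set will have size at most `3 * m / K₁` and volume at least `e / (4 * K₁)`. It
      -- violates the bound as soon as `K₁ ^ u` is at least `4 ^ v * 3 ^ w`, and `u` is positive.
      K₁ = 4 ^ v * 3 ^ w
      -- Peeling and rounding leave a minimum degree `d` with `e ≤ 16 * m * d`, hence the 16.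
      C  = 16 * C′

      4≤K₁ : 4 ≤ K₁
      4≤K₁ = ℕ.*-mono-≤ {4} {4 ^ v} {1} (ℕ.*-monoʳ-≤ 4 (ℕ.m^n>0 4 v′)) (ℕ.m^n>0 3 w)

      module _ (S : Fin n → Bool)
               (dense : C ^ v * size S ^ w < vol S ^ v)
               (sparse : ∀ S′ → size S′ < size S → vol S′ ^ v ≤ C ^ v * size S′ ^ w)
               (K₁≤C : K₁ ≤ C) where

        private
          m e : ℕ
          m = size S
          e = vol S

          0<e : 0 < e
          0<e = ℕ.n≢0⇒n>0 (λ e≡0 → ℕ.<⇒≱ dense (ℕ.≤-trans (ℕ.≤-reflexive (cong (_^ v) e≡0)) z≤n))

          0<m : 0 < m
          0<m = ℕ.n≢0⇒n>0 (λ m≡0 → ℕ.<⇒≱ 0<e (ℕ.≤-trans (vol≤size² S) (ℕ.≤-reflexive (cong (λ k → k * k) m≡0))))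

          instance
            m≢0 : NonZero m
            m≢0 = >-nonZero 0<m
            e≢0 : NonZero e
            e≢0 = >-nonZero 0<e
            K₁≢0 : NonZero K₁
            K₁≢0 = >-nonZero (ℕ.≤-trans (s≤s z≤n) 4≤K₁)

          Cm<e : C * m < e
          Cm<e = ^-cancel-< v (begin-strict
            (C * m) ^ v   ≡⟨ ^-distrib-* C m v ⟩
            C ^ v * m ^ v   ≤⟨ ℕ.*-monoʳ-≤ (C ^ v) (ℕ.^-monoʳ-≤ m (ℕ.m≤n+m v u)) ⟩
            C ^ v * m ^ w   <⟨ dense ⟩
            e ^ v                ∎)

          C<m : C < m
          C<m = ℕ.*-cancelʳ-< m C m (ℕ.<-≤-trans Cm<e (vol≤size² S))

          L : Fin n → Set
          L x = T (S x) × K₁ * e < deg S x * m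

          L? : ∀ x → Dec (L x)
          L? x = T? (S x) ×-dec (K₁ * e ℕ.<? deg S x * m)

          volL : ℕ
          volL = ∑ (λ x → ind (L? x) * deg S x)

          volL≤e : volL ≤ e
          volL≤e = ∑-mono (λ x → ℕ.*-monoˡ-≤ (deg S x) (ind-mono (L? x) (T? (S x)) proj₁))

          -- Markov's inequality for the degrees.
          few-high : cnt L? * K₁ ≤ m
          few-high = ℕ.*-cancelʳ-≤ (cnt L? * K₁) m e (begin
            cnt L? * K₁ * e   ≡⟨ ℕ.*-assoc (cnt L?) K₁ e ⟩
            cnt L? * (K₁ * e)   ≤⟨ cnt-∑≥ L? (λ x → ℕ.<⇒≤ ∘ proj₂) ⟩
            ∑ (λ x → ind (L? x) * (deg S x * m))   ≡⟨ ∑-cong (λ x → sym (ℕ.*-assoc (ind (L? x)) (deg S x) m)) ⟩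
            ∑ (λ x → ind (L? x) * deg S x * m)   ≡⟨ ∑-*ʳ m (λ x → ind (L? x) * deg S x) ⟩
            volL * m   ≤⟨ ℕ.*-monoˡ-≤ m volL≤e ⟩
            e * m   ≡⟨ ℕ.*-comm e m ⟩
            m * e                                      ∎)

          module HighVolume (high : e < 4 * volL) where
            f : Fin n → ℕ
            f y = cnt (λ z → L? z ×-dec E? y z)

            weight : (Fin n → Bool) → ℕ
            weight A = ∑ (λ y → ind (T? (A y)) * f y)

            volL≤weight : volL ≤ weight S
            volL≤weight = begin
              volL ≤⟨ ∑-mono (λ z → ℕ.*-monoʳ-≤ (ind (L? z)) (cnt-mono (λ y → T? (S y) ×-dec E? z y) (λ y → T? (S y) ×-dec E? y z) (λ y (y∈S , e) → y∈S , E-sym e))) ⟩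
              ∑ (λ z → ind (L? z) * cnt (λ y → T? (S y) ×-dec E? y z)) ≡⟨ double-count (λ y → T? (S y)) L? E? ⟨
              weight S ∎

            p : ℕ
            -- Large enough for `P` to keep a fraction `1 / K₁` of the pairs leading into `L`, small
            -- enough for `L` and `P` together to have at most `3 * m / K₁` vertices.
            p = suc (m / K₁)

            m≤pK₁ : m ≤ p * K₁
            m≤pK₁ = ℕ.<⇒≤ (m<[1+m/n]*n m K₁)

            pK₁≤2m : p * K₁ ≤ 2 * m
            pK₁≤2m = ℕ.+-mono-≤ (ℕ.≤-trans K₁≤C (ℕ.<⇒≤ C<m))
                       (ℕ.≤-trans (m/n*n≤m m K₁) (ℕ.≤-reflexive (sym (ℕ.+-identityʳ m))))

            p≤m : p ≤ m
            p≤m = ℕ.*-cancelʳ-≤ p m 2 (begin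
              p * 2   ≤⟨ ℕ.*-monoʳ-≤ p (ℕ.≤-trans (s≤s (s≤s z≤n)) 4≤K₁) ⟩
              p * K₁  ≤⟨ pK₁≤2m ⟩
              2 * m   ≡⟨ ℕ.*-comm 2 m ⟩
              m * 2   ∎)

            chosen : ∃[ P ] ((∀ x → T (P x) → T (S x)) × size P ≡ p × p * weight S ≤ size S * weight P)
            chosen = heavy-subset f (m ∸ p) p S (s≤s z≤n) (sym (ℕ.m∸n+n≡m p≤m))

            P : Fin n → Bool
            P = proj₁ chosen

            weight≤ : weight S ≤ K₁ * weight P
            weight≤ = ℕ.*-cancelˡ-≤ p (begin
              p * weight S   ≤⟨ proj₂ (proj₂ (proj₂ chosen)) ⟩
              m * weight P   ≤⟨ ℕ.*-monoˡ-≤ (weight P) m≤pK₁ ⟩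
              p * K₁ * weight P   ≡⟨ ℕ.*-assoc p K₁ (weight P) ⟩
              p * (K₁ * weight P)    ∎)

            LP? : ∀ x → Dec (L x ⊎ T (P x))
            LP? x = L? x ⊎-dec T? (P x)

            S′ : Fin n → Bool
            S′ = set LP?

            size≤ : size S′ * K₁ ≤ 3 * m
            size≤ = begin
              size S′ * K₁   ≤⟨ ℕ.*-monoˡ-≤ K₁ (cnt-split (λ x → T? (S′ x)) L? (λ x → T? (P x)) (λ x → toWitness)) ⟩
              (cnt L? + size P) * K₁   ≡⟨ ℕ.*-distribʳ-+ K₁ (cnt L?) (size P) ⟩
              cnt L? * K₁ + size P * K₁  ≡⟨ cong (λ k → cnt L? * K₁ + k * K₁) (proj₁ (proj₂ (proj₂ chosen))) ⟩
              cnt L? * K₁ + p * K₁   ≤⟨ ℕ.+-mono-≤ few-high pK₁≤2m ⟩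
              3 * m                      ∎

            smaller : size S′ < m
            smaller = ℕ.*-cancelʳ-< K₁ (size S′) m (begin-strict
              size S′ * K₁  ≤⟨ size≤ ⟩
              3 * m   <⟨ ℕ.*-monoˡ-< m (ℕ.n<1+n 3) ⟩
              4 * m   ≤⟨ ℕ.*-monoˡ-≤ m 4≤K₁ ⟩
              K₁ * m   ≡⟨ ℕ.*-comm K₁ m ⟩
              m * K₁        ∎)

            weight≤vol : weight P ≤ vol S′
            weight≤vol = ∑-mono (λ y → ℕ.*-mono-≤
              (ind-mono (T? (P y)) (T? (S′ y)) (λ y∈P → fromWitness {a? = LP? y} (inj₂ y∈P)))
              (cnt-mono (λ z → L? z ×-dec E? y z) (λ z → T? (S′ z) ×-dec E? y z)
                (λ z (z∈L , e) → fromWitness {a? = LP? z} (inj₁ z∈L) , e)))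

            e≤ : e ≤ 4 * K₁ * vol S′
            e≤ = begin
              e   ≤⟨ ℕ.<⇒≤ high ⟩
              4 * volL   ≤⟨ ℕ.*-monoʳ-≤ 4 (ℕ.≤-trans volL≤weight (ℕ.≤-trans weight≤ (ℕ.*-monoʳ-≤ K₁ weight≤vol))) ⟩
              4 * (K₁ * vol S′)   ≡⟨ ℕ.*-assoc 4 K₁ (vol S′) ⟨
              4 * K₁ * vol S′        ∎

            impossible : ⊥
            impossible = ℕ.<-irrefl refl (begin-strict
              e ^ v * K₁ ^ w   ≤⟨ ℕ.*-monoˡ-≤ (K₁ ^ w) (ℕ.^-monoˡ-≤ v e≤) ⟩
              (4 * K₁ * vol S′) ^ v * K₁ ^ w   ≡⟨ cong (_* K₁ ^ w) (trans (^-distrib-* (4 * K₁) (vol S′) v) (cong (_* vol S′ ^ v) (^-distrib-* 4 K₁ v))) ⟩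
              4 ^ v * K₁ ^ v * vol S′ ^ v * K₁ ^ w   ≤⟨ ℕ.*-monoˡ-≤ (K₁ ^ w) (ℕ.*-monoʳ-≤ (4 ^ v * K₁ ^ v) (sparse S′ smaller)) ⟩
              4 ^ v * K₁ ^ v * (C ^ v * size S′ ^ w) * K₁ ^ w   ≡⟨ pull (4 ^ v) (K₁ ^ v) (C ^ v) (size S′ ^ w) (K₁ ^ w) ⟩
              4 ^ v * K₁ ^ v * C ^ v * (size S′ ^ w * K₁ ^ w)   ≡⟨ cong (4 ^ v * K₁ ^ v * C ^ v *_) (^-distrib-* (size S′) K₁ w) ⟨
              4 ^ v * K₁ ^ v * C ^ v * (size S′ * K₁) ^ w   ≤⟨ ℕ.*-monoʳ-≤ (4 ^ v * K₁ ^ v * C ^ v) (ℕ.^-monoˡ-≤ w size≤) ⟩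
              4 ^ v * K₁ ^ v * C ^ v * (3 * m) ^ w   ≡⟨ cong (4 ^ v * K₁ ^ v * C ^ v *_) (^-distrib-* 3 m w) ⟩
              4 ^ v * K₁ ^ v * C ^ v * (3 ^ w * m ^ w)   ≡⟨ collect (4 ^ v) (K₁ ^ v) (C ^ v) (3 ^ w) (m ^ w) ⟩
              K₁ ^ suc v * (C ^ v * m ^ w)   ≤⟨ ℕ.*-monoˡ-≤ (C ^ v * m ^ w) (ℕ.^-monoʳ-≤ K₁ (ℕ.+-monoˡ-≤ v (s≤s (z≤n {u′})))) ⟩
              K₁ ^ w * (C ^ v * m ^ w)   <⟨ ℕ.*-monoʳ-< (K₁ ^ w) {{ℕ.m^n≢0 K₁ w}} dense ⟩
              K₁ ^ w * e ^ v   ≡⟨ ℕ.*-comm (K₁ ^ w) (e ^ v) ⟩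
              e ^ v * K₁ ^ w                                    ∎)
              where
              pull : ∀ a b c d k → a * b * (c * d) * k ≡ a * b * c * (d * k)
              pull = solve-∀
              collect : ∀ a b c t r → a * b * c * (t * r) ≡ a * t * b * (c * r)
              collect = solve-∀

          4volL≤e : 4 * volL ≤ e
          4volL≤e = ℕ.≮⇒≥ HighVolume.impossible

          S₁ : Fin n → Bool
          S₁ = S ∖ L?

          e≤2vol : e ≤ 2 * vol S₁
          e≤2vol = ℕ.+-cancelʳ-≤ e _ _ (begin
            e + e   ≡⟨ cong (e +_) (ℕ.+-identityʳ e) ⟨
            2 * e   ≤⟨ ℕ.*-monoʳ-≤ 2 (vol-∖ S L?) ⟩
            2 * (vol S₁ + 2 * volL)   ≡⟨ expand (vol S₁) volL ⟩
            2 * vol S₁ + 4 * volL   ≤⟨ ℕ.+-monoʳ-≤ (2 * vol S₁) 4volL≤e ⟩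
            2 * vol S₁ + e             ∎)
            where
            expand : ∀ a b → 2 * (a + 2 * b) ≡ 2 * a + 4 * b
            expand = solve-∀

          instance
            8m≢0 : NonZero (m * 8)
            8m≢0 = ℕ.m*n≢0 m 8

          d : ℕ
          -- An eighth of the average degree. The budget `8 * d * size` that `peel` spends is then
          -- at most `e`, half of the `2 * e` that `4 * vol S₁` provides.
          d = e / (m * 8)

          8dm≤e : 8 * d * m ≤ e
          8dm≤e = ℕ.≤-trans (ℕ.≤-reflexive (shuffle d m)) (m/n*n≤m e (m * 8))
            where
            shuffle : ∀ d m → 8 * d * m ≡ d * (m * 8)
            shuffle = solve-∀

          enough : e + 8 * d * size S₁ ≤ 4 * vol S₁
          enough = begin
            e + 8 * d * size S₁   ≤⟨ ℕ.+-monoʳ-≤ e (ℕ.≤-trans (ℕ.*-monoʳ-≤ (8 * d) (cnt-mono (λ x → T? (S₁ x)) (λ x → T? (S x)) (λ x → proj₁ ∘ toWitness))) 8dm≤e) ⟩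
            e + e   ≤⟨ ℕ.+-mono-≤ e≤2vol e≤2vol ⟩
            2 * vol S₁ + 2 * vol S₁ ≡⟨ ℕ.*-distribʳ-+ (vol S₁) 2 2 ⟨
            4 * vol S₁            ∎

          core : ∃[ S′ ] ((∀ x → T (S′ x) → T (S₁ x)) × (∀ x → T (S′ x) → d ≤ deg S′ x) × e ≤ 4 * vol S′)
          core = peel d e (size S₁) S₁ refl enough

          S₂ : Fin n → Bool
          S₂ = proj₁ core

          S₂⊆S : ∀ x → T (S₂ x) → T (S x)
          S₂⊆S x = proj₁ ∘ toWitness ∘ proj₁ (proj₂ core) x

          0<d : 0 < d
          0<d = m≥n⇒m/n>0 (begin
            m * 8   ≡⟨ ℕ.*-comm m 8 ⟩
            8 * m   ≤⟨ ℕ.*-monoˡ-≤ m (ℕ.≤-trans (ℕ.m≤m*n 8 2) 16≤C) ⟩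
            C * m   ≤⟨ ℕ.<⇒≤ Cm<e ⟩
            e       ∎)
            where
            16≤C : 16 ≤ C
            16≤C = positive C′ (ℕ.≤-trans 4≤K₁ K₁≤C)
              where
              positive : ∀ c → 4 ≤ 16 * c → 16 ≤ 16 * c
              positive (suc c) _ = ℕ.m≤m*n 16 (suc c)

          e≤16md : e ≤ 16 * m * d
          e≤16md = begin
            e   ≤⟨ ℕ.<⇒≤ (m<[1+m/n]*n e (m * 8)) ⟩
            suc d * (m * 8)   ≤⟨ ℕ.*-monoˡ-≤ (m * 8) (ℕ.+-monoˡ-≤ d 0<d) ⟩
            (d + d) * (m * 8)   ≡⟨ shuffle d m ⟩
            16 * m * d           ∎
            where
            shuffle : ∀ d m → (d + d) * (m * 8) ≡ 16 * m * d
            shuffle = solve-∀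

          deg≤ : ∀ x → T (S₂ x) → deg S₂ x ≤ 16 * K₁ * d
          deg≤ x x∈S₂ = ℕ.*-cancelʳ-≤ (deg S₂ x) (16 * K₁ * d) m (begin
            deg S₂ x * m   ≤⟨ ℕ.*-monoˡ-≤ m (deg-mono S₂ S S₂⊆S x) ⟩
            deg S x * m   ≤⟨ ℕ.≮⇒≥ (λ lt → proj₂ (toWitness (proj₁ (proj₂ core) x x∈S₂)) (S₂⊆S x x∈S₂ , lt)) ⟩
            K₁ * e   ≤⟨ ℕ.*-monoʳ-≤ K₁ e≤16md ⟩
            K₁ * (16 * m * d)   ≡⟨ shuffle K₁ m d ⟩
            16 * K₁ * d * m      ∎)
            where
            shuffle : ∀ k m d → k * (16 * m * d) ≡ 16 * k * d * m
            shuffle = solve-∀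

          nonempty : ∃[ x ] T (S₂ x)
          nonempty = cnt>0⇒∃ (λ x → T? (S₂ x)) (ℕ.n≢0⇒n>0 (λ size≡0 → ℕ.<⇒≱ 0<e (begin
            e   ≤⟨ proj₂ (proj₂ (proj₂ core)) ⟩
            4 * vol S₂   ≤⟨ ℕ.*-monoʳ-≤ 4 (vol≤size² S₂) ⟩
            4 * (size S₂ * size S₂) ≡⟨ cong (λ k → 4 * (k * k)) size≡0 ⟩
            0                      ∎)))

          d-large : C′ ^ v * size S₂ ^ u ≤ d ^ v
          d-large = ℕ.*-cancelˡ-≤ (16 ^ v * m ^ v) {{ℕ.m*n≢0 (16 ^ v) (m ^ v) {{ℕ.m^n≢0 16 v}} {{ℕ.m^n≢0 m v}}}} (begin
            16 ^ v * m ^ v * (C′ ^ v * size S₂ ^ u)   ≤⟨ ℕ.*-monoʳ-≤ (16 ^ v * m ^ v) (ℕ.*-monoʳ-≤ (C′ ^ v) (ℕ.^-monoˡ-≤ u (cnt-mono (λ x → T? (S₂ x)) (λ x → T? (S x)) S₂⊆S))) ⟩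
            16 ^ v * m ^ v * (C′ ^ v * m ^ u)   ≡⟨ shuffle (16 ^ v) (m ^ v) (C′ ^ v) (m ^ u) ⟩
            16 ^ v * C′ ^ v * (m ^ u * m ^ v)   ≡⟨ cong₂ _*_ (^-distrib-* 16 C′ v) (ℕ.^-distribˡ-+-* m u v) ⟨
            C ^ v * m ^ w   ≤⟨ ℕ.<⇒≤ dense ⟩
            e ^ v   ≤⟨ ℕ.^-monoˡ-≤ v e≤16md ⟩
            (16 * m * d) ^ v   ≡⟨ trans (^-distrib-* (16 * m) d v) (cong (_* d ^ v) (^-distrib-* 16 m v)) ⟩
            16 ^ v * m ^ v * d ^ v                    ∎)
            where
            shuffle : ∀ a b c d → a * b * (c * d) ≡ a * c * (d * b)
            shuffle = solve-∀

        almost-regular : ∃[ S′ ] ∃[ d ] ((∀ x → T (S′ x) → d ≤ deg S′ x × deg S′ x ≤ 16 * K₁ * d) ×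
                           (∃[ x ] T (S′ x)) × C′ ^ v * size S′ ^ u ≤ d ^ v)
        almost-regular = S₂ , d , (λ x x∈ → proj₁ (proj₂ (proj₂ core)) x x∈ , deg≤ x x∈) , nonempty , d-large

  -- Walks, paths and robustly connected pairs

  Disjoint : {A : Set} → List A → List A → Set
  Disjoint xs ys = ∀ x → x ∈ xs → x ∉ ys

  module _ {A : Set} where

    Unique-++ : ∀ {xs ys : List A} → Unique xs → Unique ys → Disjoint xs ys → Unique (xs ++ ys)
    Unique-++ u v disj = AllPairs.++⁺ u v (All.tabulate (λ x∈ → All.tabulate (λ y∈ x≡y → disj _ x∈ (subst (_∈ _) (sym x≡y) y∈))))

    Unique-reverse : ∀ {xs : List A} → Unique xs → Unique (List.reverse xs)
    Unique-reverse {[]}     []         = []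
    Unique-reverse {x ∷ xs} (x# ∷ uxs) = subst Unique (sym (List.unfold-reverse x xs))
      (Unique-++ (Unique-reverse uxs) ([] ∷ []) (λ { y y∈ (here refl) → All.lookup x# (Any.reverse⁻ y∈) refl }))

    lookup-injective : ∀ {xs : List A} → Unique xs → ∀ i j → List.lookup xs i ≡ List.lookup xs j → i ≡ j
    lookup-injective (_  ∷ _) zero    zero    _  = refl
    lookup-injective (x# ∷ _) zero    (suc j) eq = contradiction eq (All.lookup x# (∈-lookup j))
    lookup-injective (x# ∷ _) (suc i) zero    eq = contradiction (sym eq) (All.lookup x# (∈-lookup i))
    lookup-injective (_  ∷ u) (suc i) (suc j) eq = cong suc (lookup-injective u i j eq)

  module _ {n : ℕ} where

    allLists? : ∀ k {P : List (Fin n) → Set} → (∀ p → Dec (P p)) → Dec (∀ p → length p ≡ k → P p)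
    allLists? zero    P? = map′ (λ { p[] [] _ → p[] }) (λ all → all [] refl) (P? [])
    allLists? (suc k) P? = map′
      (λ { all (x ∷ p) eq → all x p (ℕ.suc-injective eq) })
      (λ all x p eq → all (x ∷ p) (cong suc eq))
      (Fin.all? (λ x → allLists? k (λ p → P? (x ∷ p))))

    anyList? : ∀ k {P : List (Fin n) → Set} → (∀ p → Dec (P p)) → Dec (∃[ p ] (length p ≡ k × P p))
    anyList? zero    P? = map′ (λ p[] → [] , refl , p[]) (λ { ([] , _ , p[]) → p[] }) (P? [])
    anyList? (suc k) P? = map′
      (λ { (x , p , eq , px) → x ∷ p , cong suc eq , px })
      (λ { (x ∷ p , eq , px) → x , p , ℕ.suc-injective eq , px })
      (Fin.any? (λ x → anyList? k (λ p → P? (x ∷ p))))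

  module Walks {n : ℕ} (R : Fin n → Fin n → Set) (R? : ∀ x y → Dec (R x y))
               (R-sym : ∀ {x y} → R x y → R y x) where

    private V = Fin n

    Reach : ℕ → V → V → Set
    Reach zero    x y = x ≡ y
    Reach (suc i) x y = ∃[ z ] (R x z × Reach i z y)

    reach? : ∀ i x y → Dec (Reach i x y)
    reach? zero    x y = x Fin.≟ y
    reach? (suc i) x y = Fin.any? (λ z → R? x z ×-dec reach? i z y)

    Reach-snoc : ∀ i {x y z} → Reach i x y → R y z → Reach (suc i) x z
    Reach-snoc zero    refl          Ryz = _ , Ryz , refl
    Reach-snoc (suc i) (w , Rxw , r) Ryz = w , Rxw , Reach-snoc i r Ryz

    Reach-sym : ∀ i {x y} → Reach i x y → Reach i y x
    Reach-sym zero    refl          = refl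
    Reach-sym (suc i) (w , Rxw , r) = Reach-snoc i (Reach-sym i r) (R-sym Rxw)

    -- Walk u p v: the vertices of p are the internal vertices of a walk from u to v.
    Walk : V → List V → V → Set
    Walk u []      v = R u v
    Walk u (x ∷ p) v = R u x × Walk x p v

    walk? : ∀ u p v → Dec (Walk u p v)
    walk? u []      v = R? u v
    walk? u (x ∷ p) v = R? u x ×-dec walk? x p v

    Walk-++ : ∀ {u w v} p {q} → Walk u p w → Walk w q v → Walk u (p ++ w ∷ q) v
    Walk-++ []      Ruw       walk = Ruw , walk
    Walk-++ (x ∷ p) (Rux , r) walk = Rux , Walk-++ p r walk

    Walk-reverse : ∀ {u v} p → Walk u p v → Walk v (List.reverse p) u
    Walk-reverse []      Ruv = R-sym Ruv
    Walk-reverse {u} {v} (x ∷ p) (Rux , walk) =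
      subst (λ q → Walk v q u) (sym (List.unfold-reverse x p))
        (Walk-++ (List.reverse p) (Walk-reverse p walk) (R-sym Rux))

    Walk⇒Reach : ∀ {u v} p → Walk u p v → Reach (suc (length p)) u v
    Walk⇒Reach []      Ruv          = _ , Ruv , refl
    Walk⇒Reach (x ∷ p) (Rux , walk) = x , Rux , Walk⇒Reach p walk

    -- `c` counts the internal vertices, so the length is `c + 1`. The avoided list includes the two
    -- ends, so that no internal vertex repeats an end.
    record PathAvoiding (c : ℕ) (u v : V) (W : List V) : Set where
      constructor pathAvoiding
      field
        internal : List V
        len      : length internal ≡ c
        walk     : Walk u internal v
        unique   : Unique internal
        avoids   : Disjoint internal (u ∷ v ∷ W)

    disjoint? : ∀ (xs ys : List V) → Dec (Disjoint xs ys)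
    disjoint? xs ys = map′
      (λ all x x∈xs x∈ys → All.lookup all x∈xs x∈ys)
      (λ disj → All.tabulate (λ x∈xs x∈ys → disj _ x∈xs x∈ys))
      (All.all? (λ x → ¬? (x ∈? ys)) xs)

    unique? : ∀ (xs : List V) → Dec (Unique xs)
    unique? []       = yes []
    unique? (x ∷ xs) = map′ (λ (p , q) → p ∷ q) (λ { (p ∷ q) → p , q })
      (All.all? (λ y → ¬? (x Fin.≟ y)) xs ×-dec unique? xs)

    pathAvoiding? : ∀ c u v W → Dec (PathAvoiding c u v W)
    pathAvoiding? c u v W = map′
      (λ (p , len , walk , uniq , avoids) → pathAvoiding p len walk uniq avoids)
      (λ (pathAvoiding p len walk uniq avoids) → p , len , walk , uniq , avoids)
      (anyList? c (λ p → walk? u p v ×-dec unique? p ×-dec disjoint? p (u ∷ v ∷ W)))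

    -- Quantifying over lists of exactly `M` vertices, possibly repeated, makes the notion decidable
    -- by exhaustion; shorter lists are recovered in `robust-≤`.
    Robust : ℕ → ℕ → V → V → Set
    Robust M c u v = ∀ W → length W ≡ M → PathAvoiding c u v W

    robust? : ∀ M c u v → Dec (Robust M c u v)
    robust? M c u v = allLists? M (pathAvoiding? c u v)

    -- Padding `W` with copies of `u` costs nothing, as the path avoids its end `u` anyway.
    robust-≤ : ∀ {M c u v} → Robust M c u v → ∀ W → length W ≤ M → PathAvoiding c u v W
    robust-≤ {M} {c} {u} {v} robust W le with robust (W ++ replicate (M ∸ length W) u)
      (trans (List.length-++ W) (trans (cong (length W +_) (List.length-replicate _)) (ℕ.m+[n∸m]≡n le)))
    ... | pathAvoiding p len walk uniq avoids = pathAvoiding p len walk uniq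
      λ { x x∈p (here x≡u) → avoids x x∈p (here x≡u)
        ; x x∈p (there (here x≡v)) → avoids x x∈p (there (here x≡v))
        ; x x∈p (there (there x∈W)) → avoids x x∈p (there (there (∈-++⁺ˡ x∈W))) }

    module _ {Δ : ℕ} (deg≤ : ∀ x → cnt (R? x) ≤ Δ) where

      cnt-reach : ∀ i x → cnt (reach? i x) ≤ Δ ^ i
      cnt-reach zero x = ℕ.≤-trans (cnt-mono (λ y → x Fin.≟ y) (Fin._≟ x) (λ y → sym)) (ℕ.≤-reflexive (cnt-≟ x))
      cnt-reach (suc i) x = begin
        cnt (reach? (suc i) x)   ≤⟨ cnt-∃ (R? x) (λ z y → reach? i z y) ⟩
        ∑ (λ z → ind (R? x z) * cnt (reach? i z))   ≤⟨ cnt-∑≤ (R? x) (λ z _ → cnt-reach i z) ⟩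
        cnt (R? x) * Δ ^ i   ≤⟨ ℕ.*-monoˡ-≤ (Δ ^ i) (deg≤ x) ⟩
        Δ * Δ ^ i                                     ∎

    -- A copy of the complete bipartite graph with sides `s` and `t`, each edge replaced by a path
    -- with `L` internal vertices.
    record PathSystem (s t L : ℕ) : Set where
      field
        a      : Fin s → V
        b      : Fin t → V
        P      : Fin s → Fin t → List V
        a-inj  : ∀ {i j} → i ≢ j → a i ≢ a j
        b-inj  : ∀ {i j} → i ≢ j → b i ≢ b j
        a≢b    : ∀ i j → a i ≢ b j
        len    : ∀ i j → length (P i j) ≡ L
        walk   : ∀ i j → Walk (a i) (P i j) (b j)
        unique : ∀ i j → Unique (P i j)
        a∉P    : ∀ i j k → a k ∉ P i j
        b∉P    : ∀ i j k → b k ∉ P i j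
        disj   : ∀ {i j i′ j′} → (i , j) ≢ (i′ , j′) → Disjoint (P i j) (P i′ j′)

    -- Like `PathAvoiding`, but the ends are not forbidden separately: in `robust-system` the list
    -- `W` already contains all ends.
    record Connector (c : ℕ) (u v : V) (W : List V) : Set where
      constructor connector
      field
        internal : List V
        len      : length internal ≡ c
        walk     : Walk u internal v
        unique   : Unique internal
        avoids   : Disjoint internal W

    -- The `s * t` paths are chosen one after another. At any time the vertices to avoid are the
    -- `s + t` ends and at most `s * t * L` internal vertices used so far, whence the bound on
    -- `length W`.
    robust-system : ∀ {s t L} (a : Fin s → V) (b : Fin t → V) →
                    (∀ {i j} → i ≢ j → a i ≢ a j) → (∀ {i j} → i ≢ j → b i ≢ b j) → (∀ i j → a i ≢ b j) →
                    (∀ i j W → length W ≤ s + t + s * t * L → Connector L (a i) (b j) W) →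
                    PathSystem s t L
    robust-system {s} {t} {L} a b a-inj b-inj a≢b connect = record
      { a = a ; b = b ; P = P ; a-inj = a-inj ; b-inj = b-inj ; a≢b = a≢b
      ; len    = λ i j → proj₂ (f (Fin.combine i j))
      ; walk   = λ i j → proj₁ (good i j)
      ; unique = λ i j → proj₁ (proj₂ (good i j))
      ; a∉P    = λ i j k ak∈ → proj₂ (proj₂ (good i j)) _ ak∈ (∈-++⁺ˡ (∈-tabulate⁺ k))
      ; b∉P    = λ i j k bk∈ → proj₂ (proj₂ (good i j)) _ bk∈ (∈-++⁺ʳ (List.tabulate a) (∈-tabulate⁺ k))
      ; disj   = disj
      }
      where
      A : Set
      A = Σ[ p ∈ List V ] length p ≡ L
      conf : A → A → Set
      conf p q = ¬ Disjoint (proj₁ p) (proj₁ q)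
      base : List V
      base = List.tabulate a ++ List.tabulate b
      Good : Fin s → Fin t → A → Set
      Good i j p = Walk (a i) (proj₁ p) (b j) × Unique (proj₁ p) × Disjoint (proj₁ p) base
      index : Fin (s * t) → Fin s × Fin t
      index = Fin.remQuot t
      step : ∀ x (cs : List A) → length cs < s * t →
             ∃[ p ] (Good (proj₁ (index x)) (proj₂ (index x)) p × All (λ c → ¬ conf c p) cs)
      step x cs lt with connect (proj₁ (index x)) (proj₂ (index x)) (base ++ List.concatMap proj₁ cs) (begin
          length (base ++ List.concatMap proj₁ cs)   ≡⟨ List.length-++ base ⟩
          length base + length (List.concatMap proj₁ cs)   ≡⟨ cong₂ _+_ (trans (List.length-++ (List.tabulate a)) (cong₂ _+_ (List.length-tabulate a) (List.length-tabulate b))) (concatMap-length proj₁ proj₂ cs) ⟩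
          s + t + length cs * L   ≤⟨ ℕ.+-monoʳ-≤ (s + t) (ℕ.*-monoˡ-≤ L (ℕ.<⇒≤ lt)) ⟩
          s + t + s * t * L                                            ∎)
      ... | connector p len walk uniq avoids = (p , len) ,
        (walk , uniq , λ x x∈p x∈base → avoids x x∈p (∈-++⁺ˡ x∈base)) ,
        All.tabulate (λ {c} c∈cs ¬disj → ¬disj (λ x x∈c x∈p → avoids x x∈p (∈-++⁺ʳ base (∈-concatMap proj₁ cs x∈c c∈cs))))
      chosen = greedy {A} (s * t) {conf} (s * t) (λ x p → Good (proj₁ (index x)) (proj₂ (index x)) p) step [] ℕ.≤-refl
      f : Fin (s * t) → A
      f = proj₁ chosen
      P : Fin s → Fin t → List V
      P i j = proj₁ (f (Fin.combine i j))
      good : ∀ i j → Good i j (f (Fin.combine i j))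
      good i j = subst (λ ij → Good (proj₁ ij) (proj₂ ij) (f (Fin.combine i j)))
        (Fin.remQuot-combine i j) (proj₁ (proj₂ chosen) (Fin.combine i j))
      -- `conf` is the negation of `Disjoint`, so `greedy` returns a double negation. It does no
      -- harm, because `Disjoint` itself ends in a negation.
      sep : ∀ x y → x ≢ y → ¬ ¬ Disjoint (proj₁ (f x)) (proj₁ (f y))
      sep x y x≢y with Fin.<-cmp x y
      ... | tri< x<y _ _ = proj₂ (proj₂ (proj₂ chosen)) x y x<y
      ... | tri≈ _ x≡y _ = contradiction x≡y x≢y
      ... | tri> _ _ y<x = λ ¬disj → proj₂ (proj₂ (proj₂ chosen)) y x y<x
              (λ disj → ¬disj (λ v v∈x v∈y → disj v v∈y v∈x))
      disj : ∀ {i j i′ j′} → (i , j) ≢ (i′ , j′) → Disjoint (P i j) (P i′ j′)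
      disj {i} {j} {i′} {j′} ne v v∈ v∈′ = sep (Fin.combine i j) (Fin.combine i′ j′)
        (λ eq → case Fin.combine-injective i j i′ j′ eq of λ { (refl , refl) → ne refl })
        (λ d → d v v∈ v∈′)

  -- Many common neighbours, and dense bipartite cores

  module CommonNeighbours {n : ℕ} {Γ : Fin n → Fin n → Set} (Γ? : ∀ a b → Dec (Γ a b))
           {A : Fin n → Set} (A? : ∀ a → Dec (A a)) (Γ⇒A : ∀ {a b} → Γ a b → A a)
           {conf : Fin n → Fin n → Fin n → Set} (conf? : ∀ b a a′ → Dec (conf b a a′))
           {D X : ℕ} (conf≤ : ∀ b a → Γ a b → cnt (λ a′ → Γ? a′ b ×-dec conf? b a a′) ≤ X)
           (0<D : 0 < D) (B₀ : Fin n → Bool) (0<B₀ : 0 < size B₀) where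

    -- New vertices are put in front, so for `i < j` the vertex `as j` is the older one, and `as i`
    -- was chosen to be free of conflict with it.
    Joint : ∀ {s} → (Fin s → Fin n) → Fin n → Set
    Joint as b = (∀ i → Γ (as i) b) × (∀ i j → i Fin.< j → ¬ conf b (as j) (as i))

    -- Dependent random choice, with an above-average choice for each random one. Every `b` in the
    -- current set has lost at most `X` candidates to each earlier vertex, so at least `D` are still
    -- allowed, and some `a` is allowed by at least a fraction `D / cnt A?` of the set.
    common-neighbours : ∀ s → (∀ b → T (B₀ b) → D + s * X ≤ cnt (λ a → Γ? a b)) →
      Σ[ as ∈ (Fin s → Fin n) ] Σ[ B ∈ (Fin n → Bool) ]
        ((∀ b → T (B b) → T (B₀ b) × Joint as b) × size B₀ * D ^ s ≤ size B * cnt A? ^ s)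
    common-neighbours zero deg≥ = (λ ()) , B₀ , (λ b b∈ → b∈ , (λ ()) , (λ ())) , ℕ.≤-refl
    common-neighbours (suc s) deg≥ = as′ , B′ , joint , bound
      where
      rec = common-neighbours s (λ b b∈ → ℕ.≤-trans (ℕ.+-monoʳ-≤ D (ℕ.m≤n+m (s * X) X)) (deg≥ b b∈))
      as = proj₁ rec
      B  = proj₁ (proj₂ rec)
      B-joint = proj₁ (proj₂ (proj₂ rec))
      B-bound = proj₂ (proj₂ (proj₂ rec))
      0<B : 0 < size B
      0<B = ℕ.n≢0⇒n>0 (λ B≡0 → ℕ.<⇒≱ (ℕ.*-mono-≤ 0<B₀ (ℕ.m^n>0 D {{>-nonZero 0<D}} s))
        (ℕ.≤-trans B-bound (ℕ.≤-reflexive (cong (_* cnt A? ^ s) B≡0))))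
      Allowed : Fin n → Fin n → Set
      Allowed b a = Γ a b × ¬ (∃[ i ] conf b (as i) a)
      Allowed? : ∀ b a → Dec (Allowed b a)
      Allowed? b a = Γ? a b ×-dec ¬? (Fin.any? (λ i → conf? b (as i) a))
      many : ∀ b → T (B b) → D ≤ cnt (λ a → A? a ×-dec Allowed? b a)
      many b b∈ = ℕ.+-cancelʳ-≤ (s * X) D _ (begin
        D + s * X   ≤⟨ ℕ.+-monoʳ-≤ D (ℕ.m≤n+m (s * X) X) ⟩
        D + (X + s * X)   ≤⟨ deg≥ b (proj₁ (B-joint b b∈)) ⟩
        cnt (λ a → Γ? a b)   ≤⟨ cnt-split (λ a → Γ? a b) (λ a → A? a ×-dec Allowed? b a)
                        (λ a → Fin.any? (λ i → Γ? a b ×-dec conf? b (as i) a)) cases ⟩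
        cnt (λ a → A? a ×-dec Allowed? b a) + cnt (λ a → Fin.any? (λ i → Γ? a b ×-dec conf? b (as i) a))
                        ≤⟨ ℕ.+-monoʳ-≤ _ (cnt-any (λ i a → Γ? a b ×-dec conf? b (as i) a)
                        (λ i → conf≤ b (as i) (proj₁ (proj₂ (B-joint b b∈)) i))) ⟩
        cnt (λ a → A? a ×-dec Allowed? b a) + s * X ∎)
        where
        cases : ∀ a → Γ a b → (A a × Allowed b a) ⊎ (∃[ i ] (Γ a b × conf b (as i) a))
        cases a g with Fin.any? (λ i → conf? b (as i) a)
        ... | yes (i , c) = inj₂ (i , g , c)
        ... | no none     = inj₁ (Γ⇒A g , g , none)
      found = ∃-above-average A? {f = λ a → cnt (λ b → T? (B b) ×-dec Allowed? b a)} {X = size B * D}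
        (ℕ.*-mono-≤ 0<B 0<D)
        (begin
          size B * D   ≤⟨ cnt-∑≥ (λ b → T? (B b)) many ⟩
          ∑ (λ b → ind (T? (B b)) * cnt (λ a → A? a ×-dec Allowed? b a))
                        ≡⟨ double-count (λ b → T? (B b)) A? Allowed? ⟩
          ∑ (λ a → ind (A? a) * cnt (λ b → T? (B b) ×-dec Allowed? b a)) ∎)
      a₀ = proj₁ found
      B′? : ∀ b → Dec (T (B b) × Allowed b a₀)
      B′? b = T? (B b) ×-dec Allowed? b a₀
      B′ : Fin n → Bool
      B′ = set B′?
      as′ : Fin (suc s) → Fin n
      as′ zero    = a₀
      as′ (suc i) = as i
      joint : ∀ b → T (B′ b) → T (B₀ b) × Joint as′ b
      joint b b∈ = proj₁ (B-joint b b∈B) , adj , sep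
        where
        member : T (B b) × Allowed b a₀
        member = toWitness {a? = B′? b} b∈
        b∈B = proj₁ member
        adj : ∀ i → Γ (as′ i) b
        adj zero    = proj₁ (proj₂ member)
        adj (suc i) = proj₁ (proj₂ (B-joint b b∈B)) i
        sep : ∀ i j → i Fin.< j → ¬ conf b (as′ j) (as′ i)
        sep zero    (suc j) _         c = proj₂ (proj₂ member) (j , c)
        sep (suc i) (suc j) (s≤s i<j) c = proj₂ (proj₂ (B-joint b b∈B)) i j i<j c
      bound : size B₀ * D ^ suc s ≤ size B′ * cnt A? ^ suc s
      bound = begin
        size B₀ * (D * D ^ s)   ≡⟨ swap₁ (size B₀) D (D ^ s) ⟩
        D * (size B₀ * D ^ s)   ≤⟨ ℕ.*-monoʳ-≤ D B-bound ⟩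
        D * (size B * cnt A? ^ s)   ≡⟨ swap₂ D (size B) (cnt A? ^ s) ⟩
        size B * D * cnt A? ^ s   ≤⟨ ℕ.*-monoˡ-≤ (cnt A? ^ s) (proj₂ (proj₂ found)) ⟩
        cnt A? * cnt B′? * cnt A? ^ s   ≤⟨ ℕ.*-monoˡ-≤ (cnt A? ^ s) (ℕ.*-monoʳ-≤ (cnt A?) (cnt-mono B′? (λ b → T? (B′ b)) (λ b → fromWitness {a? = B′? b}))) ⟩
        cnt A? * size B′ * cnt A? ^ s   ≡⟨ swap₃ (cnt A?) (size B′) (cnt A? ^ s) ⟩
        size B′ * (cnt A? * cnt A? ^ s)           ∎
        where
        swap₁ : ∀ a b c → a * (b * c) ≡ b * (a * c)
        swap₁ = solve-∀
        swap₂ : ∀ a b c → a * (b * c) ≡ b * a * c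
        swap₂ = solve-∀
        swap₃ : ∀ a b c → a * b * c ≡ b * (a * c)
        swap₃ = solve-∀

  module BipartiteCore {n : ℕ} {R : Fin n → Fin n → Set} (R? : ∀ x y → Dec (R x y))
                       (R-sym : ∀ {x y} → R x y → R y x) (M : ℕ) where

    degree : (Fin n → Bool) → Fin n → ℕ
    degree Z y = cnt (λ z → T? (Z z) ×-dec R? y z)

    edges-between : (Fin n → Bool) → (Fin n → Bool) → ℕ
    edges-between Y Z = ∑ (λ y → ind (T? (Y y)) * degree Z y)

    edges-between-sym : ∀ Y Z → edges-between Y Z ≤ edges-between Z Y
    edges-between-sym Y Z = ℕ.≤-trans
      (ℕ.≤-reflexive (double-count (λ y → T? (Y y)) (λ z → T? (Z z)) R?))
      (∑-mono (λ z → ℕ.*-monoʳ-≤ (ind (T? (Z z))) (cnt-mono (λ y → T? (Y y) ×-dec R? y z) (λ y → T? (Y y) ×-dec R? z y)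
        (λ y (y∈ , r) → y∈ , R-sym r))))

    Dense : (Fin n → Bool) → (Fin n → Bool) → Set
    Dense Y Z = M * (size Y + size Z) < edges-between Y Z

    Dense-sym : ∀ Y Z → Dense Y Z → Dense Z Y
    Dense-sym Y Z dense = ℕ.<-≤-trans
      (ℕ.≤-<-trans (ℕ.≤-reflexive (cong (M *_) (ℕ.+-comm (size Z) (size Y)))) dense) (edges-between-sym Y Z)

    Dense-∖ : ∀ Y Z y → T (Y y) → degree Z y ≤ M → Dense Y Z → Dense (Y ∖ (Fin._≟ y)) Z
    Dense-∖ Y Z y y∈ low dense = ℕ.+-cancelˡ-< M _ _ (begin-strict
      M + M * (size Y′ + size Z)   ≡⟨ ℕ.*-suc M (size Y′ + size Z) ⟨
      M * (suc (size Y′) + size Z)   ≡⟨ cong (λ m → M * (m + size Z)) (size-∖ Y y∈) ⟨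
      M * (size Y + size Z)   <⟨ dense ⟩
      edges-between Y Z   ≤⟨ ∑-mono pointwise ⟩
      ∑ (λ x → ind (x Fin.≟ y) * degree Z x + ind (T? (Y′ x)) * degree Z x)
                        ≡⟨ ∑-+ (λ x → ind (x Fin.≟ y) * degree Z x) _ ⟩
      ∑ (λ x → ind (x Fin.≟ y) * degree Z x) + edges-between Y′ Z
                        ≡⟨ cong (_+ edges-between Y′ Z) (∑-ind≟ y (degree Z)) ⟩
      degree Z y + edges-between Y′ Z   ≤⟨ ℕ.+-monoˡ-≤ _ low ⟩
      M + edges-between Y′ Z                      ∎)
      where
      Y′ = Y ∖ (Fin._≟ y)
      pointwise : ∀ x → ind (T? (Y x)) * degree Z x ≤ ind (x Fin.≟ y) * degree Z x + ind (T? (Y′ x)) * degree Z x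
      pointwise x = ℕ.≤-trans
        (ℕ.*-monoˡ-≤ (degree Z x) (ind-split (T? (Y x)) (x Fin.≟ y) (T? (Y′ x))
          (λ x∈ → [ inj₂ , inj₁ ]′ (∖-cases Y (Fin._≟ y) x∈))))
        (ℕ.≤-reflexive (ℕ.*-distribʳ-+ (degree Z x) (ind (x Fin.≟ y)) _))

    -- Removing a vertex with at most `M` neighbours on the other side lowers
    -- `M * (size Y + size Z)` by `M` and the edge count by at most `M`, so the strict inequality
    -- `Dense` persists until every degree exceeds `M`.
    core : ∀ k Y Z → size Y + size Z ≡ k → Dense Y Z →
           Σ[ Y′ ∈ (Fin n → Bool) ] Σ[ Z′ ∈ (Fin n → Bool) ]
             ((∀ y → T (Y′ y) → T (Y y)) × (∀ y → T (Y′ y) → M < degree Z′ y) ×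
              (∀ z → T (Z′ z) → M < degree Y′ z) × Dense Y′ Z′)
    core k Y Z eq dense with Fin.any? (λ y → T? (Y y) ×-dec (degree Z y ℕ.≤? M))
                           | Fin.any? (λ z → T? (Z z) ×-dec (degree Y z ℕ.≤? M))
    core k Y Z eq dense | no noY | no noZ = Y , Z , (λ _ → id) ,
      (λ y y∈ → ℕ.≰⇒> (λ le → noY (y , y∈ , le))) , (λ z z∈ → ℕ.≰⇒> (λ le → noZ (z , z∈ , le))) , dense
    core zero Y Z eq dense | yes (y , y∈ , _) | _ =
      contradiction (∃⇒cnt>0 (λ y → T? (Y y)) y y∈) (ℕ.<⇒≱ (s≤s (ℕ.≤-reflexive (ℕ.m+n≡0⇒m≡0 (size Y) eq))))
    core zero Y Z eq dense | no _ | yes (z , z∈ , _) =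
      contradiction (∃⇒cnt>0 (λ z → T? (Z z)) z z∈) (ℕ.<⇒≱ (s≤s (ℕ.≤-reflexive (ℕ.m+n≡0⇒n≡0 (size Y) eq))))
    core (suc k) Y Z eq dense | yes (y , y∈ , low) | _ =
      proj₁ rec , proj₁ (proj₂ rec) , (λ x → proj₁ ∘ toWitness ∘ proj₁ (proj₂ (proj₂ rec)) x) , proj₂ (proj₂ (proj₂ rec))
      where
      rec = core k (Y ∖ (Fin._≟ y)) Z (ℕ.suc-injective (trans (cong (_+ size Z) (sym (size-∖ Y y∈))) eq))
              (Dense-∖ Y Z y y∈ low dense)
    core (suc k) Y Z eq dense | no _ | yes (z , z∈ , low) =
      core k Y (Z ∖ (Fin._≟ z))
        (ℕ.suc-injective (trans (sym (ℕ.+-suc (size Y) _)) (trans (cong (size Y +_) (sym (size-∖ Z z∈))) eq)))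
        (Dense-sym (Z ∖ (Fin._≟ z)) Y (Dense-∖ Z Y z z∈ low (Dense-sym Y Z dense)))

    Dense⇒∃ : ∀ Y Z → Dense Y Z → ∃[ y ] T (Y y)
    Dense⇒∃ Y Z dense = cnt>0⇒∃ (λ y → T? (Y y)) (ℕ.n≢0⇒n>0 (λ Y≡0 → ℕ.<⇒≱ dense (begin
      edges-between Y Z   ≤⟨ cnt-∑≤ (λ y → T? (Y y)) {c = n} (λ y _ → cnt-≤ (λ z → T? (Z z) ×-dec R? y z)) ⟩
      size Y * n   ≡⟨ cong (_* n) Y≡0 ⟩
      0   ≤⟨ z≤n ⟩
      M * (size Y + size Z)          ∎)))

  -- Robustly connected pairs are rare around every vertex

  <⇒≢-all : ∀ {m} {P : Fin m → Fin m → Set} → (∀ {i j} → P i j → P j i) → (∀ i j → i Fin.< j → P i j) →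
            ∀ {i j} → i ≢ j → P i j
  <⇒≢-all P-sym h {i} {j} i≢j with Fin.<-cmp i j
  ... | tri< i<j _ _ = h i j i<j
  ... | tri≈ _ i≡j _ = contradiction i≡j i≢j
  ... | tri> _ _ j<i = P-sym (h j i j<i)

  module Heavy {n : ℕ} (R : Fin n → Fin n → Set) (R? : ∀ x y → Dec (R x y))
               (R-sym : ∀ {x y} → R x y → R y x) where

    open Walks R R? R-sym

    private V = Fin n

    penultimate : ∀ {u v} p {q} → length p ≡ suc q → Walk u p v → ∃[ z ] (z ∈ p × Reach (suc q) u z × R z v)
    penultimate (x ∷ [])    refl (Rux , Rxv)  = x , here refl , (x , Rux , refl) , Rxv
    penultimate (x ∷ y ∷ p) refl (Rux , walk) with penultimate (y ∷ p) refl walk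
    ... | z , z∈ , reach , Rzv = z , there z∈ , (x , Rux , reach) , Rzv

    module _ (K d : ℕ) (0<d : 0 < d) (deg≤ : ∀ x → cnt (R? x) ≤ K * d)
             (s′ t q r M κ Q : ℕ) where

      s c L Q′ Mᵣ : ℕ
      s  = suc s′
      c  = suc q
      L  = r + c
      -- `B₀` will have more than `d ^ c / (2 * Q * K)` vertices, and each of the `s` choices among
      -- at most `K * d` neighbours keeps at least a fraction `1 / (K * (8 * Q * κ))`. The product
      -- of these losses gives `d ^ c < Q′ * size B`.
      Q′ = 2 * Q * K * (K * (8 * Q * κ)) ^ s
      -- `Z₁` has at most `κ * d ^ c`, hence at most `κ * Q′ * size B` vertices. Degrees above `Mᵣ`
      -- from `B` into `Z₁` therefore give more than `M * (size B + size Z₁)` edges.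
      Mᵣ = M * (1 + κ * Q′)

      Γ : V → V → V → Set
      Γ x a z = R x a × Reach c x z × Robust Mᵣ c a z

      Γ? : ∀ x a z → Dec (Γ x a z)
      Γ? x a z = R? x a ×-dec reach? c x z ×-dec robust? Mᵣ c a z

      heavy-pairs : V → ℕ
      heavy-pairs x = ∑ (λ z → cnt (λ a → Γ? x a z))

      module _ (0<Q : 0 < Q) (0<κ : 0 < κ) (K^c≤κ : K ^ c ≤ κ)
               (M-large : 2 + (s + t + s * t * L) + r ≤ M) (d-large : 2 * s * (2 * Q * κ) ≤ d)
               (x₀ : V) (many : d ^ suc c < Q * heavy-pairs x₀) where

        private
          instance
            2Qκ≢0 : NonZero (2 * Q * κ)
            2Qκ≢0 = ℕ.m*n≢0 (2 * Q) κ {{ℕ.m*n≢0 2 Q {{_}} {{>-nonZero 0<Q}}}} {{>-nonZero 0<κ}}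
            d≢0 : NonZero d
            d≢0 = >-nonZero 0<d

          reach≤ : ∀ x → cnt (reach? c x) ≤ κ * d ^ c
          reach≤ x = begin
            cnt (reach? c x)  ≤⟨ cnt-reach deg≤ c x ⟩
            (K * d) ^ c   ≡⟨ ^-distrib-* K d c ⟩
            K ^ c * d ^ c   ≤⟨ ℕ.*-monoˡ-≤ (d ^ c) K^c≤κ ⟩
            κ * d ^ c         ∎

          D₀ D : ℕ
          -- The at most `κ * d ^ c` vertices `z` with fewer than `D₀` partners account for at most
          -- `d ^ suc c / (2 * Q)` pairs, half of what `many` provides. Subtracting `s` in `D`
          -- leaves room to discard the vertices already chosen.
          D₀ = d / (2 * Q * κ)
          D  = D₀ ∸ s

          2s≤D₀ : 2 * s ≤ D₀
          2s≤D₀ = s≤s⁻¹ (ℕ.*-cancelʳ-< (2 * Q * κ) (2 * s) (suc D₀) (ℕ.≤-<-trans d-large (m<[1+m/n]*n d (2 * Q * κ))))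

          s≤D : s ≤ D
          s≤D = ℕ.≤-trans (ℕ.≤-reflexive (sym (trans (cong (_∸ s) (cong (s +_) (ℕ.+-identityʳ s))) (ℕ.m+n∸n≡m s s))))
                          (ℕ.∸-monoˡ-≤ s 2s≤D₀)

          D+s≡D₀ : D + s ≡ D₀
          D+s≡D₀ = ℕ.m∸n+n≡m (ℕ.≤-trans (ℕ.m≤m+n s _) 2s≤D₀)

          d≤ : d ≤ 8 * Q * κ * D
          d≤ = begin
            d   ≤⟨ ℕ.<⇒≤ (m<[1+m/n]*n d (2 * Q * κ)) ⟩
            suc D₀ * (2 * Q * κ)   ≡⟨ cong (λ k → suc k * (2 * Q * κ)) (sym D+s≡D₀) ⟩
            (1 + (D + s)) * (2 * Q * κ) ≤⟨ ℕ.*-monoˡ-≤ (2 * Q * κ) (ℕ.+-mono-≤ (ℕ.≤-trans (s≤s z≤n) s≤D) (ℕ.+-monoʳ-≤ D s≤D)) ⟩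
            (D + (D + D)) * (2 * Q * κ) ≤⟨ ℕ.*-monoˡ-≤ (2 * Q * κ) (ℕ.m≤n+m (D + (D + D)) D) ⟩
            (D + (D + (D + D))) * (2 * Q * κ) ≡⟨ shuffle D Q κ ⟩
            8 * Q * κ * D               ∎
            where
            shuffle : ∀ D Q κ → (D + (D + (D + D))) * (2 * Q * κ) ≡ 8 * Q * κ * D
            shuffle = solve-∀

          deg : V → ℕ
          deg z = cnt (λ a → Γ? x₀ a z)

          B₀? : ∀ z → Dec (D₀ ≤ deg z)
          B₀? z = D₀ ℕ.≤? deg z

          B₀ : V → Bool
          B₀ = set B₀?

          pairs≤ : heavy-pairs x₀ ≤ size B₀ * (K * d) + κ * d ^ c * D₀
          pairs≤ = begin
            heavy-pairs x₀   ≤⟨ ∑-mono pointwise ⟩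
            ∑ (λ z → ind (T? (B₀ z)) * (K * d) + ind (reach? c x₀ z) * D₀)
                        ≡⟨ ∑-+ (λ z → ind (T? (B₀ z)) * (K * d)) _ ⟩
            ∑ (λ z → ind (T? (B₀ z)) * (K * d)) + ∑ (λ z → ind (reach? c x₀ z) * D₀)
                        ≡⟨ cong₂ _+_ (∑-*ʳ (K * d) (λ z → ind (T? (B₀ z)))) (∑-*ʳ D₀ (λ z → ind (reach? c x₀ z))) ⟩
            size B₀ * (K * d) + cnt (reach? c x₀) * D₀   ≤⟨ ℕ.+-monoʳ-≤ (size B₀ * (K * d)) (ℕ.*-monoˡ-≤ D₀ (reach≤ x₀)) ⟩
            size B₀ * (K * d) + κ * d ^ c * D₀                 ∎
            where
            rich : ∀ z → T (B₀ z) ⊎ deg z ≤ D₀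
            rich z = decide (B₀? z)
              where
              decide : Dec (D₀ ≤ deg z) → T (B₀ z) ⊎ deg z ≤ D₀
              decide (yes le) = inj₁ (fromWitness {a? = B₀? z} le)
              decide (no nle) = inj₂ (ℕ.<⇒≤ (ℕ.≰⇒> nle))
            pointwise : ∀ z → deg z ≤ ind (T? (B₀ z)) * (K * d) + ind (reach? c x₀ z) * D₀
            pointwise z = [ high , low (reach? c x₀ z) ]′ (rich z)
              where
              high : T (B₀ z) → deg z ≤ ind (T? (B₀ z)) * (K * d) + ind (reach? c x₀ z) * D₀
              high z∈ = begin
                deg z   ≤⟨ cnt-mono (λ a → Γ? x₀ a z) (R? x₀) (λ a → proj₁) ⟩
                cnt (R? x₀)   ≤⟨ deg≤ x₀ ⟩
                K * d   ≡⟨ ℕ.*-identityˡ (K * d) ⟨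
                1 * (K * d)   ≤⟨ ℕ.*-monoˡ-≤ (K * d) (ind-yes (T? (B₀ z)) z∈) ⟩
                ind (T? (B₀ z)) * (K * d)   ≤⟨ ℕ.m≤m+n _ _ ⟩
                ind (T? (B₀ z)) * (K * d) + ind (reach? c x₀ z) * D₀ ∎
              low : (reachable : Dec (Reach c x₀ z)) → deg z ≤ D₀ → deg z ≤ ind (T? (B₀ z)) * (K * d) + ind reachable * D₀
              low (yes _) le = ℕ.≤-trans le (ℕ.≤-trans (ℕ.≤-reflexive (sym (ℕ.*-identityˡ D₀))) (ℕ.m≤n+m (1 * D₀) (ind (T? (B₀ z)) * (K * d))))
              low (no unreachable) _ = ℕ.≤-trans (ℕ.≤-reflexive (trans
                (∑-cong (λ a → ind-no (Γ? x₀ a z) (unreachable ∘ proj₁ ∘ proj₂))) (∑-0 n))) z≤n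

          d^c< : d ^ c < 2 * Q * K * size B₀
          d^c< = ℕ.*-cancelʳ-< d (d ^ c) (2 * Q * K * size B₀) (ℕ.+-cancelʳ-< (d ^ c * d) _ _ (begin-strict
            d ^ c * d + d ^ c * d   ≡⟨ double (d ^ c) d ⟩
            2 * d ^ suc c   <⟨ ℕ.*-monoʳ-< 2 many ⟩
            2 * (Q * heavy-pairs x₀)   ≤⟨ ℕ.*-monoʳ-≤ 2 (ℕ.*-monoʳ-≤ Q pairs≤) ⟩
            2 * (Q * (size B₀ * (K * d) + κ * d ^ c * D₀))   ≡⟨ expand Q (size B₀) K d κ (d ^ c) D₀ ⟩
            2 * Q * K * size B₀ * d + d ^ c * (D₀ * (2 * Q * κ))
                        ≤⟨ ℕ.+-monoʳ-≤ _ (ℕ.*-monoʳ-≤ (d ^ c) (m/n*n≤m d (2 * Q * κ))) ⟩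
            2 * Q * K * size B₀ * d + d ^ c * d               ∎))
            where
            double : ∀ a d → a * d + a * d ≡ 2 * (d * a)
            double = solve-∀
            expand : ∀ Q b K d κ a D → 2 * (Q * (b * (K * d) + κ * a * D)) ≡ 2 * Q * K * b * d + a * (D * (2 * Q * κ))
            expand = solve-∀

          0<B₀ : 0 < size B₀
          0<B₀ = ℕ.n≢0⇒n>0 (λ B₀≡0 → ℕ.<⇒≱ d^c< (ℕ.≤-trans
            (ℕ.≤-reflexive (trans (cong (2 * Q * K *_) B₀≡0) (ℕ.*-zeroʳ (2 * Q * K)))) z≤n))

          -- Conflict is mere equality: only distinct `a` are asked for here, since robustness will
          -- make the paths disjoint later.
          open CommonNeighbours {Γ = Γ x₀} (Γ? x₀) {A = R x₀} (R? x₀) proj₁ {conf = λ b a a′ → a ≡ a′} (λ b a a′ → a Fin.≟ a′) {D = D} {X = 1}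
            (λ b a _ → ℕ.≤-trans (cnt-mono (λ a′ → Γ? x₀ a′ b ×-dec (a Fin.≟ a′)) (Fin._≟ a) (λ a′ → sym ∘ proj₂)) (ℕ.≤-reflexive (cnt-≟ a)))
            (ℕ.≤-trans (s≤s z≤n) s≤D) B₀ 0<B₀

          common = common-neighbours s (λ b b∈ → ℕ.≤-trans
            (ℕ.≤-reflexive (trans (cong (D +_) (ℕ.*-identityʳ s)) D+s≡D₀)) (toWitness {a? = B₀? b} b∈))

          as : Fin s → V
          as = proj₁ common

          B : V → Bool
          B = proj₁ (proj₂ common)

          B⇒Γ : ∀ b → T (B b) → ∀ i → Γ x₀ (as i) b
          B⇒Γ b b∈ = proj₁ (proj₂ (proj₁ (proj₂ (proj₂ common)) b b∈))

          B-large : d ^ c < Q′ * size B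
          B-large = ℕ.<-≤-trans d^c< (ℕ.*-cancelʳ-≤ _ _ (d ^ s) {{ℕ.m^n≢0 d s}} (begin
            2 * Q * K * size B₀ * d ^ s   ≤⟨ ℕ.*-monoʳ-≤ (2 * Q * K * size B₀) (ℕ.^-monoˡ-≤ s d≤) ⟩
            2 * Q * K * size B₀ * (8 * Q * κ * D) ^ s   ≡⟨ cong (2 * Q * K * size B₀ *_) (^-distrib-* (8 * Q * κ) D s) ⟩
            2 * Q * K * size B₀ * ((8 * Q * κ) ^ s * D ^ s)   ≡⟨ pull (2 * Q * K) (size B₀) ((8 * Q * κ) ^ s) (D ^ s) ⟩
            2 * Q * K * (8 * Q * κ) ^ s * (size B₀ * D ^ s)   ≤⟨ ℕ.*-monoʳ-≤ (2 * Q * K * (8 * Q * κ) ^ s) (proj₂ (proj₂ (proj₂ common))) ⟩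
            2 * Q * K * (8 * Q * κ) ^ s * (size B * cnt (R? x₀) ^ s)
                        ≤⟨ ℕ.*-monoʳ-≤ (2 * Q * K * (8 * Q * κ) ^ s) (ℕ.*-monoʳ-≤ (size B) (ℕ.^-monoˡ-≤ s (deg≤ x₀))) ⟩
            2 * Q * K * (8 * Q * κ) ^ s * (size B * (K * d) ^ s)
                        ≡⟨ cong (λ k → 2 * Q * K * (8 * Q * κ) ^ s * (size B * k)) (^-distrib-* K d s) ⟩
            2 * Q * K * (8 * Q * κ) ^ s * (size B * (K ^ s * d ^ s))
                        ≡⟨ collect (2 * Q * K) ((8 * Q * κ) ^ s) (size B) (K ^ s) (d ^ s) ⟩
            2 * Q * K * (K ^ s * (8 * Q * κ) ^ s) * size B * d ^ s
                        ≡⟨ cong (λ k → 2 * Q * K * k * size B * d ^ s) (^-distrib-* K (8 * Q * κ) s) ⟨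
            Q′ * size B * d ^ s                               ∎))
            where
            pull : ∀ a b e f → a * b * (e * f) ≡ a * e * (b * f)
            pull = solve-∀
            collect : ∀ a e b k f → a * e * (b * (k * f)) ≡ a * (k * e) * b * f
            collect = solve-∀

          0<B : 0 < size B
          0<B = ℕ.n≢0⇒n>0 (λ B≡0 → ℕ.<⇒≱ B-large (ℕ.≤-trans
            (ℕ.≤-reflexive (trans (cong (Q′ *_) B≡0) (ℕ.*-zeroʳ Q′))) z≤n))

          as-inj : ∀ {i j} → i ≢ j → as i ≢ as j
          as-inj = <⇒≢-all (λ i≢j j≡i → i≢j (sym j≡i)) (λ i j i<j i≡j →
            let b , b∈ = cnt>0⇒∃ (λ b → T? (B b)) 0<B in
            proj₂ (proj₂ (proj₁ (proj₂ (proj₂ common)) b b∈)) i j i<j (sym i≡j))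

          -- A single `a` defines the other side of the bipartite graph, which keeps that side of
          -- order `d ^ c`; `as zero` exists because `s` is a successor.
          Z₁? : ∀ z → Dec (Reach c (as zero) z)
          Z₁? = reach? c (as zero)

          Z₁ : V → Bool
          Z₁ = set Z₁?

          open BipartiteCore R? R-sym M

          -- A robust pair has more than Mᵣ penultimate vertices, as these block all paths.
          degree> : ∀ y → T (B y) → Mᵣ < degree Z₁ y
          degree> y y∈ = ℕ.≰⇒> (λ le → blocked (robust-≤ (proj₂ (proj₂ (B⇒Γ y y∈ zero))) (elements P?)
              (ℕ.≤-trans (ℕ.≤-reflexive (length-elements P?)) le)))
            where
            P? : ∀ z → Dec (T (Z₁ z) × R y z)
            P? z = T? (Z₁ z) ×-dec R? y z
            blocked : ¬ PathAvoiding c (as zero) y (elements P?)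
            blocked (pathAvoiding p len walk _ avoids) = avoids z z∈p
                (there (there (∈-elements P? (fromWitness {a? = Z₁? z} reach , R-sym Rzy))))
              where
              found = penultimate p len walk
              z     = proj₁ found
              z∈p   = proj₁ (proj₂ found)
              reach = proj₁ (proj₂ (proj₂ found))
              Rzy   = proj₂ (proj₂ (proj₂ found))

          dense : Dense B Z₁
          dense = begin-strict
            M * (size B + size Z₁)   ≤⟨ ℕ.*-monoʳ-≤ M (ℕ.+-monoʳ-≤ (size B) (begin
              size Z₁   ≤⟨ cnt-mono (λ z → T? (Z₁ z)) Z₁? (λ z → toWitness) ⟩
              cnt Z₁?   ≤⟨ reach≤ (as zero) ⟩
              κ * d ^ c   ≤⟨ ℕ.*-monoʳ-≤ κ (ℕ.<⇒≤ B-large) ⟩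
              κ * (Q′ * size B)                     ∎)) ⟩
            M * (size B + κ * (Q′ * size B))   ≡⟨ collect M (size B) κ Q′ ⟩
            size B * Mᵣ   <⟨ ℕ.*-monoʳ-< (size B) {{>-nonZero 0<B}} (ℕ.n<1+n Mᵣ) ⟩
            size B * suc Mᵣ   ≤⟨ cnt-∑≥ (λ y → T? (B y)) degree> ⟩
            edges-between B Z₁                    ∎
            where
            collect : ∀ M b κ Q → M * (b + κ * (Q * b)) ≡ b * (M * (1 + κ * Q))
            collect = solve-∀

          the-core = core (size B + size Z₁) B Z₁ refl dense

          Y Z : V → Bool
          Y = proj₁ the-core
          Z = proj₁ (proj₂ the-core)

          Y⊆B    = proj₁ (proj₂ (proj₂ the-core))
          Y-min  = proj₁ (proj₂ (proj₂ (proj₂ the-core)))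
          Z-min  = proj₁ (proj₂ (proj₂ (proj₂ (proj₂ the-core))))

          -- The side of the core from which walks of length i end in Y.
          side : ℕ → V → Bool
          side 0             = Y
          side 1             = Z
          side (suc (suc i)) = side i

          side-min : ∀ i x → T (side (suc i) x) → M < degree (side i) x
          side-min 0             = Z-min
          side-min 1             = Y-min
          side-min (suc (suc i)) = side-min i

          degree≤ : ∀ S x → degree S x ≤ size S
          degree≤ S x = cnt-mono (λ y → T? (S y) ×-dec R? x y) (λ y → T? (S y)) (λ y → proj₁)

          Y∋ : ∃[ y ] T (Y y)
          Y∋ = Dense⇒∃ Y Z (proj₂ (proj₂ (proj₂ (proj₂ (proj₂ the-core)))))

          M<Z : M < size Z
          M<Z = ℕ.<-≤-trans (Y-min (proj₁ Y∋) (proj₂ Y∋)) (degree≤ Z (proj₁ Y∋))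

          M<Y : M < size Y
          M<Y = let z , z∈ = cnt>0⇒∃ (λ z → T? (Z z)) (ℕ.≤-trans (s≤s z≤n) M<Z) in
            ℕ.<-≤-trans (Z-min z z∈) (degree≤ Y z)

          M<side : ∀ i → M < size (side i)
          M<side 0             = M<Y
          M<side 1             = M<Z
          M<side (suc (suc i)) = M<side i

          -- From `x` one walks back through alternating sides of the core, each time to a neighbour
          -- off `as i`, `x` and `W`, until a vertex of `Y` is reached, from which robustness leads
          -- to `as i`. Every step adds a vertex to `W`, whence the summand `k` in the budget; the 2
          -- stands for the ends.
          connect : ∀ k i x W → T (side k x) → 2 + length W + k ≤ M → PathAvoiding (k + c) (as i) x W
          connect zero i x W x∈ le = robust-≤ (proj₂ (proj₂ (B⇒Γ x (Y⊆B x x∈) i))) W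
            (ℕ.≤-trans (ℕ.≤-trans (ℕ.m≤m+n (length W) 0) (ℕ.≤-trans (ℕ.m≤n+m _ 2) le)) (ℕ.m≤m*n M (1 + κ * Q′)))
          connect (suc k) i x W x∈ le = extend (∃-avoiding (λ z → T? (side k z) ×-dec R? x z) (as i ∷ x ∷ W)
              (ℕ.≤-<-trans (ℕ.≤-trans (ℕ.m≤m+n _ (suc k)) le) (side-min k x x∈)))
            where
            extend : ∃[ z ] ((T (side k z) × R x z) × z ∉ as i ∷ x ∷ W) → PathAvoiding (suc k + c) (as i) x W
            extend (z , (z∈ , Rxz) , z∉) = finish (connect k i z (x ∷ W) z∈
                (ℕ.≤-trans (ℕ.≤-reflexive (sym (ℕ.+-suc (2 + length W) k))) le))
              where
              finish : PathAvoiding (k + c) (as i) z (x ∷ W) → PathAvoiding (suc k + c) (as i) x W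
              finish (pathAvoiding p len walk uniq avoids) = pathAvoiding (p ++ z ∷ [])
                (trans (List.length-++ p) (trans (ℕ.+-comm (length p) 1) (cong suc len)))
                (Walk-++ p walk (R-sym Rxz))
                (Unique-++ uniq ([] ∷ []) (λ { v v∈p (here refl) → avoids v v∈p (there (here refl)) }))
                (λ v v∈ v∈′ → [ (λ v∈p → avoids v v∈p (weaken v∈′))
                              , (λ { (here refl) → z∉ v∈′ }) ]′ (∈-++⁻ p v∈))
                where
                weaken : ∀ {v} → v ∈ as i ∷ x ∷ W → v ∈ as i ∷ z ∷ x ∷ W
                weaken (here eq)  = here eq
                weaken (there v∈) = there (there v∈)

          s+t≤M : s + t ≤ M
          s+t≤M = ℕ.≤-trans (ℕ.m≤m+n (s + t) (s * t * L)) (ℕ.≤-trans (ℕ.m≤n+m _ 2) (ℕ.≤-trans (ℕ.m≤m+n _ r) M-large))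

          bs : Σ[ f ∈ (Fin t → V) ] ((∀ i → T (side r (f i)) × f i ∉ List.tabulate as) × (∀ i → All (λ c → c ≢ f i) []) ×
                        (∀ i j → i Fin.< j → f i ≢ f j))
          bs = greedy t t (λ _ x → T (side r x) × x ∉ List.tabulate as) step [] ℕ.≤-refl
            where
            step : ∀ (i : Fin t) (cs : List V) → length cs < t →
                   ∃[ x ] ((T (side r x) × x ∉ List.tabulate as) × All (λ c → c ≢ x) cs)
            step i cs lt = extend (∃-avoiding (λ x → T? (side r x)) (List.tabulate as ++ cs) (begin-strict
                length (List.tabulate as ++ cs)  ≡⟨ trans (List.length-++ (List.tabulate as)) (cong (_+ length cs) (List.length-tabulate as)) ⟩
                s + length cs   <⟨ ℕ.+-monoʳ-< s lt ⟩
                s + t   ≤⟨ s+t≤M ⟩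
                M   <⟨ M<side r ⟩
                size (side r)                    ∎))
              where
              extend : ∃[ x ] (T (side r x) × x ∉ List.tabulate as ++ cs) →
                       ∃[ x ] ((T (side r x) × x ∉ List.tabulate as) × All (λ c → c ≢ x) cs)
              extend (x , x∈ , x∉) = x , (x∈ , λ x∈as → x∉ (∈-++⁺ˡ x∈as)) ,
                All.tabulate (λ c∈ c≡x → x∉ (∈-++⁺ʳ (List.tabulate as) (subst (_∈ cs) c≡x c∈)))

        robust⇒system : PathSystem s t L
        robust⇒system = robust-system as (proj₁ bs) as-inj
          (<⇒≢-all (λ i≢j j≡i → i≢j (sym j≡i)) (proj₂ (proj₂ (proj₂ bs))))
          (λ i j eq → proj₂ (proj₁ (proj₂ bs) j) (subst (_∈ List.tabulate as) eq (∈-tabulate⁺ {f = as} i)))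
          (λ i j W le → case connect r i (proj₁ bs j) W (proj₁ (proj₁ (proj₂ bs) j))
              (ℕ.≤-trans (ℕ.+-monoˡ-≤ r (ℕ.+-monoʳ-≤ 2 le)) M-large) of
            λ { (pathAvoiding p len walk uniq avoids) →
                connector p len walk uniq (λ v v∈p v∈W → avoids v v∈p (there (there v∈W))) })

  -- Light paths

  module Light {n : ℕ} (R : Fin n → Fin n → Set) (R? : ∀ x y → Dec (R x y))
               (R-sym : ∀ {x y} → R x y → R y x)
               (S : Fin n → Bool) (R⇒S : ∀ {x y} → R x y → T (S x)) (Mth : ℕ → ℕ) where

    open Walks R R? R-sym

    private V = Fin n

    Rob : ℕ → V → V → Set
    Rob c = Robust (Mth c) c

    rob? : ∀ c u v → Dec (Rob c u v)
    rob? c = robust? (Mth c) c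

    -- `c` is the number of path vertices strictly between `a` and the head of the list. It grows
    -- along the list, so that each pair is tested at its own distance along the path.
    NonRobust : ℕ → V → List V → Set
    NonRobust c a []       = ⊤
    NonRobust c a (y ∷ ys) = ¬ Rob c a y × NonRobust (suc c) a ys

    nonRobust? : ∀ c a ys → Dec (NonRobust c a ys)
    nonRobust? c a []       = yes tt
    nonRobust? c a (y ∷ ys) = ¬? (rob? c a y) ×-dec nonRobust? (suc c) a ys

    -- Restricting one-vertex lists to `S` makes the light paths of length 0 as many as the vertices
    -- of `S`. The neighbour `x` of `a` is exempt from the robustness test, and the vertex after it
    -- is tested with one internal vertex.
    Extends : V → List V → Set
    Extends a []       = T (S a)
    Extends a (x ∷ xs) = R a x × a ∉ x ∷ xs × NonRobust 1 a xs

    extends? : ∀ a xs → Dec (Extends a xs)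
    extends? a []       = T? (S a)
    extends? a (x ∷ xs) = R? a x ×-dec ¬? (a ∈? (x ∷ xs)) ×-dec nonRobust? 1 a xs

    -- Light lists are the vertex lists of paths none of whose subpaths joins a robust pair.
    Light : List V → Set
    Light []       = ⊤
    Light (x ∷ xs) = Extends x xs × Light xs

    light? : ∀ xs → Dec (Light xs)
    light? []       = yes tt
    light? (x ∷ xs) = extends? x xs ×-dec light? xs

    NonRobust-prefix : ∀ c a xs {ys} → NonRobust c a (xs ++ ys) → NonRobust c a xs
    NonRobust-prefix c a []       _        = tt
    NonRobust-prefix c a (x ∷ xs) (¬r , h) = ¬r , NonRobust-prefix (suc c) a xs h

    Light-prefix : ∀ x xs {ys} → Light (x ∷ xs ++ ys) → Light (x ∷ xs)
    Light-prefix x []        {[]}     (e , _)             = e , tt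
    Light-prefix x []        {y ∷ ys} ((Rxy , _) , _)     = R⇒S Rxy , tt
    Light-prefix x (x′ ∷ xs) {ys} ((Rxx′ , x∉ , nr) , l) =
      (Rxx′ , (λ x∈ → x∉ (∈-++⁺ˡ {xs = x′ ∷ xs} x∈)) , NonRobust-prefix 1 x xs nr) , Light-prefix x′ xs l

    Light-suffix : ∀ xs {ys} → Light (xs ++ ys) → Light ys
    Light-suffix []       l       = l
    Light-suffix (x ∷ xs) (_ , l) = Light-suffix xs l

    Light⇒Walk : ∀ u p v → Light (u ∷ p ++ v ∷ []) → Walk u p v
    Light⇒Walk u []      v ((Ruv , _) , _) = Ruv
    Light⇒Walk u (x ∷ p) v ((Rux , _) , l) = Rux , Light⇒Walk x p v l

    Light⇒Unique : ∀ xs → Light xs → Unique xs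
    Light⇒Unique []           _                  = []
    Light⇒Unique (x ∷ [])     _                  = [] ∷ []
    Light⇒Unique (x ∷ y ∷ xs) ((_ , x∉ , _) , l) =
      All.tabulate (λ y∈ → λ { refl → x∉ y∈ }) ∷ Light⇒Unique (y ∷ xs) l

    NonRobust-last : ∀ c a xs {v} → NonRobust c a (xs ++ v ∷ []) → ¬ Rob (c + length xs) a v
    NonRobust-last c a []       {v} (¬r , _) r = ¬r (subst (λ k → Rob k a v) (ℕ.+-identityʳ c) r)
    NonRobust-last c a (x ∷ xs) {v} (_ , h) r = NonRobust-last (suc c) a xs h (subst (λ k → Rob k a v) (ℕ.+-suc c (length xs)) r)

    Light⇒¬Rob : ∀ u p v {c} → length p ≡ suc c → Light (u ∷ p ++ v ∷ []) → ¬ Rob (suc c) u v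
    Light⇒¬Rob u (x ∷ p) v refl ((_ , _ , nr) , _) = NonRobust-last 1 u p nr

    ends∉ : ∀ (u : V) (p : List V) (v : V) → Unique (u ∷ p ++ v ∷ []) → u ∉ p × v ∉ p × Unique p × u ≢ v
    ends∉ u p v (u# ∷ uniq) = (λ u∈p → All.lookup u# (∈-++⁺ˡ u∈p) refl) , proj₁ (tail p uniq) , proj₂ (tail p uniq) ,
        All.lookup u# (∈-++⁺ʳ p (here refl))
      where
      tail : ∀ (p : List V) → Unique (p ++ v ∷ []) → v ∉ p × Unique p
      tail []      _           = (λ ()) , []
      tail (x ∷ p) (x# ∷ uniq) =
        (λ { (here refl) → All.lookup x# (∈-++⁺ʳ p (here refl)) refl ; (there v∈p) → proj₁ (tail p uniq) v∈p }) ,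
        (All.++⁻ˡ p x# ∷ proj₂ (tail p uniq))

    -- A set blocking all paths from u to v meets every light one, whose two pieces are light again.
    blocked : ∀ {c u v} → ¬ Rob c u v →
              ∃[ W ] (length W ≡ Mth c × (∀ p → length p ≡ c → Light (u ∷ p ++ v ∷ []) → ∃[ w ] (w ∈ p × w ∈ W)))
    blocked {c} {u} {v} ¬rob = extract (anyList? (Mth c) (λ W → ¬? (pathAvoiding? c u v W)))
      where
      extract : Dec (∃[ W ] (length W ≡ Mth c × ¬ PathAvoiding c u v W)) →
                ∃[ W ] (length W ≡ Mth c × (∀ p → length p ≡ c → Light (u ∷ p ++ v ∷ []) → ∃[ w ] (w ∈ p × w ∈ W)))
      extract (no none) = contradiction (λ W len → decidable-stable (pathAvoiding? c u v W) (λ ¬path → none (W , len , ¬path))) ¬rob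
      extract (yes (W , len , ¬path)) = W , len , meets
        where
        meets : ∀ p → length p ≡ c → Light (u ∷ p ++ v ∷ []) → ∃[ w ] (w ∈ p × w ∈ W)
        meets p lenp l = decide (Any.any? (_∈? W) p)
          where
          ends = ends∉ u p v (Light⇒Unique (u ∷ p ++ v ∷ []) l)
          decide : Dec (Any (_∈ W) p) → ∃[ w ] (w ∈ p × w ∈ W)
          decide (yes any) = Mem.find any
          decide (no none) = contradiction (pathAvoiding p lenp (Light⇒Walk u p v l) (proj₁ (proj₂ (proj₂ ends)))
            (λ { x x∈p (here refl) → proj₁ ends x∈p
               ; x x∈p (there (here refl)) → proj₁ (proj₂ ends) x∈p
               ; x x∈p (there (there x∈W)) → none (Mem.lose x∈p x∈W) })) ¬path

    -- A list that covers the light paths, rather than their number, so that the lists for two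
    -- pieces can be combined by concatenation.
    LightPaths : ℕ → V → V → ℕ → Set
    LightPaths c u v b = ∃[ ps ] (length ps ≤ b × (∀ p → length p ≡ c → Light (u ∷ p ++ v ∷ []) → p ∈ ps))

    module _ (f : ℕ → ℕ) (1≤f₀ : 1 ≤ f 0)
             (f-step : ∀ c → f c + Mth (suc c) * (suc c * (f c * f c)) ≤ f (suc c)) where

      -- A robust pair is joined by no light path. Otherwise every light path passes one of the
      -- `Mth (suc c)` blocking vertices, at one of `suc c` positions, and splits there into two
      -- light pieces with at most `f c` possibilities each. Treating all `c′ ≤ c` together covers
      -- both pieces, whatever their lengths.
      few-light-paths : ∀ c {c′} → c′ ≤ c → ∀ u v → LightPaths c′ u v (f c)
      few-light-paths zero    {zero} _ u v = [] ∷ [] , 1≤f₀ , λ { [] _ _ → here refl }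
      few-light-paths (suc c) {c′} c′≤ u v with c′ ℕ.≤? c
      ... | yes c′≤c = let ps , len , all = few-light-paths c c′≤c u v in
              ps , ℕ.≤-trans len (ℕ.≤-trans (ℕ.m≤m+n (f c) _) (f-step c)) , all
      ... | no c′≰c = subst (λ k → LightPaths k u v (f (suc c))) (ℕ.≤-antisym (ℕ.≰⇒> c′≰c) c′≤) (decide (rob? (suc c) u v))
        where
        decide : Dec (Rob (suc c) u v) → LightPaths (suc c) u v (f (suc c))
        decide (yes rob) = [] , z≤n , λ p len l → contradiction rob (Light⇒¬Rob u p v len l)
        decide (no ¬rob) = List.concatMap through W ,
            ℕ.≤-trans (length-concatMap-≤ through W through-length)
              (ℕ.≤-trans (ℕ.≤-reflexive (cong (_* (suc c * (f c * f c))) lenW)) (ℕ.≤-trans (ℕ.m≤n+m _ (f c)) (f-step c))) ,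
            complete
          where
          block = blocked ¬rob
          W     = proj₁ block
          lenW  = proj₁ (proj₂ block)
          -- Truncation at `c` makes the induction hypothesis available for every `i`; at the
          -- positions that occur the minimum is `i` itself.
          family : ∀ i x y → LightPaths (i ℕ.⊓ c) x y (f c)
          family i x y = few-light-paths c (ℕ.m⊓n≤n i c) x y
          join : V → List V → List (List V) → List (List V)
          join w p qs = List.map (λ q → p ++ w ∷ q) qs
          through-at : V → ℕ → List (List V)
          through-at w i = List.concatMap (λ p → join w p (proj₁ (family (c ∸ i) w v))) (proj₁ (family i u w))
          through : V → List (List V)
          through w = List.concatMap (through-at w) (List.upTo (suc c))
          through-length : ∀ w → length (through w) ≤ suc c * (f c * f c)
          through-length w = ℕ.≤-trans
            (length-concatMap-≤ (through-at w) (List.upTo (suc c)) (λ i → ℕ.≤-trans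
              (length-concatMap-≤ _ (proj₁ (family i u w)) (λ p → ℕ.≤-trans
                (ℕ.≤-reflexive (List.length-map (λ q → p ++ w ∷ q) (proj₁ (family (c ∸ i) w v)))) (proj₁ (proj₂ (family (c ∸ i) w v)))))
              (ℕ.*-monoˡ-≤ (f c) (proj₁ (proj₂ (family i u w))))))
            (ℕ.≤-reflexive (cong (_* (f c * f c)) (List.length-upTo (suc c))))
          complete : ∀ p → length p ≡ suc c → Light (u ∷ p ++ v ∷ []) → p ∈ List.concatMap through W
          complete p len l = place (proj₂ (proj₂ block) p len l)
            where
            place : ∃[ w ] (w ∈ p × w ∈ W) → p ∈ List.concatMap through W
            place (w , w∈p , w∈W) = split (∈-∃++ w∈p)
              where
              split : ∃[ p₁ ] ∃[ p₂ ] p ≡ p₁ ++ w ∷ p₂ → p ∈ List.concatMap through W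
              split (p₁ , p₂ , refl) = ∈-concatMap through W
                  (∈-concatMap (through-at w) (List.upTo (suc c))
                    (∈-concatMap (λ p → join w p (proj₁ (family (c ∸ length p₁) w v))) (proj₁ (family (length p₁) u w))
                      (∈-map⁺ (λ q → p₁ ++ w ∷ q) p₂∈) p₁∈)
                    (∈-upTo⁺ (s≤s len₁≤c)))
                  w∈W
                where
                len₁₂ : length p₁ + length p₂ ≡ c
                len₁₂ = ℕ.suc-injective (trans (sym (ℕ.+-suc (length p₁) (length p₂))) (trans (sym (List.length-++ p₁)) len))
                len₁≤c : length p₁ ≤ c
                len₁≤c = ℕ.≤-trans (ℕ.m≤m+n _ _) (ℕ.≤-reflexive len₁₂)
                len₂≡ : length p₂ ≡ (c ∸ length p₁) ℕ.⊓ c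
                len₂≡ = sym (trans (ℕ.m≤n⇒m⊓n≡m (ℕ.m∸n≤m c (length p₁)))
                  (trans (cong (_∸ length p₁) (sym len₁₂)) (ℕ.m+n∸m≡n (length p₁) (length p₂))))
                assoc : (p₁ ++ w ∷ p₂) ++ v ∷ [] ≡ p₁ ++ w ∷ p₂ ++ v ∷ []
                assoc = List.++-assoc p₁ (w ∷ p₂) (v ∷ [])
                l′ : Light (u ∷ p₁ ++ w ∷ p₂ ++ v ∷ [])
                l′ = subst (λ xs → Light (u ∷ xs)) assoc l
                p₁∈ : p₁ ∈ proj₁ (family (length p₁) u w)
                p₁∈ = proj₂ (proj₂ (family (length p₁) u w)) p₁ (sym (ℕ.m≤n⇒m⊓n≡m len₁≤c))
                  (Light-prefix u (p₁ ++ w ∷ []) (subst (λ xs → Light (u ∷ xs)) (sym (List.++-assoc p₁ (w ∷ []) (p₂ ++ v ∷ []))) l′))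
                p₂∈ : p₂ ∈ proj₁ (family (c ∸ length p₁) w v)
                p₂∈ = proj₂ (proj₂ (family (c ∸ length p₁) w v)) p₂ len₂≡ (Light-suffix (u ∷ p₁) l′)

  -- Sums over all lists of a given length

  sumUp : ℕ → (ℕ → ℕ) → ℕ
  sumUp zero    f = 0
  sumUp (suc k) f = f 0 + sumUp k (f ∘ suc)

  sumUp-cong : ∀ k {f g : ℕ → ℕ} → (∀ i → f i ≡ g i) → sumUp k f ≡ sumUp k g
  sumUp-cong zero    h = refl
  sumUp-cong (suc k) h = cong₂ _+_ (h 0) (sumUp-cong k (h ∘ suc))

  sumUp-≤ : ∀ k {f : ℕ → ℕ} {b} → (∀ i → i < k → f i ≤ b) → sumUp k f ≤ k * b
  sumUp-≤ zero    h = z≤n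
  sumUp-≤ (suc k) h = ℕ.+-mono-≤ (h 0 (s≤s z≤n)) (sumUp-≤ k (λ i i<k → h (suc i) (s≤s i<k)))

  sumUp-*ˡ : ∀ k c (f : ℕ → ℕ) → sumUp k (λ i → c * f i) ≡ c * sumUp k f
  sumUp-*ˡ zero    c f = sym (ℕ.*-zeroʳ c)
  sumUp-*ˡ (suc k) c f = trans (cong (c * f 0 +_) (sumUp-*ˡ k c (f ∘ suc))) (sym (ℕ.*-distribˡ-+ c (f 0) _))

  ∑-sumUp : ∀ {n} k (f : Fin n → ℕ → ℕ) → ∑ (λ x → sumUp k (f x)) ≡ sumUp k (λ i → ∑ (λ x → f x i))
  ∑-sumUp {n} zero f = ∑-0 n
  ∑-sumUp (suc k)  f = trans (∑-+ (λ x → f x 0) _) (cong (∑ (λ x → f x 0) +_) (∑-sumUp k (λ x → f x ∘ suc)))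

  module _ {n : ℕ} where

    private V = Fin n

    ∑ᴸ : ℕ → (List V → ℕ) → ℕ
    ∑ᴸ zero    f = f []
    ∑ᴸ (suc k) f = ∑ (λ x → ∑ᴸ k (λ p → f (x ∷ p)))

    ∑ᴸ-mono : ∀ k {f g : List V → ℕ} → (∀ p → length p ≡ k → f p ≤ g p) → ∑ᴸ k f ≤ ∑ᴸ k g
    ∑ᴸ-mono zero    h = h [] refl
    ∑ᴸ-mono (suc k) h = ∑-mono (λ x → ∑ᴸ-mono k (λ p len → h (x ∷ p) (cong suc len)))

    ∑ᴸ-cong : ∀ k {f g : List V → ℕ} → (∀ p → length p ≡ k → f p ≡ g p) → ∑ᴸ k f ≡ ∑ᴸ k g
    ∑ᴸ-cong zero    h = h [] refl
    ∑ᴸ-cong (suc k) h = ∑-cong (λ x → ∑ᴸ-cong k (λ p len → h (x ∷ p) (cong suc len)))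

    ∑ᴸ-+ : ∀ k (f g : List V → ℕ) → ∑ᴸ k (λ p → f p + g p) ≡ ∑ᴸ k f + ∑ᴸ k g
    ∑ᴸ-+ zero    f g = refl
    ∑ᴸ-+ (suc k) f g = trans (∑-cong (λ x → ∑ᴸ-+ k (λ p → f (x ∷ p)) (λ p → g (x ∷ p)))) (∑-+ (λ x → ∑ᴸ k (λ p → f (x ∷ p))) _)

    ∑ᴸ-*ˡ : ∀ k c (f : List V → ℕ) → ∑ᴸ k (λ p → c * f p) ≡ c * ∑ᴸ k f
    ∑ᴸ-*ˡ zero    c f = refl
    ∑ᴸ-*ˡ (suc k) c f = trans (∑-cong (λ x → ∑ᴸ-*ˡ k c (λ p → f (x ∷ p)))) (∑-*ˡ c (λ x → ∑ᴸ k (λ p → f (x ∷ p))))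

    ∑ᴸ-∑ : ∀ {m} k (f : List V → Fin m → ℕ) → ∑ᴸ k (λ p → ∑ (f p)) ≡ ∑ (λ y → ∑ᴸ k (λ p → f p y))
    ∑ᴸ-∑ zero    f = refl
    ∑ᴸ-∑ (suc k) f = trans (∑-cong (λ x → ∑ᴸ-∑ k (λ p → f (x ∷ p)))) (∑-swap (λ x y → ∑ᴸ k (λ p → f (x ∷ p) y)))

    ∑ᴸ-sumUp : ∀ k m (f : List V → ℕ → ℕ) → ∑ᴸ k (λ p → sumUp m (f p)) ≡ sumUp m (λ i → ∑ᴸ k (λ p → f p i))
    ∑ᴸ-sumUp zero    m f = refl
    ∑ᴸ-sumUp (suc k) m f = trans (∑-cong (λ x → ∑ᴸ-sumUp k m (λ p → f (x ∷ p)))) (∑-sumUp m (λ x i → ∑ᴸ k (λ p → f (x ∷ p) i)))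

    ∑ᴸ-++ : ∀ j k (f : List V → ℕ) → ∑ᴸ (j + k) f ≡ ∑ᴸ j (λ p → ∑ᴸ k (λ q → f (p ++ q)))
    ∑ᴸ-++ zero    k f = refl
    ∑ᴸ-++ (suc j) k f = ∑-cong (λ x → ∑ᴸ-++ j k (λ p → f (x ∷ p)))

    ∑ᴸ-snoc : ∀ k (f : List V → ℕ) → ∑ᴸ (suc k) f ≡ ∑ᴸ k (λ p → ∑ (λ z → f (p ++ z ∷ [])))
    ∑ᴸ-snoc zero    f = refl
    ∑ᴸ-snoc (suc k) f = ∑-cong (λ x → ∑ᴸ-snoc k (λ p → f (x ∷ p)))

    ∑ᴸ-0 : ∀ k → ∑ᴸ k (λ _ → 0) ≡ 0
    ∑ᴸ-0 zero    = refl
    ∑ᴸ-0 (suc k) = trans (∑-cong {n} (λ x → ∑ᴸ-0 k)) (∑-0 n)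

    ∑ᴸ-∈ : ∀ k (ps : List (List V)) (P? : ∀ p → Dec (p ∈ ps)) → ∑ᴸ k (λ p → ind (P? p)) ≤ length ps
    ∑ᴸ-∈ k []       P? = ℕ.≤-trans (∑ᴸ-mono k {g = λ _ → 0} (λ p _ → ℕ.≤-reflexive (ind-no (P? p) λ ()))) (ℕ.≤-reflexive (∑ᴸ-0 k))
    ∑ᴸ-∈ k (q ∷ ps) P? = begin
      ∑ᴸ k (λ p → ind (P? p))   ≤⟨ ∑ᴸ-mono k (λ p _ → ind-split (P? p) (p ≟ᴸ q) (in-tail? p) (λ { (here eq) → inj₁ eq ; (there p∈) → inj₂ p∈ })) ⟩
      ∑ᴸ k (λ p → ind (p ≟ᴸ q) + ind (in-tail? p))   ≡⟨ ∑ᴸ-+ k (λ p → ind (p ≟ᴸ q)) _ ⟩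
      ∑ᴸ k (λ p → ind (p ≟ᴸ q)) + ∑ᴸ k (λ p → ind (in-tail? p))   ≤⟨ ℕ.+-mono-≤ (one k q) (∑ᴸ-∈ k ps in-tail?) ⟩
      suc (length ps)                                                ∎
      where
      _≟ᴸ_ : (p q : List V) → Dec (p ≡ q)
      _≟ᴸ_ = List.≡-dec Fin._≟_
      in-tail? : ∀ p → Dec (p ∈ ps)
      in-tail? p = Any.any? (p ≟ᴸ_) ps
      one : ∀ k q → ∑ᴸ k (λ p → ind (p ≟ᴸ q)) ≤ 1
      one zero    q = ind-≤1 ([] ≟ᴸ q)
      one (suc k) [] = ℕ.≤-trans
        (∑ᴸ-mono (suc k) {f = λ p → ind (p ≟ᴸ [])} {g = λ _ → 0} (λ { (x ∷ p) _ → ℕ.≤-reflexive (ind-no ((x ∷ p) ≟ᴸ []) λ ()) }))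
        (ℕ.≤-trans (ℕ.≤-reflexive (∑ᴸ-0 (suc k))) z≤n)
      one (suc k) (y ∷ q) = begin
        ∑ (λ x → ∑ᴸ k (λ p → ind ((x ∷ p) ≟ᴸ (y ∷ q))))   ≤⟨ ∑-mono (λ x → ∑ᴸ-mono k (λ p _ → both x p)) ⟩
        ∑ (λ x → ∑ᴸ k (λ p → ind (x Fin.≟ y) * ind (p ≟ᴸ q)))   ≡⟨ ∑-cong (λ x → ∑ᴸ-*ˡ k (ind (x Fin.≟ y)) (λ p → ind (p ≟ᴸ q))) ⟩
        ∑ (λ x → ind (x Fin.≟ y) * ∑ᴸ k (λ p → ind (p ≟ᴸ q)))   ≡⟨ ∑-ind≟ y (λ _ → ∑ᴸ k (λ p → ind (p ≟ᴸ q))) ⟩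
        ∑ᴸ k (λ p → ind (p ≟ᴸ q))   ≤⟨ one k q ⟩
        1                                                        ∎
        where
        both : ∀ x p → ind ((x ∷ p) ≟ᴸ (y ∷ q)) ≤ ind (x Fin.≟ y) * ind (p ≟ᴸ q)
        both x p = ℕ.≤-trans (ind-mono ((x ∷ p) ≟ᴸ (y ∷ q)) ((x Fin.≟ y) ×-dec (p ≟ᴸ q)) (λ { refl → refl , refl }))
          (ℕ.≤-reflexive (ind-× (x Fin.≟ y) (p ≟ᴸ q)))

    -- The value 0 past the end makes missing positions contribute nothing to a sum.
    at : ℕ → (V → ℕ) → List V → ℕ
    at i       g []       = 0
    at zero    g (y ∷ ys) = g y
    at (suc i) g (y ∷ ys) = at i g ys

    at-middle : ∀ {i} p {z q} (g : V → ℕ) → length p ≡ i → at i g ((p ++ z ∷ []) ++ q) ≡ g z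
    at-middle []      g refl = refl
    at-middle (x ∷ p) g refl = at-middle p g refl

  -- Counting light paths

  module Growth {n : ℕ} (R : Fin n → Fin n → Set) (R? : ∀ x y → Dec (R x y))
                (R-sym : ∀ {x y} → R x y → R y x)
                (S : Fin n → Bool) (R⇒S : ∀ {x y} → R x y → T (S x)) (Mth : ℕ → ℕ) where

    open Walks R R? R-sym
    open Light R R? R-sym S R⇒S Mth

    private V = Fin n

    -- Indexed by the number `i` of edges, hence the lists of `suc i` vertices.
    lightPaths : ℕ → ℕ
    lightPaths i = ∑ᴸ (suc i) (λ xs → ind (light? xs))

    Chain : V → List V → Set
    Chain z []       = ⊤
    Chain z (y ∷ ys) = R z y × Chain y ys

    chain? : ∀ z ys → Dec (Chain z ys)
    chain? z []       = yes tt
    chain? z (y ∷ ys) = R? z y ×-dec chain? y ys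

    Light⇒Chain : ∀ p z {q} → Light ((p ++ z ∷ []) ++ q) → Chain z q
    Light⇒Chain (x ∷ p) z (_ , l) = Light⇒Chain p z l
    Light⇒Chain [] z {[]}    _                  = tt
    Light⇒Chain [] z {y ∷ q} ((Rzy , _) , l) = Rzy , Light⇒Chain [] y l

    -- The neighbours `a` of `x` that, put in front, would form a robust pair with the vertex at
    -- position `i` of `ys`. Between the two lie `x` and `i` vertices of `ys`, hence `1 + i`.
    robustExtensions : ℕ → List V → ℕ
    robustExtensions i []       = 0
    robustExtensions i (x ∷ ys) = ∑ (λ a → ind (R? x a) * at i (λ y → ind (rob? (1 + i) a y)) ys)

    nonRobust-or-robust : ∀ c a ys → 1 ≤ ind (nonRobust? c a ys) + sumUp (length ys) (λ i → at i (λ y → ind (rob? (c + i) a y)) ys)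
    nonRobust-or-robust c a []       = s≤s z≤n
    nonRobust-or-robust c a (y ∷ ys) = combine (rob? c a y) (nonRobust? (suc c) a ys)
        (subst (λ k → 1 ≤ ind (nonRobust? (suc c) a ys) + k)
          (sumUp-cong (length ys) (λ i → cong (λ k → at i (λ y → ind (rob? k a y)) ys) (sym (ℕ.+-suc c i))))
          (nonRobust-or-robust (suc c) a ys))
      where
      rest : ℕ
      rest = sumUp (length ys) (λ i → at i (λ y → ind (rob? (c + suc i) a y)) ys)
      here-≥ : Rob c a y → 1 ≤ ind (rob? (c + 0) a y)
      here-≥ r = ind-yes (rob? (c + 0) a y) (subst (λ k → Rob k a y) (sym (ℕ.+-identityʳ c)) r)
      combine : (r : Dec (Rob c a y)) (nr : Dec (NonRobust (suc c) a ys)) → 1 ≤ ind nr + rest →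
                1 ≤ ind (¬? r ×-dec nr) + (ind (rob? (c + 0) a y) + rest)
      combine (yes r) nr       h = ℕ.≤-trans (here-≥ r) (ℕ.≤-trans (ℕ.m≤m+n _ rest) (ℕ.m≤n+m _ (ind (¬? (yes r) ×-dec nr))))
      combine (no ¬r) (yes nr) h = s≤s z≤n
      combine (no ¬r) (no ¬nr) h = ℕ.≤-trans h (ℕ.m≤n+m rest _)

    module _ (d : ℕ) (deg≥ : ∀ x → T (S x) → d ≤ cnt (R? x)) where

      -- A neighbour of `x` fails to prolong the path only by lying on it or by being robustly
      -- joined to a vertex of `ys`; the latter is a union bound over positions.
      extensions : ∀ x ys → T (S x) →
                   d ≤ ∑ (λ a → ind (extends? a (x ∷ ys))) + suc (length ys) + sumUp (length ys) (λ i → robustExtensions i (x ∷ ys))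
      extensions x ys x∈S = begin
        d   ≤⟨ deg≥ x x∈S ⟩
        cnt (R? x)   ≤⟨ ∑-mono pointwise ⟩
        ∑ (λ a → ext a + mem a + bad a)   ≡⟨ ∑-+ (λ a → ext a + mem a) bad ⟩
        ∑ (λ a → ext a + mem a) + ∑ bad   ≡⟨ cong₂ _+_ (∑-+ ext mem) bad-swap ⟩
        ∑ ext + ∑ mem + sumUp (length ys) (λ i → robustExtensions i (x ∷ ys))
                        ≤⟨ ℕ.+-monoˡ-≤ _ (ℕ.+-monoʳ-≤ (∑ ext) (cnt-∈ (x ∷ ys))) ⟩
        ∑ ext + suc (length ys) + sumUp (length ys) (λ i → robustExtensions i (x ∷ ys)) ∎
        where
        ext mem bad : V → ℕ
        ext a = ind (extends? a (x ∷ ys))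
        mem a = ind (a ∈? (x ∷ ys))
        at-rob : ℕ → V → ℕ
        at-rob i a = at i (λ y → ind (rob? (1 + i) a y)) ys
        bad a = ind (R? x a) * sumUp (length ys) (λ i → at-rob i a)
        bad-swap : ∑ bad ≡ sumUp (length ys) (λ i → robustExtensions i (x ∷ ys))
        bad-swap = trans (∑-cong (λ a → sym (sumUp-*ˡ (length ys) (ind (R? x a)) (λ i → at-rob i a))))
                         (∑-sumUp (length ys) (λ a i → ind (R? x a) * at-rob i a))
        pointwise : ∀ a → ind (R? x a) ≤ ext a + mem a + bad a
        pointwise a = decide (R? x a) (a ∈? (x ∷ ys)) (nonRobust? 1 a ys) (nonRobust-or-robust 1 a ys)
          where
          sums : ℕ
          sums = sumUp (length ys) (λ i → at-rob i a)
          decide : (r : Dec (R x a)) (m : Dec (a ∈ x ∷ ys)) (nr : Dec (NonRobust 1 a ys)) → 1 ≤ ind nr + sums →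
                   ind r ≤ ext a + ind m + ind r * sums
          decide (no _)  m       nr       h = z≤n
          decide (yes r) (yes _) nr       h = ℕ.≤-trans (ℕ.m≤n+m 1 (ext a)) (ℕ.m≤m+n _ _)
          decide (yes r) (no a∉) (yes nr) h = ℕ.≤-trans (ind-yes (extends? a (x ∷ ys)) (R-sym r , a∉ , nr))
            (ℕ.≤-trans (ℕ.m≤m+n (ext a) 0) (ℕ.m≤m+n _ _))
          decide (yes r) (no a∉) (no ¬nr) h = ℕ.≤-trans h (ℕ.≤-trans (ℕ.m≤m+n sums 0) (ℕ.m≤n+m _ (ext a + 0)))

      Light⇒S : ∀ x ys → Light (x ∷ ys) → T (S x)
      Light⇒S x []       (x∈S , _)       = x∈S
      Light⇒S x (y ∷ ys) ((Rxy , _) , _) = R⇒S Rxy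

      badPaths : ℕ → ℕ → ℕ
      badPaths i q = ∑ᴸ (suc i) (λ xs → ind (light? xs) * robustExtensions q xs)

      growth : ∀ i → d * lightPaths i ≤ lightPaths (suc i) + suc i * lightPaths i + sumUp i (badPaths i)
      growth i = begin
        d * lightPaths i   ≡⟨ ∑ᴸ-*ˡ (suc i) d (λ xs → ind (light? xs)) ⟨
        ∑ᴸ (suc i) (λ xs → d * ind (light? xs))   ≤⟨ ∑ᴸ-mono (suc i) pointwise ⟩
        ∑ᴸ (suc i) (λ xs → new xs + suc i * ind (light? xs) + bad xs)
                        ≡⟨ ∑ᴸ-+ (suc i) (λ xs → new xs + suc i * ind (light? xs)) bad ⟩
        ∑ᴸ (suc i) (λ xs → new xs + suc i * ind (light? xs)) + ∑ᴸ (suc i) bad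
                        ≡⟨ cong₂ _+_ (∑ᴸ-+ (suc i) new (λ xs → suc i * ind (light? xs))) (∑ᴸ-sumUp (suc i) i (λ xs q → ind (light? xs) * robustExtensions q xs)) ⟩
        ∑ᴸ (suc i) new + ∑ᴸ (suc i) (λ xs → suc i * ind (light? xs)) + sumUp i (badPaths i)
                        ≡⟨ cong (_+ sumUp i (badPaths i)) (cong₂ _+_ new-total (∑ᴸ-*ˡ (suc i) (suc i) (λ xs → ind (light? xs)))) ⟩
        lightPaths (suc i) + suc i * lightPaths i + sumUp i (badPaths i) ∎
        where
        new bad : List V → ℕ
        new xs = ∑ (λ a → ind (light? (a ∷ xs)))
        bad xs = sumUp i (λ q → ind (light? xs) * robustExtensions q xs)
        new-total : ∑ᴸ (suc i) new ≡ lightPaths (suc i)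
        new-total = ∑ᴸ-∑ (suc i) (λ xs a → ind (light? (a ∷ xs)))
        pointwise : ∀ xs → length xs ≡ suc i → d * ind (light? xs) ≤ new xs + suc i * ind (light? xs) + bad xs
        pointwise (x ∷ ys) refl = begin
          d * ind (light? (x ∷ ys))   ≡⟨ ℕ.*-comm d (ind (light? (x ∷ ys))) ⟩
          lt * d   ≤⟨ weighted (light? (x ∷ ys)) ⟩
          lt * (∑ ext + suc (length ys) + sums)   ≡⟨ distribute lt (∑ ext) (suc (length ys)) sums ⟩
          lt * ∑ ext + suc (length ys) * lt + lt * sums  ≡⟨ cong₂ (λ a b → a + suc (length ys) * lt + b)
                        (trans (sym (∑-*ˡ lt ext)) (∑-cong (λ a → trans (ℕ.*-comm lt (ext a)) (sym (ind-× (extends? a (x ∷ ys)) (light? (x ∷ ys)))))))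
                        (sym (sumUp-*ˡ (length ys) lt (λ q → robustExtensions q (x ∷ ys)))) ⟩
          new (x ∷ ys) + suc (length ys) * lt + bad (x ∷ ys) ∎
          where
          lt sums : ℕ
          lt = ind (light? (x ∷ ys))
          sums = sumUp (length ys) (λ q → robustExtensions q (x ∷ ys))
          ext : V → ℕ
          ext a = ind (extends? a (x ∷ ys))
          weighted : (l : Dec (Light (x ∷ ys))) → ind l * d ≤ ind l * (∑ ext + suc (length ys) + sums)
          weighted (no _)  = z≤n
          weighted (yes l) = ℕ.+-monoˡ-≤ 0 (extensions x ys (Light⇒S x ys l))
          distribute : ∀ l a b c → l * (a + b + c) ≡ l * a + b * l + l * c
          distribute = solve-∀

    chains≤ : ∀ {Δ} → (∀ x → cnt (R? x) ≤ Δ) → ∀ m z → ∑ᴸ m (λ r → ind (chain? z r)) ≤ Δ ^ m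
    chains≤     deg≤ zero    z = ℕ.≤-refl
    chains≤ {Δ} deg≤ (suc m) z = begin
      ∑ (λ y → ∑ᴸ m (λ r → ind (R? z y ×-dec chain? y r)))   ≡⟨ ∑-cong (λ y → ∑ᴸ-cong m (λ r _ → ind-× (R? z y) (chain? y r))) ⟩
      ∑ (λ y → ∑ᴸ m (λ r → ind (R? z y) * ind (chain? y r)))   ≡⟨ ∑-cong (λ y → ∑ᴸ-*ˡ m (ind (R? z y)) (λ r → ind (chain? y r))) ⟩
      ∑ (λ y → ind (R? z y) * ∑ᴸ m (λ r → ind (chain? y r)))   ≤⟨ cnt-∑≤ (R? z) (λ y _ → chains≤ deg≤ m y) ⟩
      cnt (R? z) * Δ ^ m   ≤⟨ ℕ.*-monoˡ-≤ (Δ ^ m) (deg≤ z) ⟩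
      Δ * Δ ^ m                                                    ∎

    -- This is `heavy-pairs` of `Heavy` with `Mth c` for the threshold `Mᵣ`.
    heavyPairs : ℕ → V → ℕ
    heavyPairs c x = ∑ (λ z → cnt (λ a → R? x a ×-dec reach? c x z ×-dec rob? c a z))

    heavyPairs-outside : ∀ c x → ¬ T (S x) → heavyPairs c x ≡ 0
    heavyPairs-outside c x x∉S = trans (∑-cong (λ z → trans
      (∑-cong (λ a → ind-no (R? x a ×-dec reach? c x z ×-dec rob? c a z) (x∉S ∘ R⇒S ∘ proj₁))) (∑-0 n))) (∑-0 n)

    module Bounds (f : ℕ → ℕ) (1≤f₀ : 1 ≤ f 0)
                  (f-step : ∀ c → f c + Mth (suc c) * (suc c * (f c * f c)) ≤ f (suc c)) where

      light-between : ∀ q x z → ∑ᴸ q (λ p → ind (light? (x ∷ p ++ z ∷ []))) ≤ f q * ind (reach? (suc q) x z)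
      light-between q x z = decide (reach? (suc q) x z)
        where
        decide : (r : Dec (Reach (suc q) x z)) → ∑ᴸ q (λ p → ind (light? (x ∷ p ++ z ∷ []))) ≤ f q * ind r
        decide (no ¬r) = ℕ.≤-trans (∑ᴸ-mono q {g = λ _ → 0} (λ { p refl → ℕ.≤-reflexive
            (ind-no (light? (x ∷ p ++ z ∷ [])) (λ l → ¬r (Walk⇒Reach p (Light⇒Walk x p z l)))) }))
          (ℕ.≤-trans (ℕ.≤-reflexive (∑ᴸ-0 q)) z≤n)
        decide (yes _) = begin
          ∑ᴸ q (λ p → ind (light? (x ∷ p ++ z ∷ [])))   ≤⟨ ∑ᴸ-mono q (λ p len → ind-mono (light? (x ∷ p ++ z ∷ [])) (in? p) (proj₂ (proj₂ few) p len)) ⟩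
          ∑ᴸ q (λ p → ind (in? p))   ≤⟨ ∑ᴸ-∈ q (proj₁ few) in? ⟩
          length (proj₁ few)   ≤⟨ proj₁ (proj₂ few) ⟩
          f q   ≡⟨ ℕ.*-identityʳ (f q) ⟨
          f q * 1                                         ∎
          where
          few = few-light-paths f 1≤f₀ f-step q ℕ.≤-refl x z
          in? : ∀ p → Dec (p ∈ proj₁ few)
          in? p = Any.any? (List.≡-dec Fin._≟_ p) (proj₁ few)

      -- Cut the path after the vertex `z` that is robustly joined to `a`. The piece from `x` to `z`
      -- is light, which leaves at most `f q` possibilities; the `m` vertices behind `z` are bounded
      -- merely as a walk, by `Δ ^ m`; and `a` and `z` form a pair counted around `x`.
      badPaths≤ : ∀ {Δ} → (∀ x → cnt (R? x) ≤ Δ) → ∀ q m →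
                  ∑ᴸ (suc (suc q + m)) (λ xs → ind (light? xs) * robustExtensions q xs) ≤
                  Δ ^ m * f q * ∑ (heavyPairs (suc q))
      badPaths≤ {Δ} deg≤ q m = begin
        ∑ᴸ (suc (suc q + m)) bad
          ≡⟨ ∑ᴸ-++ (suc (suc q)) m bad ⟩
        ∑ (λ x → ∑ᴸ (suc q) (λ p → ∑ᴸ m (λ r → bad (x ∷ p ++ r))))
          ≡⟨ ∑-cong (λ x → ∑ᴸ-snoc q (λ p → ∑ᴸ m (λ r → bad (x ∷ p ++ r)))) ⟩
        ∑ (λ x → ∑ᴸ q (λ p → ∑ (λ z → ∑ᴸ m (λ r → bad (x ∷ (p ++ z ∷ []) ++ r)))))
          ≤⟨ ∑-mono (λ x → ∑ᴸ-mono q (λ p len → ∑-mono (λ z → tails x p z len))) ⟩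
        ∑ (λ x → ∑ᴸ q (λ p → ∑ (λ z → Δ ^ m * G x z * ind (light? (x ∷ p ++ z ∷ [])))))
          ≡⟨ ∑-cong (λ x → ∑ᴸ-∑ q (λ p z → Δ ^ m * G x z * ind (light? (x ∷ p ++ z ∷ [])))) ⟩
        ∑ (λ x → ∑ (λ z → ∑ᴸ q (λ p → Δ ^ m * G x z * ind (light? (x ∷ p ++ z ∷ [])))))
          ≡⟨ ∑-cong (λ x → ∑-cong (λ z → ∑ᴸ-*ˡ q (Δ ^ m * G x z) (λ p → ind (light? (x ∷ p ++ z ∷ []))))) ⟩
        ∑ (λ x → ∑ (λ z → Δ ^ m * G x z * ∑ᴸ q (λ p → ind (light? (x ∷ p ++ z ∷ [])))))
          ≤⟨ ∑-mono (λ x → ∑-mono (λ z → ℕ.*-monoʳ-≤ (Δ ^ m * G x z) (light-between q x z))) ⟩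
        ∑ (λ x → ∑ (λ z → Δ ^ m * G x z * (f q * ind (reach? (suc q) x z))))
          ≡⟨ ∑-cong (λ x → ∑-cong (λ z → merge x z)) ⟩
        ∑ (λ x → ∑ (λ z → Δ ^ m * f q * cnt (λ a → R? x a ×-dec reach? (suc q) x z ×-dec rob? (suc q) a z)))
          ≡⟨ ∑-cong (λ x → ∑-*ˡ (Δ ^ m * f q) (λ z → cnt (λ a → R? x a ×-dec reach? (suc q) x z ×-dec rob? (suc q) a z))) ⟩
        ∑ (λ x → Δ ^ m * f q * heavyPairs (suc q) x)
          ≡⟨ ∑-*ˡ (Δ ^ m * f q) (heavyPairs (suc q)) ⟩
        Δ ^ m * f q * ∑ (heavyPairs (suc q)) ∎
        where
        bad : List V → ℕ
        bad xs = ind (light? xs) * robustExtensions q xs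
        G : V → V → ℕ
        G x z = ∑ (λ a → ind (R? x a) * ind (rob? (suc q) a z))
        tails : ∀ x p z → length p ≡ q → ∑ᴸ m (λ r → bad (x ∷ (p ++ z ∷ []) ++ r)) ≤ Δ ^ m * G x z * ind (light? (x ∷ p ++ z ∷ []))
        tails x p z len = begin
          ∑ᴸ m (λ r → bad (x ∷ (p ++ z ∷ []) ++ r))   ≤⟨ ∑ᴸ-mono m (λ r _ → pointwise r) ⟩
          ∑ᴸ m (λ r → lt * G x z * ind (chain? z r))   ≡⟨ ∑ᴸ-*ˡ m (lt * G x z) (λ r → ind (chain? z r)) ⟩
          lt * G x z * ∑ᴸ m (λ r → ind (chain? z r))   ≤⟨ ℕ.*-monoʳ-≤ (lt * G x z) (chains≤ deg≤ m z) ⟩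
          lt * G x z * Δ ^ m   ≡⟨ rotate lt (G x z) (Δ ^ m) ⟩
          Δ ^ m * G x z * lt                            ∎
          where
          lt : ℕ
          lt = ind (light? (x ∷ p ++ z ∷ []))
          rotate : ∀ a b c → a * b * c ≡ c * b * a
          rotate = solve-∀
          reorder : ∀ a b c → a * b * c ≡ a * c * b
          reorder = solve-∀
          pointwise : ∀ r → bad (x ∷ (p ++ z ∷ []) ++ r) ≤ lt * G x z * ind (chain? z r)
          pointwise r = begin
            ind (light? (x ∷ (p ++ z ∷ []) ++ r)) * robustExtensions q (x ∷ (p ++ z ∷ []) ++ r)
              ≡⟨ cong (ind (light? (x ∷ (p ++ z ∷ []) ++ r)) *_) (∑-cong (λ a → cong (ind (R? x a) *_) (at-middle p (λ y → ind (rob? (suc q) a y)) len))) ⟩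
            ind (light? (x ∷ (p ++ z ∷ []) ++ r)) * G x z
              ≤⟨ ℕ.*-monoˡ-≤ (G x z) (ind-mono (light? (x ∷ (p ++ z ∷ []) ++ r)) (light? (x ∷ p ++ z ∷ []) ×-dec chain? z r)
                   (λ l → Light-prefix x (p ++ z ∷ []) l , Light⇒Chain (x ∷ p) z l)) ⟩
            ind (light? (x ∷ p ++ z ∷ []) ×-dec chain? z r) * G x z
              ≡⟨ cong (_* G x z) (ind-× (light? (x ∷ p ++ z ∷ [])) (chain? z r)) ⟩
            lt * ind (chain? z r) * G x z   ≡⟨ reorder lt (ind (chain? z r)) (G x z) ⟩
            lt * G x z * ind (chain? z r)   ∎
        merge : ∀ x z → Δ ^ m * G x z * (f q * ind (reach? (suc q) x z)) ≡
                        Δ ^ m * f q * cnt (λ a → R? x a ×-dec reach? (suc q) x z ×-dec rob? (suc q) a z)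
        merge x z = trans (regroup (Δ ^ m) (G x z) (f q) (ind (reach? (suc q) x z)))
          (cong (Δ ^ m * f q *_) (trans (sym (∑-*ˡ (ind (reach? (suc q) x z)) (λ a → ind (R? x a) * ind (rob? (suc q) a z))))
            (∑-cong (λ a → sym (trans (ind-× (R? x a) (reach? (suc q) x z ×-dec rob? (suc q) a z))
              (trans (cong (ind (R? x a) *_) (ind-× (reach? (suc q) x z) (rob? (suc q) a z)))
                (swap (ind (R? x a)) (ind (reach? (suc q) x z)) (ind (rob? (suc q) a z)))))))))
          where
          regroup : ∀ a b c e → a * b * (c * e) ≡ a * c * (e * b)
          regroup = solve-∀
          swap : ∀ a b c → a * (b * c) ≡ b * (a * c)
          swap = solve-∀

      module _ (K κ L d : ℕ) (deg≥ : ∀ x → T (S x) → d ≤ cnt (R? x)) (deg≤ : ∀ x → cnt (R? x) ≤ K * d)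
               (K^≤κ : ∀ m → m ≤ L → K ^ m ≤ κ) (2l≤d : 2 * suc L ≤ d)
               (heavy≤ : ∀ q x → suc q ≤ L → κ * f q * (suc L * 4 ^ suc L) * heavyPairs (suc q) x ≤ d ^ (2 + q)) where

        private
          l N : ℕ
          l = suc L
          N = size S

        ∑-heavy≤ : ∀ q → suc q ≤ L → κ * f q * (l * 4 ^ l) * ∑ (heavyPairs (suc q)) ≤ N * d ^ (2 + q)
        ∑-heavy≤ q q≤ = begin
          κ * f q * (l * 4 ^ l) * ∑ (heavyPairs (suc q))   ≡⟨ ∑-*ˡ (κ * f q * (l * 4 ^ l)) (heavyPairs (suc q)) ⟨
          ∑ (λ x → κ * f q * (l * 4 ^ l) * heavyPairs (suc q) x)   ≤⟨ ∑-mono (λ x → pointwise x (T? (S x))) ⟩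
          ∑ (λ x → ind (T? (S x)) * d ^ (2 + q))   ≡⟨ ∑-*ʳ (d ^ (2 + q)) (λ x → ind (T? (S x))) ⟩
          N * d ^ (2 + q)                                           ∎
          where
          pointwise : ∀ x (x∈? : Dec (T (S x))) → κ * f q * (l * 4 ^ l) * heavyPairs (suc q) x ≤ ind x∈? * d ^ (2 + q)
          pointwise x (yes _)  = ℕ.≤-trans (heavy≤ q x q≤) (ℕ.≤-reflexive (sym (ℕ.+-identityʳ _)))
          pointwise x (no x∉S) = ℕ.≤-reflexive (trans (cong (κ * f q * (l * 4 ^ l) *_) (heavyPairs-outside (suc q) x x∉S)) (ℕ.*-zeroʳ (κ * f q * (l * 4 ^ l))))

        -- The factor in `heavy≤` is made for this: `κ` absorbs the `K ^ m` of the tails, `f q` the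
        -- light pieces, and `l * 4 ^ l` remains, so that `many-light-paths` can afford a sum of
        -- fewer than `l` such terms.
        bad-few : ∀ i q → i ≤ L → q < i → l * 4 ^ l * badPaths d deg≥ i q ≤ N * d ^ suc i
        bad-few i q i≤L q<i = few (proj₁ difference) (proj₂ difference)
          where
          difference : ∃[ m ] suc q + m ≡ i
          difference = i ∸ suc q , ℕ.m+[n∸m]≡n q<i
          few : ∀ m → suc q + m ≡ i → l * 4 ^ l * badPaths d deg≥ i q ≤ N * d ^ suc i
          few m refl = begin
            l * 4 ^ l * badPaths d deg≥ (suc q + m) q
              ≤⟨ ℕ.*-monoʳ-≤ (l * 4 ^ l) (badPaths≤ deg≤ q m) ⟩
            l * 4 ^ l * ((K * d) ^ m * f q * ∑ (heavyPairs (suc q)))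
              ≡⟨ cong (λ k → l * 4 ^ l * (k * f q * ∑ (heavyPairs (suc q)))) (^-distrib-* K d m) ⟩
            l * 4 ^ l * (K ^ m * d ^ m * f q * ∑ (heavyPairs (suc q)))
              ≤⟨ ℕ.*-monoʳ-≤ (l * 4 ^ l) (ℕ.*-monoˡ-≤ (∑ (heavyPairs (suc q))) (ℕ.*-monoˡ-≤ (f q) (ℕ.*-monoˡ-≤ (d ^ m)
                   (K^≤κ m (ℕ.≤-trans (ℕ.m≤n+m m (suc q)) i≤L))))) ⟩
            l * 4 ^ l * (κ * d ^ m * f q * ∑ (heavyPairs (suc q)))
              ≡⟨ regroup (l * 4 ^ l) κ (d ^ m) (f q) (∑ (heavyPairs (suc q))) ⟩
            κ * f q * (l * 4 ^ l) * ∑ (heavyPairs (suc q)) * d ^ m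
              ≤⟨ ℕ.*-monoˡ-≤ (d ^ m) (∑-heavy≤ q (ℕ.≤-trans (ℕ.m≤m+n (suc q) m) i≤L)) ⟩
            N * d ^ (2 + q) * d ^ m
              ≡⟨ trans (ℕ.*-assoc N (d ^ (2 + q)) (d ^ m)) (cong (N *_) (sym (ℕ.^-distribˡ-+-* d (2 + q) m))) ⟩
            N * d ^ suc (suc q + m) ∎
            where
            regroup : ∀ a κ e f h → a * (κ * e * f * h) ≡ κ * f * a * h * e
            regroup = solve-∀

        -- In units of `N * d ^ suc i / 4 ^ suc i`, the `d * lightPaths i` attempted extensions
        -- amount to at least 4. Repeated vertices spoil at most half of them, because
        -- `2 * suc i ≤ d`, and robust pairs at most 1 unit, which leaves 1.
        many-light-paths : ∀ i → i ≤ l → N * d ^ i ≤ 4 ^ i * lightPaths i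
        many-light-paths zero    _   = ℕ.≤-reflexive (trans (ℕ.*-identityʳ N) (trans (∑-cong singletons) (sym (ℕ.+-identityʳ _))))
          where
          singletons : ∀ x → ind (T? (S x)) ≡ ind (light? (x ∷ []))
          singletons x = sym (trans (ind-× (T? (S x)) (yes tt)) (ℕ.*-identityʳ _))
        many-light-paths (suc i) i<l = ℕ.*-cancelˡ-≤ 2 (ℕ.+-cancelʳ-≤ (2 * (N * d ^ suc i)) _ _ (begin
          2 * (N * d ^ suc i) + 2 * (N * d ^ suc i)   ≡⟨ four N d (d ^ i) ⟩
          4 * (d * (N * d ^ i))   ≤⟨ ℕ.*-monoʳ-≤ 4 (ℕ.*-monoʳ-≤ d (many-light-paths i (ℕ.<⇒≤ i<l))) ⟩
          4 * (d * (4 ^ i * lightPaths i))   ≡⟨ regroup d (4 ^ i) (lightPaths i) ⟩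
          4 ^ suc i * (d * lightPaths i)   ≤⟨ ℕ.*-monoʳ-≤ (4 ^ suc i) twice ⟩
          4 ^ suc i * (2 * lightPaths (suc i) + 2 * bads)
                        ≡⟨ expand (4 ^ suc i) (lightPaths (suc i)) bads ⟩
          2 * (4 ^ suc i * lightPaths (suc i)) + 2 * (4 ^ suc i * bads)
                        ≤⟨ ℕ.+-monoʳ-≤ (2 * (4 ^ suc i * lightPaths (suc i))) (ℕ.*-monoʳ-≤ 2 bads≤) ⟩
          2 * (4 ^ suc i * lightPaths (suc i)) + 2 * (N * d ^ suc i) ∎))
          where
          bads : ℕ
          bads = sumUp i (badPaths d deg≥ i)
          four : ∀ N d e → 2 * (N * (d * e)) + 2 * (N * (d * e)) ≡ 4 * (d * (N * e))
          four = solve-∀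
          regroup : ∀ d e p → 4 * (d * (e * p)) ≡ 4 * e * (d * p)
          regroup = solve-∀
          expand : ∀ e p b → e * (2 * p + 2 * b) ≡ 2 * (e * p) + 2 * (e * b)
          expand = solve-∀
          i≤L : i ≤ L
          i≤L = s≤s⁻¹ i<l
          twice : d * lightPaths i ≤ 2 * lightPaths (suc i) + 2 * bads
          twice = ℕ.+-cancelʳ-≤ (d * lightPaths i) _ _ (begin
            d * lightPaths i + d * lightPaths i   ≤⟨ ℕ.+-mono-≤ (growth d deg≥ i) (growth d deg≥ i) ⟩
            lightPaths (suc i) + suc i * lightPaths i + bads + (lightPaths (suc i) + suc i * lightPaths i + bads)
                        ≡⟨ collect (lightPaths (suc i)) (suc i) (lightPaths i) bads ⟩
            2 * lightPaths (suc i) + 2 * bads + 2 * suc i * lightPaths i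
                        ≤⟨ ℕ.+-monoʳ-≤ (2 * lightPaths (suc i) + 2 * bads) (ℕ.*-monoˡ-≤ (lightPaths i)
                        (ℕ.≤-trans (ℕ.*-monoʳ-≤ 2 i<l) 2l≤d)) ⟩
            2 * lightPaths (suc i) + 2 * bads + d * lightPaths i  ∎)
            where
            collect : ∀ a k p b → a + k * p + b + (a + k * p + b) ≡ 2 * a + 2 * b + 2 * k * p
            collect = solve-∀
          bads≤ : 4 ^ suc i * bads ≤ N * d ^ suc i
          bads≤ = ℕ.*-cancelˡ-≤ l (begin
            l * (4 ^ suc i * bads)   ≤⟨ ℕ.*-monoʳ-≤ l (ℕ.*-monoˡ-≤ bads (ℕ.^-monoʳ-≤ 4 i<l)) ⟩
            l * (4 ^ l * bads)   ≡⟨ ℕ.*-assoc l (4 ^ l) bads ⟨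
            l * 4 ^ l * bads   ≡⟨ sumUp-*ˡ i (l * 4 ^ l) (badPaths d deg≥ i) ⟨
            sumUp i (λ q → l * 4 ^ l * badPaths d deg≥ i q)   ≤⟨ sumUp-≤ i (λ q q<i → bad-few i q i≤L q<i) ⟩
            i * (N * d ^ suc i)   ≤⟨ ℕ.*-monoˡ-≤ (N * d ^ suc i) (ℕ.<⇒≤ i<l) ⟩
            l * (N * d ^ suc i)                                   ∎)

  -- Assembling a path system from many light paths

  module Assemble {n : ℕ} (R : Fin n → Fin n → Set) (R? : ∀ x y → Dec (R x y))
                  (R-sym : ∀ {x y} → R x y → R y x)
                  (S : Fin n → Bool) (R⇒S : ∀ {x y} → R x y → T (S x)) (Mth : ℕ → ℕ)
                  (f : ℕ → ℕ) (1≤f₀ : 1 ≤ f 0)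
                  (f-step : ∀ c → f c + Mth (suc c) * (suc c * (f c * f c)) ≤ f (suc c)) where

    open Walks R R? R-sym
    open Light R R? R-sym S R⇒S Mth
    open Growth R R? R-sym S R⇒S Mth
    open Bounds f 1≤f₀ f-step

    private V = Fin n

    reach-from-start : ∀ {u v w} p → Walk u p v → w ∈ u ∷ p → ∃[ i ] (i < suc (length p) × Reach i u w)
    reach-from-start p       walk         (here refl) = 0 , s≤s z≤n , refl
    reach-from-start (x ∷ p) (Rux , walk) (there w∈)  =
      let i , i< , reach = reach-from-start p walk w∈ in suc i , s≤s i< , x , Rux , reach

    reach-to-end : ∀ {u v w} p → Walk u p v → w ∈ p ++ v ∷ [] → ∃[ i ] (i < suc (length p) × Reach i w v)
    reach-to-end []      walk         (here refl) = 0 , s≤s z≤n , refl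
    reach-to-end (x ∷ p) (_ , walk)   (here refl) = suc (length p) , ℕ.≤-refl , Walk⇒Reach p walk
    reach-to-end (x ∷ p) (_ , walk)   (there w∈)  =
      let i , i< , reach = reach-to-end p walk w∈ in i , ℕ.m<n⇒m<1+n i< , reach

    module _ (s′ t K L d κ A E : ℕ) (deg≤ : ∀ x → cnt (R? x) ≤ K * d) where

      s l N : ℕ
      s = suc s′
      l = suc L
      N = size S

      Γ : V → V → Set
      Γ a b = ∃[ p ] (length p ≡ L × Light (a ∷ p ++ b ∷ []))

      Γ? : ∀ a b → Dec (Γ a b)
      Γ? a b = anyList? L (λ p → light? (a ∷ p ++ b ∷ []))

      -- Fixes one path for each pair once and for all; `[]` is a dummy value that makes `P` total.
      choose : ∀ {a b} → Dec (Γ a b) → List V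
      choose (yes (p , _)) = p
      choose (no _)        = []

      P : V → V → List V
      P a b = choose (Γ? a b)

      module _ {a b : V} (γ : Γ a b) where
        chosen : length (P a b) ≡ L × Light (a ∷ P a b ++ b ∷ [])
        chosen = valid (Γ? a b)
          where
          valid : (γ? : Dec (Γ a b)) → length (choose γ?) ≡ L × Light (a ∷ choose γ? ++ b ∷ [])
          valid (yes (p , len , l)) = len , l
          valid (no ¬γ)             = contradiction γ ¬γ

        P-walk : Walk a (P a b) b
        P-walk = Light⇒Walk a (P a b) b (proj₂ chosen)

        P-ends : a ∉ P a b × b ∉ P a b × Unique (P a b) × a ≢ b
        P-ends = ends∉ a (P a b) b (Light⇒Unique (a ∷ P a b ++ b ∷ []) (proj₂ chosen))

        Γ-reach : Reach l a b
        Γ-reach = subst (λ k → Reach (suc k) a b) (proj₁ chosen) (Walk⇒Reach (P a b) P-walk)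

        Γ⇒S : T (S a)
        Γ⇒S = R⇒S (proj₁ (proj₂ Γ-reach))

        Γ⇒S′ : T (S b)
        Γ⇒S′ = R⇒S (proj₁ (proj₂ (Reach-sym l Γ-reach)))

      Near : V → V → Set
      Near w x = Σ[ i ∈ Fin l ] Reach (toℕ i) w x

      near? : ∀ w x → Dec (Near w x)
      near? w x = Fin.any? (λ i → reach? (toℕ i) w x)

      near : ∀ {i w x} → i < l → Reach i w x → Near w x
      near i<l reach = Fin.fromℕ< i<l , subst (λ k → Reach k _ _) (sym (Fin.toℕ-fromℕ< i<l)) reach

      module _ (0<d : 0 < d) (0<K : 0 < K) (0<A : 0 < A) (0<t : 0 < t)
               (K^l≤κ : K ^ l ≤ κ) (4^lf≤A : 4 ^ l * f L ≤ A)
               (E-bound : 2 * A * κ * (8 * A) ^ s * (t * (s * (2 + L) * (l * κ))) ≤ E)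
               (d-large : 2 * (s * (l * (l * κ))) * (2 * A) ≤ d)
               (many : N * d ^ l ≤ 4 ^ l * lightPaths l)
               (sparse : 8 * A * E * N ^ s < d ^ suc (l * s)) where

        private
          instance
            d≢0 : NonZero d
            d≢0 = >-nonZero 0<d
            K≢0 : NonZero K
            K≢0 = >-nonZero 0<K
            A≢0 : NonZero A
            A≢0 = >-nonZero 0<A
            2A≢0 : NonZero (2 * A)
            2A≢0 = ℕ.m*n≢0 2 A
            Kd≢0 : NonZero (K * d)
            Kd≢0 = ℕ.m*n≢0 K d

          cnt-near : ∀ w → cnt (near? w) ≤ l * (κ * d ^ L)
          cnt-near w = cnt-any (λ i x → reach? (toℕ i) w x) (λ i → begin
            cnt (reach? (toℕ i) w)   ≤⟨ cnt-reach deg≤ (toℕ i) w ⟩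
            (K * d) ^ toℕ i   ≤⟨ ℕ.^-monoʳ-≤ (K * d) (s≤s⁻¹ (Fin.toℕ<n i)) ⟩
            (K * d) ^ L   ≡⟨ ^-distrib-* K d L ⟩
            K ^ L * d ^ L   ≤⟨ ℕ.*-monoˡ-≤ (d ^ L) (ℕ.≤-trans (ℕ.^-monoʳ-≤ K (ℕ.n≤1+n L)) K^l≤κ) ⟩
            κ * d ^ L                 ∎)

          deg : V → ℕ
          deg b = cnt (λ a → Γ? a b)

          lightPaths≤ : lightPaths l ≤ f L * ∑ deg
          lightPaths≤ = begin
            lightPaths l   ≡⟨ ∑-cong (λ a → ∑ᴸ-snoc L (λ p → ind (light? (a ∷ p)))) ⟩
            ∑ (λ a → ∑ᴸ L (λ p → ∑ (λ b → ind (light? (a ∷ p ++ b ∷ [])))))  ≡⟨ ∑-cong (λ a → ∑ᴸ-∑ L (λ p b → ind (light? (a ∷ p ++ b ∷ [])))) ⟩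
            ∑ (λ a → ∑ (λ b → ∑ᴸ L (λ p → ind (light? (a ∷ p ++ b ∷ [])))))  ≤⟨ ∑-mono (λ a → ∑-mono (λ b → between a b (Γ? a b))) ⟩
            ∑ (λ a → ∑ (λ b → f L * ind (Γ? a b)))   ≡⟨ ∑-swap (λ a b → f L * ind (Γ? a b)) ⟩
            ∑ (λ b → ∑ (λ a → f L * ind (Γ? a b)))   ≡⟨ ∑-cong (λ b → ∑-*ˡ (f L) (λ a → ind (Γ? a b))) ⟩
            ∑ (λ b → f L * deg b)   ≡⟨ ∑-*ˡ (f L) deg ⟩
            f L * ∑ deg                                                      ∎
            where
            between : ∀ a b (γ? : Dec (Γ a b)) → ∑ᴸ L (λ p → ind (light? (a ∷ p ++ b ∷ []))) ≤ f L * ind γ?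
            between a b (yes _) = ℕ.≤-trans (light-between L a b) (ℕ.*-monoʳ-≤ (f L) (ind-≤1 (reach? (suc L) a b)))
            between a b (no ¬γ) = ℕ.≤-trans
              (∑ᴸ-mono L {g = λ _ → 0} (λ p len → ℕ.≤-reflexive (ind-no (light? (a ∷ p ++ b ∷ [])) (λ l → ¬γ (p , len , l)))))
              (ℕ.≤-trans (ℕ.≤-reflexive (∑ᴸ-0 L)) z≤n)

          deg≤κd^l : ∀ b → deg b ≤ κ * d ^ l
          deg≤κd^l b = begin
            deg b   ≤⟨ cnt-mono (λ a → Γ? a b) (reach? l b) (λ a γ → Reach-sym l (Γ-reach γ)) ⟩
            cnt (reach? l b)   ≤⟨ cnt-reach deg≤ l b ⟩
            (K * d) ^ l   ≡⟨ ^-distrib-* K d l ⟩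
            K ^ l * d ^ l   ≤⟨ ℕ.*-monoˡ-≤ (d ^ l) K^l≤κ ⟩
            κ * d ^ l           ∎

          X D₀ D : ℕ
          X  = l * (l * (κ * d ^ L))
          -- Vertices `b` of `S` with fewer than `D₀` partners account for at most
          -- `N * d ^ l / (2 * A)` pairs, half of what `many` and `lightPaths≤` guarantee. `D` holds
          -- back `s * X` for conflicts with vertices already chosen.
          D₀ = d ^ l / (2 * A)
          D  = D₀ ∸ s * X

          0<X : 0 < X
          0<X = ℕ.*-mono-≤ {1} {l} (s≤s z≤n) (ℕ.*-mono-≤ {1} {l} (s≤s z≤n) (ℕ.*-mono-≤ {1} {κ} (ℕ.≤-trans (ℕ.m^n>0 K l) K^l≤κ) (ℕ.m^n>0 d L)))

          2sX≤D₀ : 2 * (s * X) ≤ D₀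
          2sX≤D₀ = s≤s⁻¹ (ℕ.*-cancelʳ-< (2 * A) (2 * (s * X)) (suc D₀) (begin-strict
            2 * (s * X) * (2 * A)   ≡⟨ pull s l κ (d ^ L) A ⟩
            2 * (s * (l * (l * κ))) * (2 * A) * d ^ L   ≤⟨ ℕ.*-monoˡ-≤ (d ^ L) d-large ⟩
            d ^ l   <⟨ m<[1+m/n]*n (d ^ l) (2 * A) ⟩
            suc D₀ * (2 * A)                               ∎))
            where
            pull : ∀ s l κ e A → 2 * (s * (l * (l * (κ * e)))) * (2 * A) ≡ 2 * (s * (l * (l * κ))) * (2 * A) * e
            pull = solve-∀

          sX≤D : s * X ≤ D
          sX≤D = ℕ.≤-trans (ℕ.≤-reflexive (sym (trans (cong (_∸ s * X) (cong (s * X +_) (ℕ.+-identityʳ (s * X)))) (ℕ.m+n∸n≡m (s * X) (s * X)))))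
            (ℕ.∸-monoˡ-≤ (s * X) 2sX≤D₀)

          D+sX≡D₀ : D + s * X ≡ D₀
          D+sX≡D₀ = ℕ.m∸n+n≡m (ℕ.≤-trans (ℕ.m≤m+n (s * X) _) 2sX≤D₀)

          0<D : 0 < D
          0<D = ℕ.≤-trans (ℕ.*-mono-≤ {1} {s} (s≤s z≤n) 0<X) sX≤D

          d^l≤ : d ^ l ≤ 8 * A * D
          d^l≤ = begin
            d ^ l   ≤⟨ ℕ.<⇒≤ (m<[1+m/n]*n (d ^ l) (2 * A)) ⟩
            suc D₀ * (2 * A)   ≡⟨ cong (λ k → suc k * (2 * A)) (sym D+sX≡D₀) ⟩
            (1 + (D + s * X)) * (2 * A)   ≤⟨ ℕ.*-monoˡ-≤ (2 * A) (ℕ.+-mono-≤ 0<D (ℕ.+-monoʳ-≤ D sX≤D)) ⟩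
            (D + (D + D)) * (2 * A)   ≤⟨ ℕ.*-monoˡ-≤ (2 * A) (ℕ.m≤n+m (D + (D + D)) D) ⟩
            (D + (D + (D + D))) * (2 * A)   ≡⟨ shuffle D A ⟩
            8 * A * D                              ∎
            where
            shuffle : ∀ D A → (D + (D + (D + D))) * (2 * A) ≡ 8 * A * D
            shuffle = solve-∀

          B₀? : ∀ b → Dec (D₀ ≤ deg b)
          B₀? b = D₀ ℕ.≤? deg b

          B₀ : V → Bool
          B₀ = set B₀?

          ∑deg≤ : ∑ deg ≤ size B₀ * (κ * d ^ l) + N * D₀
          ∑deg≤ = begin
            ∑ deg   ≤⟨ ∑-mono (λ b → pointwise b (B₀? b) (T? (S b))) ⟩
            ∑ (λ b → ind (T? (B₀ b)) * (κ * d ^ l) + ind (T? (S b)) * D₀)   ≡⟨ ∑-+ (λ b → ind (T? (B₀ b)) * (κ * d ^ l)) _ ⟩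
            ∑ (λ b → ind (T? (B₀ b)) * (κ * d ^ l)) + ∑ (λ b → ind (T? (S b)) * D₀)
                        ≡⟨ cong₂ _+_ (∑-*ʳ (κ * d ^ l) (λ b → ind (T? (B₀ b)))) (∑-*ʳ D₀ (λ b → ind (T? (S b)))) ⟩
            size B₀ * (κ * d ^ l) + N * D₀                                   ∎
            where
            pointwise : ∀ b → Dec (D₀ ≤ deg b) → (b∈? : Dec (T (S b))) → deg b ≤ ind (T? (B₀ b)) * (κ * d ^ l) + ind b∈? * D₀
            pointwise b (yes rich) b∈? = begin
              deg b   ≤⟨ deg≤κd^l b ⟩
              κ * d ^ l   ≡⟨ ℕ.*-identityˡ (κ * d ^ l) ⟨
              1 * (κ * d ^ l)   ≤⟨ ℕ.*-monoˡ-≤ (κ * d ^ l) (ind-yes (T? (B₀ b)) (fromWitness {a? = B₀? b} rich)) ⟩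
              ind (T? (B₀ b)) * (κ * d ^ l)   ≤⟨ ℕ.m≤m+n _ _ ⟩
              ind (T? (B₀ b)) * (κ * d ^ l) + ind b∈? * D₀         ∎
            pointwise b (no poor) (yes _) = ℕ.≤-trans (ℕ.<⇒≤ (ℕ.≰⇒> poor))
              (ℕ.≤-trans (ℕ.≤-reflexive (sym (ℕ.*-identityˡ D₀))) (ℕ.m≤n+m (1 * D₀) (ind (T? (B₀ b)) * (κ * d ^ l))))
            pointwise b (no poor) (no b∉) = ℕ.≤-trans
              (ℕ.≤-reflexive (trans (∑-cong (λ a → ind-no (Γ? a b) (b∉ ∘ Γ⇒S′))) (∑-0 n))) z≤n

          -- The vertices of `B₀` carry half of the guaranteed pairs with at most `κ * d ^ l` each,
          -- so they are a constant fraction of all.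
          N≤ : N ≤ 2 * A * κ * size B₀
          N≤ = ℕ.*-cancelʳ-≤ N (2 * A * κ * size B₀) (d ^ l) {{ℕ.m^n≢0 d l}} (ℕ.+-cancelʳ-≤ (N * d ^ l) _ _ (begin
            N * d ^ l + N * d ^ l   ≡⟨ double (N * d ^ l) ⟩
            2 * (N * d ^ l)   ≤⟨ ℕ.*-monoʳ-≤ 2 (begin
              N * d ^ l   ≤⟨ many ⟩
              4 ^ l * lightPaths l   ≤⟨ ℕ.*-monoʳ-≤ (4 ^ l) lightPaths≤ ⟩
              4 ^ l * (f L * ∑ deg)   ≡⟨ ℕ.*-assoc (4 ^ l) (f L) (∑ deg) ⟨
              4 ^ l * f L * ∑ deg   ≤⟨ ℕ.*-mono-≤ 4^lf≤A ∑deg≤ ⟩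
              A * (size B₀ * (κ * d ^ l) + N * D₀)                   ∎) ⟩
            2 * (A * (size B₀ * (κ * d ^ l) + N * D₀))   ≡⟨ expand A (size B₀) κ (d ^ l) N D₀ ⟩
            2 * A * κ * size B₀ * d ^ l + N * (D₀ * (2 * A))   ≤⟨ ℕ.+-monoʳ-≤ (2 * A * κ * size B₀ * d ^ l) (ℕ.*-monoʳ-≤ N (m/n*n≤m (d ^ l) (2 * A))) ⟩
            2 * A * κ * size B₀ * d ^ l + N * d ^ l                ∎))
            where
            double : ∀ a → a + a ≡ 2 * a
            double = solve-∀
            expand : ∀ A b κ e N D → 2 * (A * (b * (κ * e) + N * D)) ≡ 2 * A * κ * b * e + N * (D * (2 * A))
            expand = solve-∀

          module Nonempty (0<N : 0 < N) where

            0<B₀ : 0 < size B₀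
            0<B₀ = ℕ.n≢0⇒n>0 (λ B₀≡0 → ℕ.<⇒≱ 0<N (ℕ.≤-trans N≤
              (ℕ.≤-trans (ℕ.≤-reflexive (trans (cong (2 * A * κ *_) B₀≡0) (ℕ.*-zeroʳ (2 * A * κ)))) z≤n)))

            D≤N : D ≤ N
            D≤N = let b , b∈ = cnt>0⇒∃ (λ b → T? (B₀ b)) 0<B₀ in begin
              D   ≤⟨ ℕ.m∸n≤m D₀ (s * X) ⟩
              D₀   ≤⟨ toWitness {a? = B₀? b} b∈ ⟩
              deg b   ≤⟨ cnt-mono (λ a → Γ? a b) (λ a → T? (S a)) (λ a → Γ⇒S) ⟩
              N                                ∎

            conf : V → V → V → Set
            conf b a a′ = Any (_∈ a′ ∷ P a′ b) (a ∷ P a b)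

            conf? : ∀ b a a′ → Dec (conf b a a′)
            conf? b a a′ = Any.any? (_∈? (a′ ∷ P a′ b)) (a ∷ P a b)

            -- The common end `b` is left out of both lists in `conf`, so a conflicting `a′` is
            -- fewer than `l` steps away from one of the `l` vertices of `a ∷ P a b`. There are only
            -- `O(d ^ (l - 1))` such `a′`, a factor `d` below the number of candidates.
            conf≤ : ∀ b a → Γ a b → cnt (λ a′ → Γ? a′ b ×-dec conf? b a a′) ≤ X
            conf≤ b a γ = begin
              cnt (λ a′ → Γ? a′ b ×-dec conf? b a a′)   ≤⟨ cnt-mono (λ a′ → Γ? a′ b ×-dec conf? b a a′) (λ a′ → Any.any? (λ w → near? w a′) (a ∷ P a b))
                        (λ a′ (γ′ , c) → Any.map (back γ′) c) ⟩
              cnt (λ a′ → Any.any? (λ w → near? w a′) (a ∷ P a b))   ≤⟨ cnt-Any near? (a ∷ P a b) cnt-near ⟩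
              suc (length (P a b)) * (l * (κ * d ^ L))   ≡⟨ cong (λ k → suc k * (l * (κ * d ^ L))) (proj₁ (chosen γ)) ⟩
              X                                                              ∎
              where
              back : ∀ {a′} → Γ a′ b → ∀ {w} → w ∈ a′ ∷ P a′ b → Near w a′
              back {a′} γ′ w∈ = let i , i< , reach = reach-from-start (P a′ b) (P-walk γ′) w∈ in
                near (ℕ.≤-trans i< (ℕ.≤-reflexive (cong suc (proj₁ (chosen γ′))))) (Reach-sym i reach)

            open CommonNeighbours {Γ = Γ} Γ? {A = λ a → T (S a)} (λ a → T? (S a)) Γ⇒S {conf = conf} conf? {D = D} {X = X}
              conf≤ 0<D B₀ 0<B₀

            common = common-neighbours s (λ b b∈ → ℕ.≤-trans (ℕ.≤-reflexive D+sX≡D₀) (toWitness {a? = B₀? b} b∈))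

            as : Fin s → V
            as = proj₁ common

            B : V → Bool
            B = proj₁ (proj₂ common)

            B⇒Γ : ∀ {b} → T (B b) → ∀ i → Γ (as i) b
            B⇒Γ {b} b∈ = proj₁ (proj₂ (proj₁ (proj₂ (proj₂ common)) b b∈))

            apart : ∀ {b} → T (B b) → ∀ {i i′} → i ≢ i′ → Disjoint (as i ∷ P (as i) b) (as i′ ∷ P (as i′) b)
            apart {b} b∈ = <⇒≢-all {P = λ i i′ → Disjoint (as i ∷ P (as i) b) (as i′ ∷ P (as i′) b)} (λ disj w w∈ w∈′ → disj w w∈′ w∈)
              (λ i j i<j w w∈ w∈′ → proj₂ (proj₂ (proj₁ (proj₂ (proj₂ common)) b b∈)) i j i<j (Mem.lose w∈′ w∈))

            X′ : ℕ
            X′ = s * (2 + L) * (l * (κ * d ^ L))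

            B-large : t * X′ < size B
            B-large = ℕ.≰⇒> (λ small → ℕ.<⇒≱ sparse (ℕ.*-cancelˡ-≤ N {{>-nonZero 0<N}} (begin
              N * (d * d ^ (l * s))   ≡⟨ swap N d (d ^ (l * s)) ⟩
              d * (N * d ^ (l * s))   ≤⟨ ℕ.*-monoʳ-≤ d (begin
                N * d ^ (l * s)   ≤⟨ ℕ.*-monoˡ-≤ (d ^ (l * s)) N≤ ⟩
                2 * A * κ * size B₀ * d ^ (l * s)   ≡⟨ cong (2 * A * κ * size B₀ *_) (sym (ℕ.^-*-assoc d l s)) ⟩
                2 * A * κ * size B₀ * (d ^ l) ^ s   ≤⟨ ℕ.*-monoʳ-≤ (2 * A * κ * size B₀) (ℕ.^-monoˡ-≤ s d^l≤) ⟩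
                2 * A * κ * size B₀ * (8 * A * D) ^ s   ≡⟨ cong (2 * A * κ * size B₀ *_) (^-distrib-* (8 * A) D s) ⟩
                2 * A * κ * size B₀ * ((8 * A) ^ s * D ^ s)   ≡⟨ pull (2 * A * κ) (size B₀) ((8 * A) ^ s) (D ^ s) ⟩
                2 * A * κ * (8 * A) ^ s * (size B₀ * D ^ s)   ≤⟨ ℕ.*-monoʳ-≤ (2 * A * κ * (8 * A) ^ s) (proj₂ (proj₂ (proj₂ common))) ⟩
                2 * A * κ * (8 * A) ^ s * (size B * N ^ s)   ≤⟨ ℕ.*-monoʳ-≤ (2 * A * κ * (8 * A) ^ s) (ℕ.*-monoˡ-≤ (N ^ s) small) ⟩
                2 * A * κ * (8 * A) ^ s * (t * X′ * N ^ s)   ≡⟨ collect (2 * A * κ * (8 * A) ^ s) t (s * (2 + L)) l κ (d ^ L) (N ^ s) ⟩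
                2 * A * κ * (8 * A) ^ s * (t * (s * (2 + L) * (l * κ))) * d ^ L * N ^ s
                        ≤⟨ ℕ.*-monoˡ-≤ (N ^ s) (ℕ.*-monoˡ-≤ (d ^ L) E-bound) ⟩
                E * d ^ L * N ^ s                                       ∎) ⟩
              d * (E * d ^ L * N ^ s)   ≡⟨ push d E (d ^ L) (N ^ s) ⟩
              -- Some `b` has at least `D` partners in `S`, so `d ^ l` is at most a constant times
              -- `N`. This trades `d ^ (l - 1)` for `N / d` and produces the exponent `l * s + 1` of
              -- `sparse`.
              E * N ^ s * d ^ l   ≤⟨ ℕ.*-monoʳ-≤ (E * N ^ s) (ℕ.≤-trans d^l≤ (ℕ.*-monoʳ-≤ (8 * A) D≤N)) ⟩
              E * N ^ s * (8 * A * N)   ≡⟨ final E (N ^ s) (8 * A) N ⟩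
              N * (8 * A * E * N ^ s)                                 ∎)))
              where
              swap : ∀ a b c → a * (b * c) ≡ b * (a * c)
              swap = solve-∀
              pull : ∀ a b e g → a * b * (e * g) ≡ a * e * (b * g)
              pull = solve-∀
              collect : ∀ e t σ l κ g h → e * (t * (σ * (l * (κ * g))) * h) ≡ e * (t * (σ * (l * κ))) * g * h
              collect = solve-∀
              push : ∀ d E g h → d * (E * g * h) ≡ E * h * (d * g)
              push = solve-∀
              final : ∀ E h a N → E * h * (a * N) ≡ N * (a * E * h)
              final = solve-∀

            vertices : V → List V
            vertices b = List.concatMap (λ i → as i ∷ P (as i) b ++ b ∷ []) (List.allFin s)

            ∈-vertices : ∀ {b w} i → w ∈ as i ∷ P (as i) b ++ b ∷ [] → w ∈ vertices b
            ∈-vertices {b} i w∈ = ∈-concatMap (λ i → as i ∷ P (as i) b ++ b ∷ []) (List.allFin s) w∈ (∈-allFin i)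

            length-vertices : ∀ {b} → T (B b) → length (vertices b) ≤ s * (2 + L)
            length-vertices {b} b∈ = ℕ.≤-trans
              (length-concatMap-≤ (λ i → as i ∷ P (as i) b ++ b ∷ []) (List.allFin s)
                (λ i → ℕ.≤-reflexive (cong suc (trans (List.length-++ (P (as i) b)) (trans (cong (_+ 1) (proj₁ (chosen (B⇒Γ b∈ i)))) (ℕ.+-comm L 1))))))
              (ℕ.≤-reflexive (cong (_* (2 + L)) (List.length-tabulate {n = s} id)))

            -- `as i` is left out, being common to the paths of all `b`. Every other vertex of such
            -- a path is fewer than `l` steps from `b`, which makes conflicts rare in `cnt-bad`.
            Meets : V → V → Set
            Meets w b = ∃[ i ] (w ∈ P (as i) b ++ b ∷ [])

            meets? : ∀ w b → Dec (Meets w b)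
            meets? w b = Fin.any? (λ i → w ∈? (P (as i) b ++ b ∷ []))

            BV : Set
            BV = Σ[ b ∈ V ] T (B b)

            confᴮ : BV → BV → Set
            confᴮ (b , _) (b′ , _) = Any (λ w → Meets w b′) (vertices b)

            bad? : ∀ (c : BV) x → Dec (T (B x) × Any (λ w → Meets w x) (vertices (proj₁ c)))
            bad? (b , _) x = T? (B x) ×-dec Any.any? (λ w → meets? w x) (vertices b)

            cnt-bad : ∀ c → cnt (bad? c) ≤ X′
            cnt-bad c@(b , b∈) = begin
              cnt (bad? c)   ≤⟨ cnt-mono (bad? c) (λ x → Any.any? (λ w → near? w x) (vertices b))
                        (λ x (x∈ , m) → Any.map (λ { {w} (i , w∈) → forward x∈ i w∈ }) m) ⟩
              cnt (λ x → Any.any? (λ w → near? w x) (vertices b))   ≤⟨ cnt-Any near? (vertices b) cnt-near ⟩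
              length (vertices b) * (l * (κ * d ^ L))   ≤⟨ ℕ.*-monoˡ-≤ (l * (κ * d ^ L)) (length-vertices b∈) ⟩
              X′                                                              ∎
              where
              forward : ∀ {x w} → T (B x) → ∀ i → w ∈ P (as i) x ++ x ∷ [] → Near w x
              forward {x} x∈ i w∈ = let j , j< , reach = reach-to-end (P (as i) x) (P-walk (B⇒Γ x∈ i)) w∈ in
                near (ℕ.≤-trans j< (ℕ.≤-reflexive (cong suc (proj₁ (chosen (B⇒Γ x∈ i)))))) reach

            step : ∀ (j : Fin t) (cs : List BV) → length cs < t → ∃[ b ] (⊤ × All (λ c → ¬ confᴮ c b) cs)
            step j cs lt = extend (Fin.any? (λ x → T? (B x) ×-dec ¬? (Any.any? (λ c → bad? c x) cs)))
              where
              extend : Dec (∃[ x ] (T (B x) × ¬ Any (λ c → T (B x) × Any (λ w → Meets w x) (vertices (proj₁ c))) cs)) →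
                       ∃[ b ] (⊤ × All (λ c → ¬ confᴮ c b) cs)
              extend (yes (x , x∈ , good)) = (x , x∈) , tt , All.tabulate (λ c∈ conflict → good (Mem.lose c∈ (x∈ , conflict)))
              extend (no none) = contradiction (begin
                size B   ≤⟨ cnt-mono (λ x → T? (B x)) (λ x → Any.any? (λ c → bad? c x) cs)
                        (λ x x∈ → stable x x∈ (Any.any? (λ c → bad? c x) cs)) ⟩
                cnt (λ x → Any.any? (λ c → bad? c x) cs)   ≤⟨ cnt-Any bad? cs cnt-bad ⟩
                length cs * X′   ≤⟨ ℕ.*-monoˡ-≤ X′ (ℕ.<⇒≤ lt) ⟩
                t * X′                                                ∎) (ℕ.<⇒≱ B-large)
                where
                stable : ∀ x → T (B x) → Dec (Any (λ c → T (B x) × Any (λ w → Meets w x) (vertices (proj₁ c))) cs) →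
                         Any (λ c → T (B x) × Any (λ w → Meets w x) (vertices (proj₁ c))) cs
                stable x x∈ (yes bad) = bad
                stable x x∈ (no good) = contradiction (x , x∈ , good) none

            selected : Σ[ g ∈ (Fin t → BV) ] ((∀ j → ⊤) × (∀ j → All (λ c → ¬ confᴮ c (g j)) []) ×
                        (∀ j j′ → j Fin.< j′ → ¬ confᴮ (g j) (g j′)))
            selected = greedy {BV} t {confᴮ} t (λ _ _ → ⊤) step [] ℕ.≤-refl

            pick : Fin t → BV
            pick = proj₁ selected

            bs : Fin t → V
            bs j = proj₁ (pick j)

            bs∈ : ∀ j → T (B (bs j))
            bs∈ j = proj₂ (pick j)

            γ : ∀ i j → Γ (as i) (bs j)
            γ i j = B⇒Γ (bs∈ j) i

            separate : ∀ {j j′} → j Fin.< j′ → ∀ i i′ → Disjoint (as i ∷ P (as i) (bs j) ++ bs j ∷ []) (P (as i′) (bs j′) ++ bs j′ ∷ [])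
            separate {j} {j′} j<j′ i i′ w w∈ w∈′ =
              proj₂ (proj₂ (proj₂ selected)) j j′ j<j′ (Mem.lose (∈-vertices i w∈) (i′ , w∈′))

            last∈ : ∀ (p : List V) {z} → z ∈ p ++ z ∷ []
            last∈ p = ∈-++⁺ʳ p (here refl)

            ∉-own : ∀ i j k → bs k ∉ P (as i) (bs j)
            ∉-own i j k bk∈ = compare (Fin.<-cmp k j)
              where
              compare : Tri (k Fin.< j) (k ≡ j) (j Fin.< k) → ⊥
              compare (tri≈ _ k≡j _) = proj₁ (proj₂ (P-ends (γ i j))) (subst (λ k → bs k ∈ P (as i) (bs j)) k≡j bk∈)
              compare (tri< k<j _ _) = separate k<j i i (bs k) (there (last∈ (P (as i) (bs k)))) (∈-++⁺ˡ bk∈)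
              compare (tri> _ _ j<k) = separate j<k i i (bs k) (there (∈-++⁺ˡ bk∈)) (last∈ (P (as i) (bs k)))

            system : PathSystem s t L
            system = record
              { a = as ; b = bs ; P = λ i j → P (as i) (bs j)
              -- The `a` are distinct because their paths to a common `b` are disjoint, starting
              -- points included; `0 < t` provides such a `b`.
              ; a-inj = λ i≢j ai≡aj → apart (bs∈ j₀) i≢j _ (here refl) (here ai≡aj)
              ; b-inj = <⇒≢-all {P = λ i j → bs i ≢ bs j} (λ i≢j j≡i → i≢j (sym j≡i)) (λ j j′ j<j′ eq → separate j<j′ zero zero (bs j)
                          (there (last∈ (P (as zero) (bs j))))
                          (∈-++⁺ʳ (P (as zero) (bs j′)) (here eq)))
              ; a≢b    = λ i j → proj₂ (proj₂ (proj₂ (P-ends (γ i j))))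
              ; len    = λ i j → proj₁ (chosen (γ i j))
              ; walk   = λ i j → P-walk (γ i j)
              ; unique = λ i j → proj₁ (proj₂ (proj₂ (P-ends (γ i j))))
              ; a∉P    = a∉
              ; b∉P    = ∉-own
              ; disj   = λ {i} {j} {i′} {j′} → disjoint i j i′ j′
              }
              where
              j₀ : Fin t
              j₀ = Fin.fromℕ< 0<t
              a∉ : ∀ i j k → as k ∉ P (as i) (bs j)
              a∉ i j k ak∈ = compare (k Fin.≟ i)
                where
                compare : Dec (k ≡ i) → ⊥
                compare (yes k≡i) = proj₁ (P-ends (γ i j)) (subst (λ k → as k ∈ P (as i) (bs j)) k≡i ak∈)
                compare (no k≢i)  = apart (bs∈ j) k≢i (as k) (here refl) (there ak∈)
              disjoint : ∀ i j i′ j′ → (i , j) ≢ (i′ , j′) → Disjoint (P (as i) (bs j)) (P (as i′) (bs j′))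
              disjoint i j i′ j′ ne w w∈ w∈′ = compare (Fin.<-cmp j j′)
                where
                compare : Tri (j Fin.< j′) (j ≡ j′) (j′ Fin.< j) → ⊥
                compare (tri≈ _ j≡j′ _) = apart (bs∈ j) (λ i≡i′ → ne (cong₂ _,_ i≡i′ j≡j′)) w (there w∈)
                  (there (subst (λ k → w ∈ P (as i′) (bs k)) (sym j≡j′) w∈′))
                compare (tri< j<j′ _ _) = separate j<j′ i i′ w (there (∈-++⁺ˡ w∈)) (∈-++⁺ˡ w∈′)
                compare (tri> _ _ j′<j) = separate j′<j i′ i w (there (∈-++⁺ˡ w∈′)) (∈-++⁺ˡ w∈)

        light⇒system : 0 < N → PathSystem s t L
        light⇒system = Nonempty.system

  -- Path systems contain subdivisions

  open import Defs

  module _ {n : ℕ} (R : Fin n → Fin n → Set) (R? : ∀ x y → Dec (R x y)) (R-sym : ∀ {x y} → R x y → R y x) where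

    open Walks R R? R-sym

    private V = Fin n

    nth : ∀ {s} (q : List V) → length q ≡ s → Fin s → V
    nth q refl = List.lookup q

    nth∈ : ∀ {s} (q : List V) (len : length q ≡ s) i → nth q len i ∈ q
    nth∈ q refl i = ∈-lookup i

    nth-injective : ∀ {s} (q : List V) (len : length q ≡ s) → Unique q → ∀ i j → nth q len i ≡ nth q len j → i ≡ j
    nth-injective q refl u = lookup-injective u

    -- Built like `pathVertex`, so that the image of a subdivided edge can be compared with it case
    -- by case.
    walkVertex : ∀ {s} → V → (q : List V) → length q ≡ s → V → Fin (suc (s + 1)) → V
    walkVertex u q len v zero    = u
    walkVertex {s} u q len v (suc i) = [ nth q len , (λ _ → v) ]′ (Fin.splitAt s i)

    walkVertex-tail : ∀ u x q v i → walkVertex u (x ∷ q) refl v (suc i) ≡ walkVertex x q refl v i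
    walkVertex-tail u x q v zero    = refl
    walkVertex-tail u x q v (suc i) = through (Fin.splitAt (length q) i)
      where
      through : ∀ (c : Fin (length q) ⊎ Fin 1) → [ List.lookup (x ∷ q) , (λ _ → v) ]′ (Sum.map suc id c) ≡ [ List.lookup q , (λ _ → v) ]′ c
      through (inj₁ _) = refl
      through (inj₂ _) = refl

    walkVertex-step : ∀ {s} u q (len : length q ≡ s) v → Walk u q v → ∀ i →
                      R (walkVertex u q len v (Fin.inject₁ i)) (walkVertex u q len v (suc i))
    walkVertex-step u []      refl v Ruv           zero    = Ruv
    walkVertex-step u (x ∷ q) refl v (Rux , walk)  zero    = Rux
    walkVertex-step u (x ∷ q) refl v (Rux , walk)  (suc i) =
      subst₂ R (sym (walkVertex-tail u x q v (Fin.inject₁ i))) (sym (walkVertex-tail u x q v (suc i)))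
        (walkVertex-step x q refl v walk i)

    module _ {h : ℕ} (H : Graph h) where

      subdivision-copy : (G : Graph n) → (∀ {x y} → R x y → Adj G x y) → ∀ s (a : Fin h → V) (Q : Fin (∣E∣ H) → List V) →
        (∀ {u v} → a u ≡ a v → u ≡ v) → (len : ∀ e → length (Q e) ≡ s) →
        (∀ e → Walk (a (proj₁ (ends H s e))) (Q e) (a (proj₂ (ends H s e)))) →
        (∀ e → Unique (Q e)) → (∀ u e → a u ∉ Q e) → (∀ {e e′} → e ≢ e′ → Disjoint (Q e) (Q e′)) →
        Contains (subdivision H s) G
      subdivision-copy G R⇒Adj s a Q a-inj len walk unique a∉ disj = f , f-injective , f-adj
        where
        I : Fin (∣E∣ H) → Fin s → V
        I e = nth (Q e) (len e)

        internalImage : Fin (∣E∣ H * s) → V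
        internalImage i = I (proj₁ (Fin.remQuot s i)) (proj₂ (Fin.remQuot {∣E∣ H} s i))

        g : Fin h ⊎ Fin (∣E∣ H * s) → V
        g = [ a , internalImage ]′

        f : Fin (h + ∣E∣ H * s) → V
        f x = g (Fin.splitAt h x)

        I-injective : ∀ e q e′ q′ → I e q ≡ I e′ q′ → e ≡ e′ × q ≡ q′
        I-injective e q e′ q′ eq = compare (e Fin.≟ e′)
          where
          compare : Dec (e ≡ e′) → e ≡ e′ × q ≡ q′
          compare (yes refl) = refl , nth-injective (Q e) (len e) (unique e) q q′ eq
          compare (no e≢e′)  = contradiction (nth∈ (Q e′) (len e′) q′) (λ ∈Q′ →
            disj e≢e′ _ (nth∈ (Q e) (len e) q) (subst (_∈ Q e′) (sym eq) ∈Q′))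

        g-injective : ∀ c c′ → g c ≡ g c′ → c ≡ c′
        g-injective (inj₁ u) (inj₁ v) eq = cong inj₁ (a-inj eq)
        g-injective (inj₁ u) (inj₂ j) eq = contradiction (subst (_∈ Q _) (sym eq) (nth∈ (Q _) (len _) _)) (a∉ u _)
        g-injective (inj₂ i) (inj₁ v) eq = contradiction (subst (_∈ Q _) eq (nth∈ (Q _) (len _) _)) (a∉ v _)
        g-injective (inj₂ i) (inj₂ j) eq = cong inj₂ (trans (sym (Fin.combine-remQuot {∣E∣ H} s i))
          (trans (cong₂ Fin.combine (proj₁ same) (proj₂ same)) (Fin.combine-remQuot {∣E∣ H} s j)))
          where
          same = I-injective (proj₁ (Fin.remQuot {∣E∣ H} s i)) (proj₂ (Fin.remQuot {∣E∣ H} s i))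
                             (proj₁ (Fin.remQuot {∣E∣ H} s j)) (proj₂ (Fin.remQuot {∣E∣ H} s j)) eq

        f-injective : ∀ {x y} → f x ≡ f y → x ≡ y
        f-injective {x} {y} eq = trans (sym (Fin.join-splitAt h (∣E∣ H * s) x))
          (trans (cong (Fin.join h (∣E∣ H * s)) (g-injective (Fin.splitAt h x) (Fin.splitAt h y) eq)) (Fin.join-splitAt h (∣E∣ H * s) y))

        f-branch : ∀ u → f (branch H s u) ≡ a u
        f-branch u = cong g (Fin.splitAt-↑ˡ h u (∣E∣ H * s))

        f-internal : ∀ e q → f (internal H s e q) ≡ I e q
        f-internal e q = trans (cong g (Fin.splitAt-↑ʳ h (∣E∣ H * s) (Fin.combine e q)))
          (cong (λ eq → I (proj₁ eq) (proj₂ eq)) (Fin.remQuot-combine e q))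

        f-path : ∀ e p → f (pathVertex H s e p) ≡ walkVertex (a (proj₁ (ends H s e))) (Q e) (len e) (a (proj₂ (ends H s e))) p
        f-path e zero    = f-branch (proj₁ (ends H s e))
        f-path e (suc p) = through (Fin.splitAt s p)
          where
          through : ∀ c → f ([ internal H s e , (λ _ → branch H s (proj₂ (ends H s e))) ]′ c) ≡
                          [ nth (Q e) (len e) , (λ _ → a (proj₂ (ends H s e))) ]′ c
          through (inj₁ q) = f-internal e q
          through (inj₂ _) = f-branch (proj₂ (ends H s e))

        consecutive : ∀ {x y} → Consecutive H s x y → R (f x) (f y)
        consecutive (e , p , refl , refl) = subst₂ R (sym (f-path e (Fin.inject₁ p))) (sym (f-path e (suc p)))
          (walkVertex-step (a (proj₁ (ends H s e))) (Q e) (len e) (a (proj₂ (ends H s e))) (walk e) p)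

        f-adj : ∀ x y → Adj (subdivision H s) x y → Adj G (f x) (f y)
        f-adj x y adj = R⇒Adj ([ consecutive , R-sym ∘ consecutive ]′ (toWitness adj))

      -- `L + suc L` counts the internal vertices of one path, the midpoint, and those of the
      -- reversed second path. The sides of the system exceed the numbers of vertices and edges of
      -- `H` by one, so that they are nonempty even for an empty `H`; therefore the indices are
      -- shifted by `suc`.
      system⇒subdivision : (G : Graph n) → (∀ {x y} → R x y → Adj G x y) → ∀ {L} →
        PathSystem (suc h) (suc (∣E∣ H)) L → Contains (subdivision H (L + suc L)) G
      system⇒subdivision G R⇒Adj {L} system = subdivision-copy G R⇒Adj (L + suc L) (λ u → a (suc u)) Q a-injective
          len′ walk′ unique′ a∉Q disj′
        where
        open PathSystem system
        E : Set
        E = Fin (∣E∣ H)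
        u v : E → Fin (suc h)
        u e = suc (proj₁ (ends H (L + suc L) e))
        v e = suc (proj₂ (ends H (L + suc L) e))
        u≢v : ∀ e → u e ≢ v e
        u≢v e eq = Fin.<⇒≢ (edge-< H (L + suc L) e) (Fin.suc-injective eq)
        back : E → List V
        back e = List.reverse (P (v e) (suc e))
        Q : E → List V
        Q e = P (u e) (suc e) ++ b (suc e) ∷ back e
        a-injective : ∀ {x y} → a (suc x) ≡ a (suc y) → x ≡ y
        a-injective {x} {y} eq = compare (x Fin.≟ y)
          where
          compare : Dec (x ≡ y) → x ≡ y
          compare (yes x≡y) = x≡y
          compare (no x≢y)  = contradiction eq (a-inj (x≢y ∘ Fin.suc-injective))
        len′ : ∀ e → length (Q e) ≡ L + suc L
        len′ e = trans (List.length-++ (P (u e) (suc e)))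
          (cong₂ _+_ (len (u e) (suc e)) (cong suc (trans (List.length-reverse (P (v e) (suc e))) (len (v e) (suc e)))))
        walk′ : ∀ e → Walk (a (u e)) (Q e) (a (v e))
        walk′ e = Walk-++ (P (u e) (suc e)) (walk (u e) (suc e)) (Walk-reverse (P (v e) (suc e)) (walk (v e) (suc e)))
        Part : E → V → Set
        Part e w = (∃[ i ] w ∈ P i (suc e)) ⊎ w ≡ b (suc e)
        parts : ∀ e {w} → w ∈ Q e → Part e w
        parts e w∈ = [ (λ w∈P → inj₁ (u e , w∈P)) , (λ { (here w≡b) → inj₂ w≡b ; (there w∈back) → inj₁ (v e , Any.reverse⁻ w∈back) }) ]′
          (∈-++⁻ (P (u e) (suc e)) w∈)
        unique′ : ∀ e → Unique (Q e)
        unique′ e = Unique-++ (unique (u e) (suc e))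
          (All.tabulate (λ w∈ b≡w → b∉P (v e) (suc e) (suc e) (Any.reverse⁻ (subst (_∈ back e) (sym b≡w) w∈))) ∷ Unique-reverse (unique (v e) (suc e)))
          (λ { w w∈ (here refl) → b∉P (u e) (suc e) (suc e) w∈
             ; w w∈ (there w∈back) → disj (λ eq → u≢v e (cong proj₁ eq)) w w∈ (Any.reverse⁻ w∈back) })
        a∉Q : ∀ x e → a (suc x) ∉ Q e
        a∉Q x e a∈ = [ (λ (i , a∈P) → a∉P i (suc e) (suc x) a∈P) , a≢b (suc x) (suc e) ]′ (parts e a∈)
        disj′ : ∀ {e e′} → e ≢ e′ → Disjoint (Q e) (Q e′)
        disj′ {e} {e′} e≢e′ w w∈ w∈′ = clash (parts e w∈) (parts e′ w∈′)
          where
          clash : Part e w → Part e′ w → ⊥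
          clash (inj₁ (i , w∈P)) (inj₁ (i′ , w∈P′)) = disj (λ eq → e≢e′ (Fin.suc-injective (cong proj₂ eq))) w w∈P w∈P′
          clash (inj₁ (i , w∈P)) (inj₂ refl)        = b∉P i (suc e) (suc e′) w∈P
          clash (inj₂ refl)      (inj₁ (i′ , w∈P′)) = b∉P i′ (suc e′) (suc e) w∈P′
          clash (inj₂ w≡b)       (inj₂ w≡b′)        = b-inj (e≢e′ ∘ Fin.suc-injective) (trans (sym w≡b) w≡b′)

  -- The choice of constants

  -- f c bounds the number of light paths with c internal vertices between two vertices, Mth c
  -- is the robustness threshold for such paths, and 1 / Q q is the admissible density of robust
  -- pairs with q + 1 internal vertices. Mth (suc q) and f (suc q) only depend on f q.
  module Constants (s′ L K κ M : ℕ) where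

    l : ℕ
    l = suc L

    thresholdFor : ℕ → ℕ
    -- This is `Mᵣ` of `Heavy` for the density `1 / Q`.
    thresholdFor Q = M * (1 + κ * (2 * Q * K * (K * (8 * Q * κ)) ^ suc s′))

    f Q Mth : ℕ → ℕ
    f zero    = 1
    f (suc c) = f c + thresholdFor (Q c) * (suc c * (f c * f c))
    Q q = κ * f q * (l * 4 ^ l)
    Mth zero    = 0
    Mth (suc q) = thresholdFor (Q q)

    f>0 : ∀ c → 0 < f c
    f>0 zero    = s≤s z≤n
    f>0 (suc c) = ℕ.≤-trans (f>0 c) (ℕ.m≤m+n (f c) _)

    -- A sum in place of a maximum: it dominates the condition `d-large` of `Heavy` for all `q < L`
    -- at once.
    d-heavy : ℕ
    d-heavy = sumUp L (λ q → 2 * suc s′ * (2 * Q q * κ))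

  sumUp-≥ : ∀ {k i} (f : ℕ → ℕ) → i < k → f i ≤ sumUp k f
  sumUp-≥ {suc k} {zero}  f _         = ℕ.m≤m+n (f 0) _
  sumUp-≥ {suc k} {suc i} f (s≤s i<k) = ℕ.≤-trans (sumUp-≥ (f ∘ suc) i<k) (ℕ.m≤n+m _ (f 0))

  module Regular {n : ℕ} (R : Fin n → Fin n → Set) (R? : ∀ x y → Dec (R x y))
                 (R-sym : ∀ {x y} → R x y → R y x)
                 (S : Fin n → Bool) (R⇒S : ∀ {x y} → R x y → T (S x))
                 (s′ t L K κ M A E d : ℕ) where

    open Constants s′ L K κ M
    open Walks R R? R-sym

    private
      s : ℕ
      s = suc s′

    -- The system comes from `Heavy` if some vertex has too many robust pairs, and from `Assemble`
    -- otherwise. The double negation avoids deciding between the cases: without a system, no vertex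
    -- is heavy, and then the light paths yield one. It suffices for contradicting `Free`.
    regular⇒system : 0 < d → 0 < K → 0 < t → (∀ m → m ≤ l → K ^ m ≤ κ) →
      2 + (s + t + s * t * L) + L ≤ M → 4 ^ l * f L ≤ A →
      2 * A * κ * (8 * A) ^ s * (t * (s * (2 + L) * (l * κ))) ≤ E →
      d-heavy ≤ d → 2 * l ≤ d → 2 * (s * (l * (l * κ))) * (2 * A) ≤ d →
      8 * A * E * size S ^ s < d ^ suc (l * s) → 0 < size S →
      (∀ x → T (S x) → d ≤ cnt (R? x)) → (∀ x → cnt (R? x) ≤ K * d) →
      ¬ ¬ PathSystem s t L
    regular⇒system 0<d 0<K 0<t K^≤κ M-large A-bound E-bound d₁ d₂ d₃ sparse 0<N deg≥ deg≤ none =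
      none (light⇒system s′ t K L d κ A E deg≤ 0<d 0<K 0<A 0<t (K^≤κ l ℕ.≤-refl) A-bound E-bound d₃
        (many-light-paths K κ L d deg≥ deg≤ (λ m m≤L → K^≤κ m (ℕ.m≤n⇒m≤1+n m≤L)) d₂ heavy≤ l ℕ.≤-refl)
        sparse 0<N)
      where
      f-step : ∀ c → f c + Mth (suc c) * (suc c * (f c * f c)) ≤ f (suc c)
      f-step c = ℕ.≤-refl
      open Growth R R? R-sym S R⇒S Mth
      open Bounds f ℕ.≤-refl f-step
      open Assemble R R? R-sym S R⇒S Mth f ℕ.≤-refl f-step using (light⇒system)
      0<A : 0 < A
      0<A = ℕ.≤-trans (ℕ.*-mono-≤ {1} {4 ^ l} (ℕ.m^n>0 4 l) (f>0 L)) A-bound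
      0<κ : 0 < κ
      0<κ = K^≤κ 0 z≤n
      0<Q : ∀ q → 0 < Q q
      0<Q q = ℕ.*-mono-≤ {1} {κ * f q} (ℕ.*-mono-≤ {1} {κ} 0<κ (f>0 q)) (ℕ.*-mono-≤ {1} {l} (s≤s z≤n) (ℕ.m^n>0 4 l))
      heavy≤ : ∀ q x → suc q ≤ L → κ * f q * (l * 4 ^ l) * heavyPairs (suc q) x ≤ d ^ (2 + q)
      heavy≤ q x q<L = ℕ.≮⇒≥ (λ many → none (subst (PathSystem s t) r+c≡L
          (Heavy.robust⇒system R R? R-sym K d 0<d deg≤ s′ t q r M κ (Q q) (0<Q q) 0<κ
            (K^≤κ (suc q) (ℕ.m≤n⇒m≤1+n q<L)) M-large′ (ℕ.≤-trans (sumUp-≥ (λ q → 2 * s * (2 * Q q * κ)) q<L) d₁) x many)))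
        where
        r : ℕ
        r = L ∸ suc q
        r+c≡L : r + suc q ≡ L
        r+c≡L = ℕ.m∸n+n≡m q<L
        M-large′ : 2 + (s + t + s * t * (r + suc q)) + r ≤ M
        M-large′ = subst (λ k → 2 + (s + t + s * t * k) + r ≤ M) (sym r+c≡L)
          (ℕ.≤-trans (ℕ.+-monoʳ-≤ (2 + (s + t + s * t * L)) (ℕ.m∸n≤m L (suc q))) M-large)

  -- From edge counts to the extremal number

  length-filter-cartesianProduct : ∀ {m n} {A : Set} {P : A × Fin n → Set} (P? : ∀ e → Dec (P e)) (f : Fin m → A) →
    length (filter P? (List.cartesianProduct (List.tabulate f) (allFin n))) ≡ ∑ (λ x → ∑ (λ y → ind (P? (f x , y))))
  length-filter-cartesianProduct {zero} P? f = refl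
  length-filter-cartesianProduct {suc m} {n} P? f =
    trans (cong length (List.filter-++ P? (List.map (f zero ,_) (allFin n)) (List.cartesianProduct (List.tabulate (f ∘ suc)) (allFin n))))
      (trans (List.length-++ (filter P? (List.map (f zero ,_) (allFin n))))
        (cong₂ _+_ (row id) (length-filter-cartesianProduct P? (f ∘ suc))))
    where
    row : ∀ {k} (g : Fin k → Fin n) →
          length (filter P? (List.map (f zero ,_) (List.tabulate g))) ≡ ∑ (λ y → ind (P? (f zero , g y)))
    row {zero}  g = refl
    row {suc k} g with P? (f zero , g zero)
    ... | yes _ = cong suc (row (g ∘ suc))
    ... | no _  = row (g ∘ suc)

  module EdgeBound {h : ℕ} (H : Graph h) (L K κ M A E C′ : ℕ) where

    open Constants h L K κ M hiding (Q; Mth)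

    s t v w K₁ C : ℕ
    s = suc h
    t = suc (∣E∣ H)
    v = suc (l * s)
    w = s + v
    K₁ = 4 ^ v * 3 ^ w
    C  = 16 * C′

    module _ (K-bound : 16 * K₁ ≤ K) (K^≤κ : ∀ m → m ≤ l → K ^ m ≤ κ)
             (M-large : 2 + (s + t + s * t * L) + L ≤ M) (A-bound : 4 ^ l * f L ≤ A)
             (E-bound : 2 * A * κ * (8 * A) ^ s * (t * (s * (2 + L) * (l * κ))) ≤ E)
             (C₁ : d-heavy ≤ C′) (C₂ : 2 * l ≤ C′) (C₃ : 2 * (s * (l * (l * κ))) * (2 * A) ≤ C′)
             (C₄ : 8 * A * E < C′) (C₅ : K₁ ≤ C′) where

      private
        0<C′ : 0 < C′
        0<C′ = ℕ.≤-trans (s≤s z≤n) C₄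

      module _ {n : ℕ} (G : Graph n) (free : Free (subdivision H (L + suc L)) G) where

        private
          adj? : ∀ x y → Dec (Adj G x y)
          adj? x y = T? (adj G x y)

          adj-sym : ∀ {x y} → Adj G x y → Adj G y x
          adj-sym {x} {y} = subst T (symm G x y)

        open AlmostRegular (Adj G) adj? adj-sym

        no-almost-regular : ¬ (∃[ S ] ∃[ d ] ((∀ x → T (S x) → d ≤ deg S x × deg S x ≤ 16 * K₁ * d) ×
                               (∃[ x ] T (S x)) × C′ ^ v * size S ^ s ≤ d ^ v))
        no-almost-regular (S , d , degrees , (x₀ , x₀∈) , large) =
          Regular.regular⇒system R R? R-sym S proj₁ h t L K κ M A E d 0<d 0<K (s≤s z≤n) K^≤κ M-large A-bound E-bound
            (ℕ.≤-trans C₁ C′≤d) (ℕ.≤-trans C₂ C′≤d) (ℕ.≤-trans C₃ C′≤d) sparse 0<N deg≥ deg≤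
            (λ system → free (system⇒subdivision R R? R-sym H G (proj₂ ∘ proj₂) system))
          where
          R : Fin n → Fin n → Set
          R x y = T (S x) × T (S y) × Adj G x y
          R? : ∀ x y → Dec (R x y)
          R? x y = T? (S x) ×-dec T? (S y) ×-dec adj? x y
          R-sym : ∀ {x y} → R x y → R y x
          R-sym (x∈ , y∈ , e) = y∈ , x∈ , adj-sym e
          0<N : 0 < size S
          0<N = ∃⇒cnt>0 (λ x → T? (S x)) x₀ x₀∈
          instance
            N^s≢0 : NonZero (size S ^ s)
            N^s≢0 = ℕ.m^n≢0 (size S) s {{>-nonZero 0<N}}
          -- Since `S` is nonempty, the density bound alone makes `d` at least `C′`, so every lower
          -- bound required of `d` can be imposed on `C′`.
          C′≤d : C′ ≤ d
          C′≤d = ^-cancel-≤ (l * s) (ℕ.≤-trans (ℕ.m≤m*n (C′ ^ v) (size S ^ s)) large)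
          0<d : 0 < d
          0<d = ℕ.≤-trans 0<C′ C′≤d
          0<K : 0 < K
          0<K = ℕ.≤-trans (ℕ.*-mono-≤ {1} {16} (s≤s z≤n) (ℕ.*-mono-≤ {1} {4 ^ v} (ℕ.m^n>0 4 v) (ℕ.m^n>0 3 w))) K-bound
          sparse : 8 * A * E * size S ^ s < d ^ v
          sparse = begin-strict
            8 * A * E * size S ^ s   <⟨ ℕ.*-monoˡ-< (size S ^ s) C₄ ⟩
            C′ * size S ^ s   ≤⟨ ℕ.*-monoˡ-≤ (size S ^ s) (ℕ.m≤m*n C′ (C′ ^ (l * s)) {{ℕ.m^n≢0 C′ (l * s) {{>-nonZero 0<C′}}}}) ⟩
            C′ ^ v * size S ^ s   ≤⟨ large ⟩
            d ^ v                     ∎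
          deg≥ : ∀ x → T (S x) → d ≤ cnt (R? x)
          deg≥ x x∈ = ℕ.≤-trans (proj₁ (degrees x x∈))
            (cnt-mono (λ y → T? (S y) ×-dec adj? x y) (R? x) (λ y (y∈ , e) → x∈ , y∈ , e))
          deg≤ : ∀ x → cnt (R? x) ≤ K * d
          deg≤ x = decide (T? (S x))
            where
            decide : Dec (T (S x)) → cnt (R? x) ≤ K * d
            decide (yes x∈) = ℕ.≤-trans (cnt-mono (R? x) (λ y → T? (S y) ×-dec adj? x y) (λ y → proj₂))
              (ℕ.≤-trans (proj₂ (degrees x x∈)) (ℕ.*-monoˡ-≤ d K-bound))
            decide (no x∉)  = ℕ.≤-trans (ℕ.≤-reflexive (trans (∑-cong (λ y → ind-no (R? x y) (x∉ ∘ proj₁))) (∑-0 n))) z≤n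

        open Regularise h (l * s) C′ using (almost-regular)

        -- Induction on the size takes the place of a minimal counterexample: its hypothesis is the
        -- `sparse` argument of `almost-regular`.
        vol-bound : ∀ k S → size S < k → vol S ^ v ≤ C ^ v * size S ^ w
        vol-bound (suc k) S lt = ℕ.≮⇒≥ (λ dense → no-almost-regular (almost-regular S dense
          (λ S′ smaller → vol-bound k S′ (ℕ.≤-trans smaller (s≤s⁻¹ lt)))
          (ℕ.≤-trans C₅ (ℕ.m≤n*m C′ 16))))

        everything : Fin n → Bool
        everything _ = true

        edges≤vol : ∣E∣ G ≤ vol everything
        edges≤vol = ℕ.≤-trans (ℕ.≤-reflexive (length-filter-cartesianProduct (isEdge? G) id))
          (∑-mono (λ x → ℕ.≤-trans (∑-mono (λ y → ind-mono (isEdge? G (x , y)) (T? (everything y) ×-dec adj? x y) (λ (_ , e) → tt , e)))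
            (ℕ.≤-reflexive (sym (ℕ.+-identityʳ (deg everything x))))))

        edge-bound : ∣E∣ G ^ v ≤ C ^ v * n ^ w
        edge-bound = begin
          ∣E∣ G ^ v   ≤⟨ ℕ.^-monoˡ-≤ v edges≤vol ⟩
          vol everything ^ v   ≤⟨ vol-bound (suc (size everything)) everything ℕ.≤-refl ⟩
          C ^ v * size everything ^ w   ≤⟨ ℕ.*-monoʳ-≤ (C ^ v) (ℕ.^-monoˡ-≤ w (cnt-≤ (λ x → T? (everything x)))) ⟩
          C ^ v * n ^ w                  ∎

      ex-bound : ∀ n → ex n (subdivision H (L + suc L)) ^ v ≤ C ^ v * n ^ w
      ex-bound n = [ (λ ex≡0 → ℕ.≤-trans (ℕ.≤-reflexive (cong (_^ v) ex≡0)) z≤n) , attained ]′ (argmax-sel id 0 counts)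
        where
        F = subdivision H (L + suc L)
        counts : List ℕ
        counts = List.map ∣E∣ (filter (free? F) (allGraphs {n}))
        attained : ex n F ∈ counts → ex n F ^ v ≤ C ^ v * n ^ w
        attained ex∈ = bound (∈-map⁻ ∣E∣ ex∈)
          where
          bound : ∃[ G ] (G ∈ filter (free? F) (allGraphs {n}) × ex n F ≡ ∣E∣ G) → ex n F ^ v ≤ C ^ v * n ^ w
          bound (G , G∈ , ex≡) = ℕ.≤-trans (ℕ.≤-reflexive (cong (_^ v) ex≡))
            (edge-bound G (proj₂ (∈-filter⁻ (free? F) {xs = allGraphs} G∈)))

  -- The exponent

  open import Data.Integer.Base using (+_)

  common-bound : ∀ a b c e g → ∃[ m ] (a ≤ m × b ≤ m × c ≤ m × e ≤ m × g ≤ m)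
  common-bound a b c e g = a ℕ.⊔ (b ℕ.⊔ (c ℕ.⊔ (e ℕ.⊔ g))) , ℕ.m≤m⊔n a _ ,
      ℕ.≤-trans (ℕ.m≤m⊔n b _) r₁ , ℕ.≤-trans (ℕ.m≤m⊔n c _) r₂ ,
      ℕ.≤-trans (ℕ.m≤m⊔n e g) r₃ , ℕ.≤-trans (ℕ.m≤n⊔m e g) r₃
    where
    r₁ : b ℕ.⊔ (c ℕ.⊔ (e ℕ.⊔ g)) ≤ a ℕ.⊔ (b ℕ.⊔ (c ℕ.⊔ (e ℕ.⊔ g)))
    r₁ = ℕ.m≤n⊔m a _
    r₂ : c ℕ.⊔ (e ℕ.⊔ g) ≤ a ℕ.⊔ (b ℕ.⊔ (c ℕ.⊔ (e ℕ.⊔ g)))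
    r₂ = ℕ.≤-trans (ℕ.m≤n⊔m b _) r₁
    r₃ : e ℕ.⊔ g ≤ a ℕ.⊔ (b ℕ.⊔ (c ℕ.⊔ (e ℕ.⊔ g)))
    r₃ = ℕ.≤-trans (ℕ.m≤n⊔m c _) r₂

  -- The constants are fixed in the order `K`, `κ`, `M`, `A`, `E`, `C′`, each in terms of earlier
  -- ones. Every one enters as a variable with lower bounds, so that later formulas keep it
  -- abstract.
  ∃-ex-bound : ∀ {h} (H : Graph h) L → let v = suc (suc L * suc h) in
    ∃[ C ] (∀ n → ex n (subdivision H (L + suc L)) ^ v ≤ C ^ v * n ^ (suc h + v))
  ∃-ex-bound {h} H L = withK (16 * (4 ^ v * 3 ^ (s + v))) ℕ.≤-refl
      (ℕ.*-mono-≤ {1} {16} (s≤s z≤n) (ℕ.*-mono-≤ {1} {4 ^ v} (ℕ.m^n>0 4 v) (ℕ.m^n>0 3 (s + v))))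
    where
    l s t v : ℕ
    l = suc L
    s = suc h
    t = suc (∣E∣ H)
    v = suc (l * s)
    Result : Set
    Result = ∃[ C ] (∀ n → ex n (subdivision H (L + suc L)) ^ v ≤ C ^ v * n ^ (s + v))
    module _ (K : ℕ) (K-bound : 16 * (4 ^ v * 3 ^ (s + v)) ≤ K) (0<K : 0 < K) where
      withκMAE : ∀ κ M A E → (∀ m → m ≤ l → K ^ m ≤ κ) → 2 + (s + t + s * t * L) + L ≤ M →
                 4 ^ l * Constants.f h L K κ M L ≤ A →
                 2 * A * κ * (8 * A) ^ s * (t * (s * (2 + L) * (l * κ))) ≤ E → Result
      withκMAE κ M A E κ-bound M-bound A-bound E-bound =
        let C′ , C₁ , C₂ , C₃ , C₄ , C₅ = common-bound (Constants.d-heavy h L K κ M) (2 * l)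
              (2 * (s * (l * (l * κ))) * (2 * A)) (suc (8 * A * E)) (4 ^ v * 3 ^ (s + v)) in
        16 * C′ , EdgeBound.ex-bound H L K κ M A E C′ K-bound κ-bound M-bound A-bound E-bound C₁ C₂ C₃ C₄ C₅
      withA : ∀ κ M A → (∀ m → m ≤ l → K ^ m ≤ κ) → 2 + (s + t + s * t * L) + L ≤ M →
              4 ^ l * Constants.f h L K κ M L ≤ A → Result
      withA κ M A κ-bound M-bound A-bound = withκMAE κ M A _ κ-bound M-bound A-bound ℕ.≤-refl
      withκM : ∀ κ M → (∀ m → m ≤ l → K ^ m ≤ κ) → 2 + (s + t + s * t * L) + L ≤ M → Result
      withκM κ M κ-bound M-bound = withA κ M _ κ-bound M-bound ℕ.≤-refl
      withK : Result
      withK = withκM (K ^ l) _ (λ m m≤l → ℕ.^-monoʳ-≤ K {{>-nonZero 0<K}} m≤l) ℕ.≤-refl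

  ≤·^ℚ-intro : ∀ x C n e a → ℚᵘ.↥ e ≡ + a → x ^ ℚᵘ.↧ₙ e ≤ C ^ ℚᵘ.↧ₙ e * n ^ a → x ≤ C · n ^ℚ e
  ≤·^ℚ-intro x C n e a eq le with ℚᵘ.↥ e | eq
  ... | + .a | refl = le

  raise : ∀ x C n v w m → x ^ v ≤ C ^ v * n ^ w → x ^ (v * m) ≤ C ^ (v * m) * n ^ (w * m)
  raise x C n v w m le = begin
    x ^ (v * m)   ≡⟨ ℕ.^-*-assoc x v m ⟨
    (x ^ v) ^ m   ≤⟨ ℕ.^-monoˡ-≤ m le ⟩
    (C ^ v * n ^ w) ^ m   ≡⟨ ^-distrib-* (C ^ v) (n ^ w) m ⟩
    (C ^ v) ^ m * (n ^ w) ^ m   ≡⟨ cong₂ _*_ (ℕ.^-*-assoc C v m) (ℕ.^-*-assoc n w m) ⟩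
    C ^ (v * m) * n ^ (w * m)       ∎

  exponent-bound : ∀ (g : ℕ → ℕ) C e v w m → ℚᵘ.↥ e ≡ + (w * m) → ℚᵘ.↧ₙ e ≡ v * m →
                   (∀ n → g n ^ v ≤ C ^ v * n ^ w) → g =O[n^ e ]
  exponent-bound g C e v w m num den bound = C , 0 , λ n _ → ≤·^ℚ-intro (g n) C n e (w * m) num
    (subst (λ b → g n ^ b ≤ C ^ b * n ^ (w * m)) (sym den) (raise (g n) C n v w m (bound n)))

  -- With k = 2 l and v = l s + 1, the exponent 1 + 2 / k - 1 / (l v) is (s + v) / v.
  module Exponent (L s : ℕ) where

    l k v m : ℕ
    l = suc L
    k = l * 2
    v = suc (l * s)
    -- The unnormalised denominator of `e` is `2 * l` times `l * v`, so the fraction `(s + v) / v`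
    -- appears expanded by `2 * l * l`.
    m = 2 * l * l

    δ e : ℚᵘ
    δ = + 1 ℚᵘ./ (l * v)
    e = 1ℚᵘ ℚᵘ.+ (+ 2 ℚᵘ./ k) ℚᵘ.- δ

    numerator : ℚᵘ.↥ e ≡ + ((s + v) * m)
    numerator = trans (cong₂ ℤ._+_ positive negative) (trans (cong (λ i → i ℤ.+ ℤ.- (+ k)) (trans (cong +_ (split L s)) (ℤ.pos-+ ((s + v) * m) k)))
      (trans (ℤ.+-assoc (+ ((s + v) * m)) (+ k) (ℤ.- (+ k))) (trans (cong (λ i → + ((s + v) * m) ℤ.+ i) (ℤ.+-inverseʳ (+ k))) (ℤ.+-identityʳ _))))
      where
      positive : (+ 1 ℤ.* + k ℤ.+ + 2 ℤ.* + 1) ℤ.* + (l * v) ≡ + ((k + 2) * (l * v))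
      positive = trans (cong (λ i → (i ℤ.+ + 2) ℤ.* + (l * v)) (ℤ.*-identityˡ (+ k))) (sym (ℤ.pos-* (k + 2) (l * v)))
      negative : ℤ.-1ℤ ℤ.* + (1 * k) ≡ ℤ.- (+ k)
      negative = trans (ℤ.-1*i≡-i (+ (1 * k))) (cong (λ i → ℤ.- (+ i)) (ℕ.*-identityˡ k))
      split : ∀ L s → (suc L * 2 + 2) * (suc L * suc (suc L * s)) ≡
                      (s + suc (suc L * s)) * (2 * suc L * suc L) + suc L * 2
      split = solve-∀

    denominator : ℚᵘ.↧ₙ e ≡ v * m
    denominator = product L s
      where
      product : ∀ L s → (1 * (suc L * 2)) * (suc L * suc (suc L * s)) ≡ suc (suc L * s) * (2 * suc L * suc L)
      product = solve-∀

  ∃-ex-bound′ : ∀ {h} (H : Graph h) L → ∃[ C ] (∀ n → ex n (subdivision H (suc L * 2 ∸ 1)) ^ Exponent.v L (suc h) ≤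
                  C ^ Exponent.v L (suc h) * n ^ (suc h + Exponent.v L (suc h)))
  ∃-ex-bound′ {h} H L = subst (λ i → ∃[ C ] (∀ n → ex n (subdivision H i) ^ Exponent.v L (suc h) ≤
                  C ^ Exponent.v L (suc h) * n ^ (suc h + Exponent.v L (suc h)))) L+1+L (∃-ex-bound H L)
    where
    L+1+L : L + suc L ≡ suc L * 2 ∸ 1
    L+1+L = trans (ℕ.+-suc L L) (cong suc (trans (cong (L ℕ.+_) (sym (ℕ.+-identityʳ L))) (ℕ.*-comm 2 L)))

  ex-O : ∀ {h} (H : Graph h) L → (λ n → ex n (subdivision H (suc L * 2 ∸ 1))) =O[n^ 1ℚᵘ ℚᵘ.+ (+ 2 ℚᵘ./ (suc L * 2)) ℚᵘ.- Exponent.δ L (suc h) ]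
  ex-O {h} H L = exponent-bound (λ n → ex n (subdivision H (suc L * 2 ∸ 1))) (proj₁ bound) (1ℚᵘ ℚᵘ.+ (+ 2 ℚᵘ./ (suc L * 2)) ℚᵘ.- Exponent.δ L (suc h)) v (suc h + v) m
      numerator denominator (proj₂ bound)
    where
    open Exponent L (suc h)
    bound = ∃-ex-bound′ H L

  δ>0 : ∀ L s → 0ℚᵘ ℚᵘ.< Exponent.δ L s
  δ>0 L s = ℚᵘ.positive⁻¹ (Exponent.δ L s)

open import Defs
open import Data.Integer.Base using (+_)
open import Data.Nat.Base using (ℕ; zero; suc; NonZero; _≤_; _∸_)
open import Data.Nat.Divisibility using (_∣_; divides)
open import Data.Product.Base using (_×_; _,_; ∃-syntax)
open import Data.Rational.Unnormalised.Base using (ℚᵘ; 0ℚᵘ; 1ℚᵘ; _<_; _+_; _-_; _/_)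
open import Relation.Binary.PropositionalEquality using (refl)

open SubdivisionBound using (module Exponent; δ>0; ex-O)

theorem1p18 : (k : ℕ) .{{_ : NonZero k}} → 2 ≤ k → 2 ∣ k →
    ∀ {h : ℕ} (H : Graph h) →
    ∃[ δ ] (0ℚᵘ < δ × (λ n → ex n (subdivision H (k ∸ 1))) =O[n^ 1ℚᵘ + (+ 2 / k) - δ ])
theorem1p18 .0 ()  (divides zero refl) H
theorem1p18 ._ 2≤k (divides (suc L) refl) {h} H = Exponent.δ L (suc h) , δ>0 L (suc h) , ex-O H L
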